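{- There is a function $g$ such that for every Steiner graph $(G,T)$ and every facet defining inequality $cx\ge\gamma$ (in minimum integer form) of the Steiner cut dominant $\mathrm{CUT}_+(G,T)$, the right-hand side $\gamma$ and all coefficients $c_e$ ($e\in E(G)$) are bounded from above by $g(|T|)$.
   Context: Graphs are finite and have no loops or multiple edges. A Steiner graph $(G,T)$ consists of a connected graph $G$ with node set $V(G)$ and edge set $E(G)$ and a set $T\subseteq V(G)$ of terminals with $|T|\ge 2$. For $S\subseteq V(G)$, $\delta(S)$ is the set of edges with exactly one endnode in $S$. The cut $\delta(S)$ is a $T$-Steiner cut if $T\cap S\neq\varnothing$ and $T\setminus S\neq\varnothing$. The $T$-Steiner cut dominant is $\mathrm{CUT}_+(G,T)=\mathrm{conv}\{\chi(\delta(S)) : \delta(S)\text{ a }T\text{ -Steiner cut}\}+\mathbb{R}_{\ge 0}^{E(G)}$, where $\chi(\cdot)$ denotes the $0/1$ incidence vector in $\mathbb{R}^{E(G)}$. (Since the recession cone is the nonnegative orthant, every valid inequality $cx\ge\gamma$ has $c\ge 0$.) An inequality $cx\ge\gamma$ is in minimum integer form if the components of its coefficient vector $c$ are nonnegative integers with greatest common divisor one. -}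

module Defs where

open import Data.Bool.Base using (if_then_else_; _xor_)
open import Data.Fin.Base using (Fin)
import Data.Fin.Base as Fin
open import Data.Fin.Subset using (Subset; _∩_; _─_; Nonempty)
import Data.Fin.Subset as Subset
open import Data.Integer.Base using (+_)
open import Data.Nat.Base using (ℕ; suc; _⊔_)
import Data.Nat.Base as ℕ
open import Data.Nat.GCD using (gcd)
import Data.Nat.Properties as ℕₚ
open import Data.Product.Base using (Σ-syntax; ∃-syntax; _×_; _,_)
open import Data.Rational.Base using (ℚ; 0ℚ; 1ℚ; ½)
import Data.Rational.Base as ℚ
import Data.Rational.Properties as ℚₚ
open import Data.Rational.Solver using (module +-*-Solver)
open import Data.Sum.Base using (_⊎_)
open import Data.Vec.Base using (lookup; tabulate)
open import Data.Vec.Functional using (Vector; foldr; zipWith)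
open import Level using (0ℓ)
open import Relation.Binary.Construct.Closure.ReflexiveTransitive using (Star)
open import Relation.Binary.PropositionalEquality
  using (_≡_; refl; sym; trans; cong; cong₂; subst)
open import Relation.Nullary.Negation using (¬_)
open import Relation.Unary using (Pred)

-- Real numbers (Cantor): Cauchy sequences of rationals, compared by the
-- equivalence _≈_ rather than by _≡_.

IsCauchy : (ℕ → ℚ) → Set
IsCauchy x = ∀ ε → 0ℚ ℚ.< ε →
  Σ[ N ∈ ℕ ] (∀ m n → N ℕ.≤ m → N ℕ.≤ n → ℚ.∣ x m ℚ.- x n ∣ ℚ.≤ ε)

record ℝ : Set where
  constructor mkℝ
  field
    seq    : ℕ → ℚ
    cauchy : IsCauchy seq

open ℝ public

infix 4 _≈_ _≤_

_≈_ : ℝ → ℝ → Set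
x ≈ y = ∀ ε → 0ℚ ℚ.< ε →
  Σ[ N ∈ ℕ ] (∀ n → N ℕ.≤ n → ℚ.∣ seq x n ℚ.- seq y n ∣ ℚ.≤ ε)

_≤_ : ℝ → ℝ → Set
x ≤ y = ∀ ε → 0ℚ ℚ.< ε →
  Σ[ N ∈ ℕ ] (∀ n → N ℕ.≤ n → seq x n ℚ.≤ seq y n ℚ.+ ε)

fromℚ : ℚ → ℝ
fromℚ q = mkℝ (λ _ → q) λ ε 0<ε → 0 , λ _ _ _ _ →
  subst (ℚ._≤ ε) (sym (cong ℚ.∣_∣ (ℚₚ.+-inverseʳ q))) (ℚₚ.<⇒≤ 0<ε)

fromℕ : ℕ → ℝ
fromℕ k = fromℚ (+ k ℚ./ 1)

0ℝ 1ℝ : ℝ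
0ℝ = fromℚ 0ℚ
1ℝ = fromℚ 1ℚ

private
  open ℚₚ.≤-Reasoning
  open +-*-Solver using (solve; _:=_; _:+_; _:*_; _:-_)

  +-difference : ∀ a b c d → (a ℚ.+ b) ℚ.- (c ℚ.+ d) ≡ (a ℚ.- c) ℚ.+ (b ℚ.- d)
  +-difference = solve 4 (λ a b c d → (a :+ b) :- (c :+ d) := (a :- c) :+ (b :- d)) refl

  *-difference : ∀ a b c d → a ℚ.* b ℚ.- c ℚ.* d ≡ a ℚ.* (b ℚ.- d) ℚ.+ d ℚ.* (a ℚ.- c)
  *-difference = solve 4 (λ a b c d → a :* b :- c :* d := a :* (b :- d) :+ d :* (a :- c)) refl

  add-difference : ∀ a b → a ≡ (a ℚ.- b) ℚ.+ b
  add-difference = solve 2 (λ a b → a := (a :- b) :+ b) refl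

  0<½* : ∀ {ε} → 0ℚ ℚ.< ε → 0ℚ ℚ.< ½ ℚ.* ε
  0<½* 0<ε = ℚₚ.*-monoʳ-<-pos ½ 0<ε

  halves : ∀ ε → ½ ℚ.* ε ℚ.+ ½ ℚ.* ε ≡ ε
  halves ε = trans (sym (ℚₚ.*-distribʳ-+ ε ½ ½)) (ℚₚ.*-identityˡ ε)

  ⊔-≤ˡ : ∀ {N M m} → N ⊔ M ℕ.≤ m → N ℕ.≤ m
  ⊔-≤ˡ {N} {M} = ℕₚ.≤-trans (ℕₚ.m≤m⊔n N M)

  ⊔-≤ʳ : ∀ {N M m} → N ⊔ M ℕ.≤ m → M ℕ.≤ m
  ⊔-≤ʳ {N} {M} = ℕₚ.≤-trans (ℕₚ.m≤n⊔m N M)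

  abstract
    +-cauchy : ∀ x y → IsCauchy (λ n → seq x n ℚ.+ seq y n)
    +-cauchy x y ε 0<ε with cauchy x (½ ℚ.* ε) (0<½* 0<ε) | cauchy y (½ ℚ.* ε) (0<½* 0<ε)
    ... | N , p | M , q = N ⊔ M , λ m n Nm Nn → begin
      ℚ.∣ (seq x m ℚ.+ seq y m) ℚ.- (seq x n ℚ.+ seq y n) ∣
        ≡⟨ cong ℚ.∣_∣ (+-difference (seq x m) (seq y m) (seq x n) (seq y n)) ⟩
      ℚ.∣ (seq x m ℚ.- seq x n) ℚ.+ (seq y m ℚ.- seq y n) ∣
        ≤⟨ ℚₚ.∣p+q∣≤∣p∣+∣q∣ (seq x m ℚ.- seq x n) (seq y m ℚ.- seq y n) ⟩
      ℚ.∣ seq x m ℚ.- seq x n ∣ ℚ.+ ℚ.∣ seq y m ℚ.- seq y n ∣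
        ≤⟨ ℚₚ.+-mono-≤ (p m n (⊔-≤ˡ Nm) (⊔-≤ˡ Nn))
                       (q m n (⊔-≤ʳ {N} Nm) (⊔-≤ʳ {N} Nn)) ⟩
      ½ ℚ.* ε ℚ.+ ½ ℚ.* ε
        ≡⟨ halves ε ⟩
      ε ∎

  bounded : ∀ x → Σ[ B ∈ ℚ ] (ℚ.Positive B ×
    Σ[ N ∈ ℕ ] (∀ n → N ℕ.≤ n → ℚ.∣ seq x n ∣ ℚ.≤ B))
  bounded x with cauchy x 1ℚ (ℚₚ.positive⁻¹ 1ℚ)
  ... | N , p = 1ℚ ℚ.+ ℚ.∣ seq x N ∣
              , ℚₚ.pos+nonNeg⇒pos 1ℚ ℚ.∣ seq x N ∣ {{ℚₚ.∣-∣-nonNeg (seq x N)}}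
              , N , λ n Nn → begin
    ℚ.∣ seq x n ∣
      ≡⟨ cong ℚ.∣_∣ (add-difference (seq x n) (seq x N)) ⟩
    ℚ.∣ (seq x n ℚ.- seq x N) ℚ.+ seq x N ∣
      ≤⟨ ℚₚ.∣p+q∣≤∣p∣+∣q∣ (seq x n ℚ.- seq x N) (seq x N) ⟩
    ℚ.∣ seq x n ℚ.- seq x N ∣ ℚ.+ ℚ.∣ seq x N ∣
      ≤⟨ ℚₚ.+-monoˡ-≤ ℚ.∣ seq x N ∣ (p n N Nn ℕₚ.≤-refl) ⟩
    1ℚ ℚ.+ ℚ.∣ seq x N ∣ ∎

  divide : ∀ B → ℚ.Positive B → ∀ ε → 0ℚ ℚ.< ε →
    Σ[ η ∈ ℚ ] (0ℚ ℚ.< η × B ℚ.* η ≡ ε)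
  divide B B>0 ε 0<ε =
      1/B ℚ.* ε
    , ℚₚ.positive⁻¹ _ {{ℚₚ.pos*pos⇒pos 1/B {{ℚₚ.1/pos⇒pos B}} ε {{ℚ.positive 0<ε}}}}
    , trans (sym (ℚₚ.*-assoc B 1/B ε))
        (trans (cong (ℚ._* ε) (ℚₚ.*-inverseʳ B)) (ℚₚ.*-identityˡ ε))
    where
    instance
      _ = B>0
      _ = ℚₚ.pos⇒nonZero B
    1/B = ℚ.1/ B

  *-bound : ∀ p q {B η} → ℚ.Positive B → ℚ.∣ p ∣ ℚ.≤ B → ℚ.∣ q ∣ ℚ.≤ η →
    ℚ.∣ p ℚ.* q ∣ ℚ.≤ B ℚ.* η
  *-bound p q {B} {η} B>0 p≤B q≤η = begin
    ℚ.∣ p ℚ.* q ∣           ≡⟨ ℚₚ.∣p*q∣≡∣p∣*∣q∣ p q ⟩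
    ℚ.∣ p ∣ ℚ.* ℚ.∣ q ∣     ≤⟨ ℚₚ.*-monoʳ-≤-nonNeg ℚ.∣ q ∣ {{ℚₚ.∣-∣-nonNeg q}} p≤B ⟩
    B ℚ.* ℚ.∣ q ∣           ≤⟨ ℚₚ.*-monoˡ-≤-nonNeg B {{ℚₚ.pos⇒nonNeg B {{B>0}}}} q≤η ⟩
    B ℚ.* η                 ∎

  *-estimate : ∀ a b c d {B C η θ ε} → ℚ.Positive B → ℚ.Positive C →
    ℚ.∣ a ∣ ℚ.≤ B → ℚ.∣ d ∣ ℚ.≤ C → ℚ.∣ b ℚ.- d ∣ ℚ.≤ η → ℚ.∣ a ℚ.- c ∣ ℚ.≤ θ →
    B ℚ.* η ≡ ½ ℚ.* ε → C ℚ.* θ ≡ ½ ℚ.* ε →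
    ℚ.∣ a ℚ.* b ℚ.- c ℚ.* d ∣ ℚ.≤ ε
  *-estimate a b c d {B} {C} {η} {θ} {ε} B>0 C>0 aB dC bd ac Bη Cθ = begin
    ℚ.∣ a ℚ.* b ℚ.- c ℚ.* d ∣
      ≡⟨ cong ℚ.∣_∣ (*-difference a b c d) ⟩
    ℚ.∣ a ℚ.* (b ℚ.- d) ℚ.+ d ℚ.* (a ℚ.- c) ∣
      ≤⟨ ℚₚ.∣p+q∣≤∣p∣+∣q∣ (a ℚ.* (b ℚ.- d)) (d ℚ.* (a ℚ.- c)) ⟩
    ℚ.∣ a ℚ.* (b ℚ.- d) ∣ ℚ.+ ℚ.∣ d ℚ.* (a ℚ.- c) ∣
      ≤⟨ ℚₚ.+-mono-≤ (*-bound a (b ℚ.- d) B>0 aB bd) (*-bound d (a ℚ.- c) C>0 dC ac) ⟩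
    B ℚ.* η ℚ.+ C ℚ.* θ
      ≡⟨ cong₂ ℚ._+_ Bη Cθ ⟩
    ½ ℚ.* ε ℚ.+ ½ ℚ.* ε
      ≡⟨ halves ε ⟩
    ε ∎

  abstract
    *-cauchy : ∀ x y → IsCauchy (λ n → seq x n ℚ.* seq y n)
    *-cauchy x y ε 0<ε =
      let B , B>0 , K , xB = bounded x
          C , C>0 , L , yC = bounded y
          η , 0<η , Bη     = divide B B>0 (½ ℚ.* ε) (0<½* 0<ε)
          θ , 0<θ , Cθ     = divide C C>0 (½ ℚ.* ε) (0<½* 0<ε)
          M , q            = cauchy y η 0<η
          N , p            = cauchy x θ 0<θ
      in (K ⊔ L) ⊔ (M ⊔ N) , λ m n Nm Nn →
        *-estimate (seq x m) (seq y m) (seq x n) (seq y n) B>0 C>0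
          (xB m (⊔-≤ˡ (⊔-≤ˡ Nm)))
          (yC n (⊔-≤ʳ {K} (⊔-≤ˡ Nn)))
          (q m n (⊔-≤ˡ (⊔-≤ʳ {K ⊔ L} Nm)) (⊔-≤ˡ (⊔-≤ʳ {K ⊔ L} Nn)))
          (p m n (⊔-≤ʳ {M} (⊔-≤ʳ {K ⊔ L} Nm)) (⊔-≤ʳ {M} (⊔-≤ʳ {K ⊔ L} Nn)))
          Bη Cθ

infixl 6 _+_
infixl 7 _*_

_+_ : ℝ → ℝ → ℝ
x + y = mkℝ (λ n → seq x n ℚ.+ seq y n) (+-cauchy x y)

_*_ : ℝ → ℝ → ℝ
x * y = mkℝ (λ n → seq x n ℚ.* seq y n) (*-cauchy x y)

∑ : ∀ {k} → Vector ℝ k → ℝ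
∑ = foldr _+_ 0ℝ

infix 4 _≋_
infixl 6 _⊞_
infix 8 _·_

_≋_ : ∀ {m} → Vector ℝ m → Vector ℝ m → Set
x ≋ y = ∀ e → x e ≈ y e

_·_ : ∀ {m} → Vector ℝ m → Vector ℝ m → ℝ
a · x = ∑ (zipWith _*_ a x)

lincomb : ∀ {m k} → Vector ℝ k → Vector (Vector ℝ m) k → Vector ℝ m
lincomb μ p e = ∑ λ i → μ i * p i e

conv : ∀ {m} → Pred (Vector ℝ m) 0ℓ → Pred (Vector ℝ m) 0ℓ
conv X x = ∃[ k ] Σ[ p ∈ Vector (Vector ℝ _) k ] Σ[ μ ∈ Vector ℝ k ]
  (∀ i → X (p i)) × (∀ i → 0ℝ ≤ μ i) × ∑ μ ≈ 1ℝ × x ≋ lincomb μ p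

_⊞_ : ∀ {m} → Pred (Vector ℝ m) 0ℓ → Pred (Vector ℝ m) 0ℓ → Pred (Vector ℝ m) 0ℓ
(X ⊞ Y) x = ∃[ y ] ∃[ z ] X y × Y z × x ≋ zipWith _+_ y z

NonnegativeOrthant : ∀ {m} → Pred (Vector ℝ m) 0ℓ
NonnegativeOrthant x = ∀ e → 0ℝ ≤ x e

AffinelyIndependent : ∀ {m k} → Vector (Vector ℝ m) k → Set
AffinelyIndependent p = ∀ μ → ∑ μ ≈ 0ℝ → (∀ e → lincomb μ p e ≈ 0ℝ) → ∀ i → μ i ≈ 0ℝ

HasDimension : ∀ {m} → Pred (Vector ℝ m) 0ℓ → ℕ → Set
HasDimension {m} X d =
    (Σ[ p ∈ Vector (Vector ℝ m) (suc d) ] (∀ i → X (p i)) × AffinelyIndependent p)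
  × (∀ (p : Vector (Vector ℝ m) (suc (suc d))) → (∀ i → X (p i)) → ¬ AffinelyIndependent p)

Valid : ∀ {m} → Pred (Vector ℝ m) 0ℓ → Vector ℝ m → ℝ → Set
Valid P a γ = ∀ x → P x → γ ≤ a · x

Face : ∀ {m} → Pred (Vector ℝ m) 0ℓ → Vector ℝ m → ℝ → Pred (Vector ℝ m) 0ℓ
Face P a γ x = P x × a · x ≈ γ

-- The empty set has no HasDimension, so a facet is non-empty here.  Nothing is
-- lost for CUT₊: a connected graph with two terminals has an edge, so CUT₊ has
-- dimension at least 1.
FacetDefining : ∀ {m} → Pred (Vector ℝ m) 0ℓ → Vector ℝ m → ℝ → Set
FacetDefining P a γ = Valid P a γ ×
  ∃[ d ] HasDimension P (suc d) × HasDimension (Face P a γ) d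

MinimumIntegerForm : ∀ {m} → Vector ℕ m → Set
MinimumIntegerForm c = foldr gcd 0 c ≡ 1

-- Edges are enumerated without repetition, each a two-element set of
-- nodes listed in increasing order.
record Graph : Set where
  field
    nodes edges : ℕ
    end₁ end₂   : Fin edges → Fin nodes
    ordered     : ∀ e → end₁ e Fin.< end₂ e
    distinct    : ∀ e f → end₁ e ≡ end₁ f → end₂ e ≡ end₂ f → e ≡ f

  Adjacent : Fin nodes → Fin nodes → Set
  Adjacent u v = ∃[ e ] ((end₁ e ≡ u × end₂ e ≡ v) ⊎ (end₁ e ≡ v × end₂ e ≡ u))

  Connected : Set
  Connected = ∀ u v → Star Adjacent u v

  δ : Subset nodes → Subset edges
  δ S = tabulate λ e → lookup S (end₁ e) xor lookup S (end₂ e)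

χ : ∀ {m} → Subset m → Vector ℝ m
χ F e = if lookup F e then 1ℝ else 0ℝ

record SteinerGraph : Set where
  field
    graph : Graph

  open Graph graph public

  field
    connected   : Connected
    T           : Subset nodes
    2≤terminals : 2 ℕ.≤ Subset.∣ T ∣

  SteinerCut : Subset nodes → Set
  SteinerCut S = Nonempty (T ∩ S) × Nonempty (T ─ S)

  SteinerCutVector : Pred (Vector ℝ edges) 0ℓ
  SteinerCutVector x = ∃[ S ] SteinerCut S × x ≋ χ (δ S)

  CUT₊ : Pred (Vector ℝ edges) 0ℓ
  CUT₊ = conv SteinerCutVector ⊞ NonnegativeOrthant

{-# OPTIONS --safe #-}

-- A facet with γ > 0 is an extreme ray: up to scaling, c is the only vector supported on
-- its edges for which all tight (minimum) Steiner cuts have equal weight.  A nonterminal of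
-- degree two has edges of equal weight, which can be merged without losing extremality, so
-- all n - t nonterminals (t = |T|) may be assumed to have degree at least three.
-- Of two crossing Steiner cuts X and Y, either X ∩ Y, X ∪ Y or X ∖ Y, Y ∖ X are Steiner cuts;
-- so tight cuts uncross, and repeatedly contracting the sides of a tight cut yields at most
-- (n - 3) + t tight cuts spanning all others.  Extremality then gives m ≤ n + t for the number
-- of edges and the degrees give 3(n - t) ≤ 2m, whence m ≤ 6t.  Thus (γ, c) spans the kernel of
-- a matrix with entries 0, ±1 and at most 6t + 1 columns, which has a nonzero integer vector
-- bounded in terms of t; it is a multiple of the primitive vector (γ, c).  Every edge with
-- c e > 0 lies in a tight cut, so c e ≤ γ.  For γ = 0, c is a unit vector.

module Submission where

open import Defs
open import Data.Fin.Subset using (∣_∣)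
open import Data.Nat.Base using (ℕ)
import Data.Nat.Base as ℕ
open import Data.Product.Base using (Σ-syntax; _×_)
open import Data.Vec.Functional using (Vector)
open import Function.Base using (_∘_)

open import Algebra.Bundles using (CommutativeRing; module AbelianGroup)
import Algebra.Properties.Group
import Algebra.Properties.Ring
import Algebra.Properties.Semiring.Sum as SemiringSum
open import Algebra.Structures using (IsCommutativeRing)
open import Data.Bool.Base using (Bool; true; false; if_then_else_; not; _∧_; _∨_; _xor_)
import Data.Bool.Properties as Boolₚ
open import Data.Empty using (⊥)
open import Data.Fin.Base using (Fin; zero; suc)
import Data.Fin.Properties as Finₚ
open import Data.Fin.Subset using (Subset; _∈_; _∉_; _─_)
open import Data.Fin.Subset.Properties
  using (anySubset?; x∈p∩q⁺; x∈p∩q⁻; x∈p∧x∉q⇒x∈p─q; p─q⊆p)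
open import Data.Integer.Base using (ℤ; +_; 0ℤ; 1ℤ)
import Data.Integer.Base as ℤ
import Data.Integer.Properties as ℤₚ
import Data.Integer.Tactic.RingSolver as ℤ-Solver
open import Data.List.Base using (List; []; _∷_; length)
import Data.List.Base as List
import Data.List.Properties as Listₚ
open import Data.List.Relation.Unary.All using (All; []; _∷_)
import Data.List.Relation.Unary.All as All
import Data.List.Relation.Unary.All.Properties as Allₚ
open import Data.Nat.Base using (zero; suc; z≤n; s≤s)
open import Data.Nat.Divisibility using (_∣_)
import Data.Nat.Divisibility as ∣
open import Data.Nat.GCD using (gcd; gcd-greatest; c*gcd[m,n]≡gcd[cm,cn])
open import Data.Nat.Induction using (<-wellFounded)
import Data.Nat.Properties as ℕₚ
import Data.Nat.Tactic.RingSolver as ℕ-Solver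
open import Data.Product.Base using (∃; ∃-syntax; _,_; proj₁; proj₂)
open import Data.Rational.Base using (ℚ; 0ℚ; 1ℚ; ½)
import Data.Rational.Base as ℚ
import Data.Rational.Properties as ℚₚ
open import Data.Rational.Solver using (module +-*-Solver)
import Data.Rational.Unnormalised.Base as ℚᵘ
import Data.Rational.Unnormalised.Properties as ℚᵘₚ
open import Data.Sum.Base using (_⊎_; inj₁; inj₂; [_,_]′)
import Data.Sum.Base as Sum
open import Data.Unit.Base using (tt)
open import Data.Vec.Base using (lookup; tabulate; []; _∷_)
import Data.Vec.Functional as V
open import Data.Vec.Properties using (lookup∘tabulate; []=⇒lookup; lookup⇒[]=)
open import Induction.WellFounded using (Acc; acc)
open import Level using (0ℓ)
open import Relation.Binary.Definitions using (tri<; tri≈; tri>)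
open import Relation.Binary.PropositionalEquality as ≡
  using (_≡_; _≢_; _≗_; refl; sym; trans; cong; cong₂; subst; subst₂; module ≡-Reasoning)
import Relation.Binary.Reasoning.Setoid
open import Relation.Nullary using (¬_; Dec; yes; no; does; contradiction)
open import Relation.Nullary.Decidable
  using (toWitness; toWitnessFalse; map′; _×-dec_; _→-dec_; _⊎-dec_; ¬?; dec-true; dec-false; decidable-stable)
open import Relation.Unary using (Decidable; Pred)

-- Extremality is extracted from the facet by perturbation. If an integral `x` on the support of `c`
-- has value 0 on all tight cuts, then for large `K` both `K c + x` and `K c - x` are valid with
-- right-hand side `K γ`. They add up to `2K c`, so on a facet both are proportional to `c`, and a
-- tight cut then shows `x = 0`. This argument is integral because `γ` equals the weight of a
-- minimum Steiner cut, found by finite search; the combinatorics is thus free of real numbers,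
-- whose equality is not decidable.
--
-- Renumbering is avoided by never deleting a node or an edge. An edge is removed by giving it
-- weight 0, splitting off composes the end maps with a map on the nodes, and a contraction is an
-- idempotent map whose fixed points represent the classes. Cuts are therefore treated for arbitrary
-- end maps, with loops and parallel edges, and the sizes that count are the number of edges of
-- positive weight and the number of fixed points.

private module ℤ-Group = Algebra.Properties.Group (AbelianGroup.group ℤₚ.+-0-abelianGroup)

-- Integer kernels

module Σℕ = SemiringSum ℕₚ.+-*-semiring
module Σℤ = SemiringSum ℤₚ.+-*-semiring

private
  addˡ : ∀ x {y z} → y ≡ z → x ℤ.+ y ≡ x ℤ.+ z
  addˡ x = cong (λ t → x ℤ.+ t)

⟦_⟧ : Bool → ℕ
⟦ b ⟧ = if b then 1 else 0

⟦⟧≤1 : ∀ p → ⟦ p ⟧ ℕ.≤ 1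
⟦⟧≤1 true  = s≤s z≤n
⟦⟧≤1 false = z≤n

count : ∀ {N} → (Fin N → Bool) → ℕ
count p = Σℕ.sum (⟦_⟧ ∘ p)

SupportedOn : ∀ {N} → (Fin N → Bool) → (Fin N → ℤ) → Set
SupportedOn p v = ∀ j → p j ≡ false → v j ≡ 0ℤ

infix 8 _∙_

_∙_ : ∀ {N} → (Fin N → ℤ) → (Fin N → ℤ) → ℤ
r ∙ v = Σℤ.sum (λ j → r j ℤ.* v j)

∣∙∣≤ : ∀ {N} (p : Fin N → Bool) {B F} (r v : Fin N → ℤ) →
  (∀ j → ℤ.∣ r j ∣ ℕ.≤ B) → SupportedOn p v → (∀ j → ℤ.∣ v j ∣ ℕ.≤ F) →
  ℤ.∣ r ∙ v ∣ ℕ.≤ count p ℕ.* (B ℕ.* F)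
∣∙∣≤ {zero} p r v _ _ _ = z≤n
∣∙∣≤ {suc N} p {B} {F} r v r≤ sv v≤ = begin
  ℤ.∣ r zero ℤ.* v zero ℤ.+ (r ∘ suc) ∙ (v ∘ suc) ∣
    ≤⟨ ℤₚ.∣i+j∣≤∣i∣+∣j∣ (r zero ℤ.* v zero) _ ⟩
  ℤ.∣ r zero ℤ.* v zero ∣ ℕ.+ ℤ.∣ (r ∘ suc) ∙ (v ∘ suc) ∣
    ≤⟨ ℕₚ.+-mono-≤ head≤
         (∣∙∣≤ (p ∘ suc) (r ∘ suc) (v ∘ suc) (r≤ ∘ suc) (sv ∘ suc) (v≤ ∘ suc)) ⟩
  ⟦ p zero ⟧ ℕ.* (B ℕ.* F) ℕ.+ count (p ∘ suc) ℕ.* (B ℕ.* F)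
    ≡⟨ ℕₚ.*-distribʳ-+ (B ℕ.* F) ⟦ p zero ⟧ _ ⟨
  count p ℕ.* (B ℕ.* F) ∎
  where
  open ℕₚ.≤-Reasoning
  head≤ : ℤ.∣ r zero ℤ.* v zero ∣ ℕ.≤ ⟦ p zero ⟧ ℕ.* (B ℕ.* F)
  head≤ with p zero in eq
  ... | true  rewrite ℤₚ.abs-* (r zero) (v zero) | ℕₚ.+-identityʳ (B ℕ.* F) =
    ℕₚ.*-mono-≤ (r≤ zero) (v≤ zero)
  ... | false rewrite sv zero eq | ℤₚ.*-zeroʳ (r zero) = z≤n

-- `ys` is `xs` with the pivot taken out. In place of a permutation it comes with the two transports
-- of `All`, which is all that elimination uses.
findPivot : ∀ {A : Set} (f : A → ℤ) (xs : List A) →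
  All (λ x → f x ≡ 0ℤ) xs ⊎
  (Σ[ x ∈ A ] Σ[ ys ∈ List A ] f x ≢ 0ℤ × length xs ≡ suc (length ys) ×
    (∀ {P : A → Set} → All P xs → P x × All P ys) ×
    (∀ {P : A → Set} → P x → All P ys → All P xs))
findPivot f [] = inj₁ []
findPivot f (x ∷ xs) with f x ℤₚ.≟ 0ℤ
... | no fx≢0 = inj₂ (x , xs , fx≢0 , refl , (λ { (p ∷ ps) → p , ps }) , _∷_)
... | yes fx≡0 with findPivot f xs
...   | inj₁ all = inj₁ (fx≡0 ∷ all)
...   | inj₂ (y , ys , fy≢0 , len , split , join) =
  inj₂ (y , x ∷ ys , fy≢0 , cong suc len
       , (λ { (p ∷ ps) → proj₁ (split ps) , p ∷ proj₂ (split ps) })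
       , λ { q (p ∷ ps) → p ∷ join q ps })

-- Cross-multiplication makes column `zero` vanish without division, so that column is dropped.
eliminate : ∀ {N} → (Fin (suc N) → ℤ) → (Fin (suc N) → ℤ) → Fin N → ℤ
eliminate r s j = r zero ℤ.* s (suc j) ℤ.- s zero ℤ.* r (suc j)

eliminate-∙ : ∀ {N} (r s : Fin (suc N) → ℤ) v → eliminate r s ∙ v ≡
  r zero ℤ.* (s ∘ suc) ∙ v ℤ.- s zero ℤ.* (r ∘ suc) ∙ v
eliminate-∙ {N} r s v = go (r zero) (s zero) (s ∘ suc) (r ∘ suc) v
  where
  step : ∀ a b x y z p q → (a ℤ.* x ℤ.- b ℤ.* y) ℤ.* z ℤ.+ (a ℤ.* p ℤ.- b ℤ.* q) ≡
    a ℤ.* (x ℤ.* z ℤ.+ p) ℤ.- b ℤ.* (y ℤ.* z ℤ.+ q)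
  step = ℤ-Solver.solve-∀
  base : ∀ a b → 0ℤ ≡ a ℤ.* 0ℤ ℤ.- b ℤ.* 0ℤ
  base = ℤ-Solver.solve-∀
  go : ∀ a b {M} (s r v : Fin M → ℤ) →
    (λ j → a ℤ.* s j ℤ.- b ℤ.* r j) ∙ v ≡ a ℤ.* s ∙ v ℤ.- b ℤ.* r ∙ v
  go a b {zero}  s r v = base a b
  go a b {suc M} s r v = trans
    (addˡ ((a ℤ.* s zero ℤ.- b ℤ.* r zero) ℤ.* v zero) (go a b (s ∘ suc) (r ∘ suc) (v ∘ suc)))
    (step a b (s zero) (r zero) (v zero) ((s ∘ suc) ∙ (v ∘ suc)) ((r ∘ suc) ∙ (v ∘ suc)))

-- Fraction-free elimination replaces entries bounded by B by entries bounded by 2B².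
kernelBound : ℕ → ℕ → ℕ
kernelBound B zero    = 0
kernelBound B (suc k) =
  suc (suc k ℕ.* (B ℕ.* kernelBound (B ℕ.* B ℕ.+ B ℕ.* B) k))

∙-zeroʳ : ∀ {N} (r v : Fin N → ℤ) → (∀ j → v j ≡ 0ℤ) → r ∙ v ≡ 0ℤ
∙-zeroʳ {N} r v v≡0 = trans
  (Σℤ.sum-cong-≗ (λ j → trans (cong (r j ℤ.*_) (v≡0 j)) (ℤₚ.*-zeroʳ (r j))))
  (Σℤ.sum-replicate-zero N)

∙-scale : ∀ {N} z (r v : Fin N → ℤ) → r ∙ (λ j → z ℤ.* v j) ≡ z ℤ.* r ∙ v
∙-scale z r v = trans (Σℤ.sum-cong-≗ (λ j → swap (r j) z (v j)))
                      (sym (Σℤ.*-distribˡ-sum z (λ j → r j ℤ.* v j)))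
  where
  swap : ∀ x y z → x ℤ.* (y ℤ.* z) ≡ y ℤ.* (x ℤ.* z)
  swap = ℤ-Solver.solve-∀

∙-pos : ∀ {N} (f g : Fin N → ℕ) → (+_ ∘ f) ∙ (+_ ∘ g) ≡ + Σℕ.sum (λ e → g e ℕ.* f e)
∙-pos {zero}  f g = refl
∙-pos {suc N} f g = cong₂ ℤ._+_
  (trans (sym (ℤₚ.pos-* (f zero) (g zero))) (cong +_ (ℕₚ.*-comm (f zero) (g zero))))
  (∙-pos (f ∘ suc) (g ∘ suc))

-- Gaussian elimination by columns: a column outside `p` receives the entry 0, a zero column inside
-- `p` yields a unit vector (for which the outer `suc` in `kernelBound` makes room), and any other
-- column is eliminated with a pivot row. Each pivot uses up one row and one column of `p`, whence
-- the count in the second alternative. That count later bounds the number of live edges; the first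
-- alternative bounds `γ`.
smallKernelVector : ∀ {N} (p : Fin N → Bool) B (rows : List (Fin N → ℤ)) →
  All (λ r → ∀ j → ℤ.∣ r j ∣ ℕ.≤ B) rows →
  (Σ[ v ∈ (Fin N → ℤ) ] SupportedOn p v × All (λ r → r ∙ v ≡ 0ℤ) rows ×
    (∃[ j ] v j ≢ 0ℤ) × (∀ j → ℤ.∣ v j ∣ ℕ.≤ kernelBound B (count p)))
  ⊎ (count p ℕ.≤ length rows ×
    (∀ v → SupportedOn p v → All (λ r → r ∙ v ≡ 0ℤ) rows → ∀ j → v j ≡ 0ℤ))
smallKernelVector {zero} p B rows rows≤ = inj₂ (z≤n , λ _ _ _ ())
smallKernelVector {suc N} p B rows rows≤ with p zero in eq
... | false with smallKernelVector (p ∘ suc) B (List.map (_∘ suc) rows)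
                   (Allₚ.map⁺ (All.map (λ r≤ j → r≤ (suc j)) rows≤))
...   | inj₁ (v , sv , ker , (j , vj≢0) , v≤) =
  inj₁ (0ℤ V.∷ v , (λ { zero _ → refl ; (suc j) → sv j })
       , All.map (λ {r} r∙v → trans (cong (ℤ._+ ((r ∘ suc) ∙ v)) (ℤₚ.*-zeroʳ (r zero)))
                                     (trans (ℤₚ.+-identityˡ _) r∙v)) (Allₚ.map⁻ ker)
       , (suc j , vj≢0) , λ { zero → z≤n ; (suc j) → v≤ j })
...   | inj₂ (cnt , triv) =
  inj₂ (subst (count (p ∘ suc) ℕ.≤_) (Listₚ.length-map (_∘ suc) rows) cnt , λ v sv ker →
    let tail≡0 = triv (v ∘ suc) (sv ∘ suc)
          (Allₚ.map⁺ (All.map (λ {r} r∙v → trans (sym (ℤₚ.+-identityˡ _))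
            (trans (cong (ℤ._+ ((r ∘ suc) ∙ (v ∘ suc)))
              (sym (trans (cong (r zero ℤ.*_) (sv zero eq)) (ℤₚ.*-zeroʳ (r zero))))) r∙v)) ker))
    in λ { zero → sv zero eq ; (suc j) → tail≡0 j })
smallKernelVector {suc N} p B rows rows≤ | true with findPivot (λ r → r zero) rows
... | inj₁ col≡0 = inj₁ (1ℤ V.∷ (λ _ → 0ℤ)
       , (λ { zero p0 → contradiction (trans (sym eq) p0) (λ ()) ; (suc j) _ → refl })
       , All.map (λ {r} r0 → cong₂ ℤ._+_ (trans (ℤₚ.*-identityʳ (r zero)) r0)
                                          (∙-zeroʳ (r ∘ suc) _ (λ _ → refl))) col≡0
       , (zero , λ ()) , λ { zero → s≤s z≤n ; (suc j) → z≤n })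
... | inj₂ (r , rest , r0≢0 , len , split , join)
  with smallKernelVector (p ∘ suc) (B ℕ.* B ℕ.+ B ℕ.* B) (List.map (eliminate r) rest)
         (Allₚ.map⁺ (All.map (λ {s} s≤ j → eliminate≤ s s≤ j) (proj₂ (split rows≤))))
  where
  r≤ = proj₁ (split rows≤)
  eliminate≤ : ∀ s → (∀ j → ℤ.∣ s j ∣ ℕ.≤ B) →
    ∀ j → ℤ.∣ eliminate r s j ∣ ℕ.≤ B ℕ.* B ℕ.+ B ℕ.* B
  eliminate≤ s s≤ j = ℕₚ.≤-trans (ℤₚ.∣i-j∣≤∣i∣+∣j∣ (r zero ℤ.* s (suc j)) _)
    (subst₂ (λ a b → a ℕ.+ b ℕ.≤ B ℕ.* B ℕ.+ B ℕ.* B)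
      (sym (ℤₚ.abs-* (r zero) (s (suc j)))) (sym (ℤₚ.abs-* (s zero) (r (suc j))))
      (ℕₚ.+-mono-≤ (ℕₚ.*-mono-≤ (r≤ zero) (s≤ (suc j))) (ℕₚ.*-mono-≤ (s≤ zero) (r≤ (suc j)))))
...   | inj₁ (v , sv , ker , (j , vj≢0) , v≤) =
  inj₁ (w , sw , join pivot-row (All.map (λ {s} → other-row s) (Allₚ.map⁻ ker))
       , (suc j , λ rv≡0 → nonzero (ℤₚ.i*j≡0⇒i≡0∨j≡0 (r zero) rv≡0)) , w≤)
  where
  r≤ = proj₁ (split rows≤)
  F = kernelBound (B ℕ.* B ℕ.+ B ℕ.* B) (count (p ∘ suc))
  -- Back substitution: scaling `v` by the pivot entry keeps the new head entry integral.
  w : Fin (suc N) → ℤ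
  w = (ℤ.- ((r ∘ suc) ∙ v)) V.∷ (λ j → r zero ℤ.* v j)
  sw : SupportedOn p w
  sw zero p0    = contradiction (trans (sym eq) p0) (λ ())
  sw (suc j) pj = trans (cong (r zero ℤ.*_) (sv j pj)) (ℤₚ.*-zeroʳ (r zero))
  nonzero : r zero ≡ 0ℤ ⊎ v j ≡ 0ℤ → ⊥
  nonzero (inj₁ z) = r0≢0 z
  nonzero (inj₂ z) = vj≢0 z
  row : ∀ s → s ∙ w ≡ eliminate r s ∙ v
  row s = trans (addˡ (s zero ℤ.* w zero) (∙-scale (r zero) (s ∘ suc) v))
    (trans (arith (s zero) ((r ∘ suc) ∙ v) (r zero) ((s ∘ suc) ∙ v)) (sym (eliminate-∙ r s v)))
    where
    arith : ∀ a b c d → a ℤ.* (ℤ.- b) ℤ.+ c ℤ.* d ≡ c ℤ.* d ℤ.- a ℤ.* b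
    arith = ℤ-Solver.solve-∀
  pivot-row : r ∙ w ≡ 0ℤ
  pivot-row = trans (row r) (trans (eliminate-∙ r r v) (ℤₚ.+-inverseʳ (r zero ℤ.* (r ∘ suc) ∙ v)))
  other-row : ∀ s → eliminate r s ∙ v ≡ 0ℤ → s ∙ w ≡ 0ℤ
  other-row s = trans (row s)
  w≤ : ∀ j → ℤ.∣ w j ∣ ℕ.≤ kernelBound B (suc (count (p ∘ suc)))
  w≤ zero rewrite ℤₚ.∣-i∣≡∣i∣ ((r ∘ suc) ∙ v) =
    ℕₚ.m≤n⇒m≤1+n (ℕₚ.≤-trans (∣∙∣≤ (p ∘ suc) (r ∘ suc) v (r≤ ∘ suc) sv v≤)
      (ℕₚ.m≤n+m _ (B ℕ.* F)))
  w≤ (suc j) rewrite ℤₚ.abs-* (r zero) (v j) =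
    ℕₚ.m≤n⇒m≤1+n (ℕₚ.≤-trans (ℕₚ.*-mono-≤ (r≤ zero) (v≤ j)) (ℕₚ.m≤m+n (B ℕ.* F) _))
...   | inj₂ (cnt , triv) =
  inj₂ (ℕₚ.≤-trans (s≤s (subst (count (p ∘ suc) ℕ.≤_) (Listₚ.length-map (eliminate r) rest) cnt))
                    (ℕₚ.≤-reflexive (sym len))
       , vanish)
  where
  vanish : ∀ v → SupportedOn p v → All (λ s → s ∙ v ≡ 0ℤ) rows → ∀ j → v j ≡ 0ℤ
  vanish v sv ker = all≡0
    where
    v′ = v ∘ suc
    combine : ∀ a b x y z → a ℤ.* x ℤ.+ y ≡ 0ℤ → b ℤ.* x ℤ.+ z ≡ 0ℤ → a ℤ.* z ℤ.- b ℤ.* y ≡ 0ℤ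
    combine a b x y z p q = trans (arith a b x y z)
      (trans (cong₂ (λ s t → a ℤ.* t ℤ.- b ℤ.* s) p q) (arith₀ a b))
      where
      arith : ∀ a b x y z → a ℤ.* z ℤ.- b ℤ.* y ≡ a ℤ.* (b ℤ.* x ℤ.+ z) ℤ.- b ℤ.* (a ℤ.* x ℤ.+ y)
      arith = ℤ-Solver.solve-∀
      arith₀ : ∀ a b → a ℤ.* 0ℤ ℤ.- b ℤ.* 0ℤ ≡ 0ℤ
      arith₀ = ℤ-Solver.solve-∀
    r∙v = proj₁ (split ker)
    tail≡0 : ∀ j → v′ j ≡ 0ℤ
    tail≡0 = triv v′ (sv ∘ suc) (Allₚ.map⁺ (All.map (λ {s} s∙v →
      trans (eliminate-∙ r s v′) (combine (r zero) (s zero) (v zero) _ _ r∙v s∙v)) (proj₂ (split ker))))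
    r0v0≡0 : r zero ℤ.* v zero ≡ 0ℤ
    r0v0≡0 = trans (sym (ℤₚ.+-identityʳ (r zero ℤ.* v zero)))
      (trans (addˡ (r zero ℤ.* v zero) (sym (∙-zeroʳ (r ∘ suc) v′ tail≡0))) r∙v)
    all≡0 : ∀ j → v j ≡ 0ℤ
    all≡0 zero with ℤₚ.i*j≡0⇒i≡0∨j≡0 (r zero) r0v0≡0
    ... | inj₁ z = contradiction z r0≢0
    ... | inj₂ z = z
    all≡0 (suc j) = tail≡0 j

-- Cuts

sum-mono-≤ : ∀ {N} {f g : Fin N → ℕ} → (∀ i → f i ℕ.≤ g i) → Σℕ.sum f ℕ.≤ Σℕ.sum g
sum-mono-≤ {zero}  f≤g = z≤n
sum-mono-≤ {suc N} f≤g = ℕₚ.+-mono-≤ (f≤g zero) (sum-mono-≤ (f≤g ∘ suc))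

sum-≡⇒pointwise : ∀ {N} {f g : Fin N → ℕ} → (∀ i → f i ℕ.≤ g i) →
  Σℕ.sum g ℕ.≤ Σℕ.sum f → ∀ i → f i ≡ g i
sum-≡⇒pointwise {f = f} {g} f≤g Σg≤Σf zero = ℕₚ.≤-antisym (f≤g zero)
  (ℕₚ.+-cancelʳ-≤ _ (g zero) (f zero) (ℕₚ.≤-trans Σg≤Σf
    (ℕₚ.+-monoʳ-≤ (f zero) (sum-mono-≤ (f≤g ∘ suc)))))
sum-≡⇒pointwise {f = f} {g} f≤g Σg≤Σf (suc i) = sum-≡⇒pointwise (f≤g ∘ suc)
  (ℕₚ.+-cancelˡ-≤ (g zero) _ _ (ℕₚ.≤-trans Σg≤Σf (ℕₚ.+-monoˡ-≤ _ (f≤g zero)))) i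

term≤sum : ∀ {N} (f : Fin N → ℕ) i → f i ℕ.≤ Σℕ.sum f
term≤sum f zero    = ℕₚ.m≤m+n (f zero) _
term≤sum f (suc i) = ℕₚ.≤-trans (term≤sum (f ∘ suc) i) (ℕₚ.m≤n+m _ (f zero))

infix 8 _≐_

_≐_ : ∀ {N} → Fin N → Fin N → Bool
i ≐ j = does (i Finₚ.≟ j)

≐-refl : ∀ {N} (i : Fin N) → i ≐ i ≡ true
≐-refl i = dec-true (i Finₚ.≟ i) refl

≐-≢ : ∀ {N} {i j : Fin N} → i ≢ j → i ≐ j ≡ false
≐-≢ {i = i} {j} = dec-false (i Finₚ.≟ j)

≐⇒≡ : ∀ {N} {i j : Fin N} → i ≐ j ≡ true → i ≡ j
≐⇒≡ {i = i} {j} eq with i Finₚ.≟ j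
... | yes p = p

sum-point : ∀ {N} (i : Fin N) (f : Fin N → ℕ) → Σℕ.sum (λ j → ⟦ i ≐ j ⟧ ℕ.* f j) ≡ f i
sum-point {suc N} zero f = trans
  (cong₂ ℕ._+_ (ℕₚ.*-identityˡ (f zero)) (Σℕ.sum-replicate-zero N))
  (ℕₚ.+-identityʳ (f zero))
sum-point (suc i) f = sum-point i (f ∘ suc)

count-point : ∀ {N} (i : Fin N) → count (i ≐_) ≡ 1
count-point i = trans (Σℕ.sum-cong-≗ (λ j → sym (ℕₚ.*-identityʳ ⟦ i ≐ j ⟧))) (sum-point i (λ _ → 1))

distinct-indicators : ∀ {N} {i j k : Fin N} → i ≢ j → i ≢ k → j ≢ k →
  ∀ (f : Fin N → ℕ) → 1 ℕ.≤ f i → 1 ℕ.≤ f j → 1 ℕ.≤ f k → 3 ℕ.≤ Σℕ.sum f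
distinct-indicators {i = i} {j} {k} i≢j i≢k j≢k f fi fj fk = begin
  3 ≡⟨ cong₂ ℕ._+_ (cong₂ ℕ._+_ (count-point i) (count-point j)) (count-point k) ⟨
  count (i ≐_) ℕ.+ count (j ≐_) ℕ.+ count (k ≐_)
    ≡⟨ cong (ℕ._+ count (k ≐_)) (Σℕ.∑-distrib-+ (⟦_⟧ ∘ (i ≐_)) (⟦_⟧ ∘ (j ≐_))) ⟨
  Σℕ.sum (λ l → ⟦ i ≐ l ⟧ ℕ.+ ⟦ j ≐ l ⟧) ℕ.+ count (k ≐_)
    ≡⟨ Σℕ.∑-distrib-+ (λ l → ⟦ i ≐ l ⟧ ℕ.+ ⟦ j ≐ l ⟧) (⟦_⟧ ∘ (k ≐_)) ⟨
  Σℕ.sum (λ l → ⟦ i ≐ l ⟧ ℕ.+ ⟦ j ≐ l ⟧ ℕ.+ ⟦ k ≐ l ⟧) ≤⟨ sum-mono-≤ bound ⟩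
  Σℕ.sum f ∎
  where
  open ℕₚ.≤-Reasoning
  bound : ∀ l → ⟦ i ≐ l ⟧ ℕ.+ ⟦ j ≐ l ⟧ ℕ.+ ⟦ k ≐ l ⟧ ℕ.≤ f l
  bound l with i Finₚ.≟ l | j Finₚ.≟ l | k Finₚ.≟ l
  ... | yes refl | yes refl | _        = contradiction refl i≢j
  ... | yes refl | _        | yes refl = contradiction refl i≢k
  ... | _        | yes refl | yes refl = contradiction refl j≢k
  ... | yes refl | no _     | no _     = fi
  ... | no _     | yes refl | no _     = fj
  ... | no _     | no _     | yes refl = fk
  ... | no _     | no _     | no _     = z≤n

∀-Bool? : {P : Bool → Set} → Decidable P → Dec (∀ b → P b)
∀-Bool? P? = map′ (λ { (f , t) false → f ; (f , t) true → t }) (λ p → p false , p true)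
                  (P? false ×-dec P? true)

-- The search runs over Boolean vectors, and a function agrees only pointwise with the vector
-- tabulated from it; hence the condition that `P` respects `≗`.
anySet? : ∀ {n} {P : (Fin n → Bool) → Set} → (∀ {X Y} → X ≗ Y → P X → P Y) →
  Decidable P → Dec (∃ P)
anySet? {P = P} resp P? = map′ (λ (X , p) → lookup X , p)
  (λ (X , p) → tabulate X , resp (sym ∘ lookup∘tabulate X) p) (anySubset? (P? ∘ lookup))

infixr 7 _⊓_ _∖_
infixr 6 _⊔_

_⊓_ _⊔_ _∖_ : ∀ {n} → (Fin n → Bool) → (Fin n → Bool) → Fin n → Bool
(X ⊓ Y) v = X v ∧ Y v
(X ⊔ Y) v = X v ∨ Y v
(X ∖ Y) v = X v ∧ not (Y v)

-- Marks the edges of positive weight; those of weight 0 count as deleted.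
live : ℕ → Bool
live zero    = false
live (suc _) = true

live⁻ : ∀ {k} → live k ≡ false → k ≡ 0
live⁻ {zero} _ = refl

true≢false : true ≢ false
true≢false ()

module Cuts {n m : ℕ} (T : Fin n → Bool) (a b : Fin m → Fin n) where

  Steiner : (Fin n → Bool) → Set
  Steiner X = (∃[ v ] T v ≡ true × X v ≡ true) × (∃[ v ] T v ≡ true × X v ≡ false)

  steiner? : Decidable Steiner
  steiner? X = Finₚ.any? (λ v → (T v Boolₚ.≟ true) ×-dec (X v Boolₚ.≟ true))
         ×-dec Finₚ.any? (λ v → (T v Boolₚ.≟ true) ×-dec (X v Boolₚ.≟ false))

  steiner-resp : ∀ {X Y} → X ≗ Y → Steiner X → Steiner Y
  steiner-resp eq ((u , Tu , Xu) , (v , Tv , Xv)) =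
    (u , Tu , trans (sym (eq u)) Xu) , (v , Tv , trans (sym (eq v)) Xv)

  cut : (Fin n → Bool) → Fin m → ℕ
  cut X e = ⟦ X (a e) xor X (b e) ⟧

  cut-resp : ∀ {X Y} → X ≗ Y → cut X ≗ cut Y
  cut-resp eq e = cong₂ (λ p q → ⟦ p xor q ⟧) (eq (a e)) (eq (b e))

  cut-not : ∀ X → cut (not ∘ X) ≗ cut X
  cut-not X e = lemma (X (a e)) (X (b e))
    where
    lemma : ∀ p q → ⟦ not p xor not q ⟧ ≡ ⟦ p xor q ⟧
    lemma true  true  = refl
    lemma true  false = refl
    lemma false true  = refl
    lemma false false = refl

  -- Submodularity of the cut function, edge by edge, so that equality can later be localised; a
  -- check of the sixteen truth assignments.
  cut-⊓-⊔ : ∀ X Y e → cut (X ⊓ Y) e ℕ.+ cut (X ⊔ Y) e ℕ.≤ cut X e ℕ.+ cut Y e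
  cut-⊓-⊔ X Y e = lemma (X (a e)) (X (b e)) (Y (a e)) (Y (b e))
    where
    lemma : ∀ p q r s →
      ⟦ (p ∧ r) xor (q ∧ s) ⟧ ℕ.+ ⟦ (p ∨ r) xor (q ∨ s) ⟧ ℕ.≤ ⟦ p xor q ⟧ ℕ.+ ⟦ r xor s ⟧
    lemma = toWitness {a? = ∀-Bool? λ p → ∀-Bool? λ q → ∀-Bool? λ r → ∀-Bool? λ s → _ ℕₚ.≤? _} tt

  -- Posimodularity, the companion obtained by complementing one of the two sets.
  cut-∖-∖ : ∀ X Y e → cut (X ∖ Y) e ℕ.+ cut (Y ∖ X) e ℕ.≤ cut X e ℕ.+ cut Y e
  cut-∖-∖ X Y e = lemma (X (a e)) (X (b e)) (Y (a e)) (Y (b e))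
    where
    lemma : ∀ p q r s → ⟦ (p ∧ not r) xor (q ∧ not s) ⟧ ℕ.+ ⟦ (r ∧ not p) xor (s ∧ not q) ⟧
      ℕ.≤ ⟦ p xor q ⟧ ℕ.+ ⟦ r xor s ⟧
    lemma = toWitness {a? = ∀-Bool? λ p → ∀-Bool? λ q → ∀-Bool? λ r → ∀-Bool? λ s → _ ℕₚ.≤? _} tt

  ⊓-⊔-steiner : ∀ {X Y} u v →
    T u ≡ true → X u ≡ true → Y u ≡ true → T v ≡ true → X v ≡ false → Y v ≡ false →
    Steiner (X ⊓ Y) × Steiner (X ⊔ Y)
  ⊓-⊔-steiner u v Tu Xu Yu Tv Xv Yv =
      ((u , Tu , cong₂ _∧_ Xu Yu) , (v , Tv , cong₂ _∧_ Xv Yv))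
    , ((u , Tu , cong₂ _∨_ Xu Yu) , (v , Tv , cong₂ _∨_ Xv Yv))

  ∖-∖-steiner : ∀ {X Y} u v →
    T u ≡ true → X u ≡ true → Y u ≡ false → T v ≡ true → X v ≡ false → Y v ≡ true →
    Steiner (X ∖ Y) × Steiner (Y ∖ X)
  ∖-∖-steiner u v Tu Xu Yu Tv Xv Yv =
      ((u , Tu , cong₂ minus Xu Yu) , (v , Tv , cong₂ minus Xv Yv))
    , ((v , Tv , cong₂ minus Yv Xv) , (u , Tu , cong₂ minus Yu Xu))
    where
    minus : Bool → Bool → Bool
    minus p q = p ∧ not q

  -- The terminals meet both sides of `X` and both sides of `Y`. Among the four quadrants of the two
  -- sets, any selection meeting both rows and both columns contains a diagonal, and the diagonal
  -- decides which uncrossing is available.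
  uncross-steiner : ∀ {X Y} → Steiner X → Steiner Y →
    (Steiner (X ⊓ Y) × Steiner (X ⊔ Y)) ⊎ (Steiner (X ∖ Y) × Steiner (Y ∖ X))
  uncross-steiner {X} {Y} ((u , Tu , Xu) , (v , Tv , Xv)) ((s , Ts , Ys) , (t , Tt , Yt))
    with Y u in Yu | X s in Xs | Y v in Yv | X t in Xt
  ... | true  | _     | false | _     = inj₁ (⊓-⊔-steiner {X} {Y} u v Tu Xu Yu Tv Xv Yv)
  ... | true  | _     | true  | false = inj₁ (⊓-⊔-steiner {X} {Y} u t Tu Xu Yu Tt Xt Yt)
  ... | false | true  | false | _     = inj₁ (⊓-⊔-steiner {X} {Y} s v Ts Xs Ys Tv Xv Yv)
  ... | false | true  | true  | false = inj₁ (⊓-⊔-steiner {X} {Y} s t Ts Xs Ys Tt Xt Yt)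
  ... | false | false | _     | _     = inj₂ (∖-∖-steiner {X} {Y} u s Tu Xu Yu Ts Xs Ys)
  ... | true  | _     | true  | true  = inj₂ (∖-∖-steiner {X} {Y} t v Tt Xt Yt Tv Xv Yv)
  ... | false | true  | true  | true  = inj₂ (∖-∖-steiner {X} {Y} t v Tt Xt Yt Tv Xv Yv)

  value : (Fin m → ℤ) → (Fin n → Bool) → ℤ
  value x X = (λ e → + cut X e) ∙ x

  value-resp : ∀ x X Y → X ≗ Y → value x X ≡ value x Y
  value-resp x X Y eq = Σℤ.sum-cong-≗ (λ e → cong (λ k → + k ℤ.* x e) (cut-resp eq e))

  value-not : ∀ x X → value x (not ∘ X) ≡ value x X
  value-not x X = Σℤ.sum-cong-≗ (λ e → cong (λ k → + k ℤ.* x e) (cut-not X e))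

  module Weights (c : Fin m → ℕ) (γ : ℕ) where

    weight : (Fin n → Bool) → ℕ
    weight X = Σℕ.sum (λ e → c e ℕ.* cut X e)

    weight-resp : ∀ {X Y} → X ≗ Y → weight X ≡ weight Y
    weight-resp eq = Σℕ.sum-cong-≗ (λ e → cong (c e ℕ.*_) (cut-resp eq e))

    weight-not : ∀ X → weight (not ∘ X) ≡ weight X
    weight-not X = Σℕ.sum-cong-≗ (λ e → cong (c e ℕ.*_) (cut-not X e))

    Tight : (Fin n → Bool) → Set
    Tight X = Steiner X × weight X ≡ γ

    tight? : Decidable Tight
    tight? X = steiner? X ×-dec (weight X ℕₚ.≟ γ)

    tight-resp : ∀ {X Y} → X ≗ Y → Tight X → Tight Y
    tight-resp eq (st , w) = steiner-resp eq st , trans (sym (weight-resp eq)) w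

    Supported : (Fin m → ℤ) → Set
    Supported = SupportedOn (live ∘ c)

    -- The integral content of a facet with positive right-hand side. `rigid` is the homogeneous
    -- form of extremality; a common value other than 0 is reduced to it by subtracting a multiple
    -- of `c`. `coprime` expresses that the weights have greatest common divisor one, as the
    -- cancellation in which this is applied.
    record Extremal : Set where
      field
        positive  : 0 ℕ.< γ
        valid     : ∀ X → Steiner X → γ ℕ.≤ weight X
        rigid     : ∀ x → Supported x → (∀ X → Tight X → value x X ≡ 0ℤ) → ∀ e → x e ≡ 0ℤ
        coprime   : ∀ k d → (∀ e → d ∣ k ℕ.* c e) → d ∣ k

    module _ (valid : ∀ X → Steiner X → γ ℕ.≤ weight X) where

      module _ X Y P Q (cut≤ : ∀ e → cut P e ℕ.+ cut Q e ℕ.≤ cut X e ℕ.+ cut Y e)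
               (tX : Tight X) (tY : Tight Y) (sP : Steiner P) (sQ : Steiner Q) where

        private
          split : ∀ X Y → Σℕ.sum (λ e → c e ℕ.* (cut X e ℕ.+ cut Y e)) ≡ weight X ℕ.+ weight Y
          split X Y = trans (Σℕ.sum-cong-≗ (λ e → ℕₚ.*-distribˡ-+ (c e) (cut X e) (cut Y e)))
            (Σℕ.∑-distrib-+ (λ e → c e ℕ.* cut X e) (λ e → c e ℕ.* cut Y e))

          pointwise≤ : ∀ e → c e ℕ.* (cut P e ℕ.+ cut Q e) ℕ.≤ c e ℕ.* (cut X e ℕ.+ cut Y e)
          pointwise≤ e = ℕₚ.*-monoʳ-≤ (c e) (cut≤ e)

          PQ≤XY : weight P ℕ.+ weight Q ℕ.≤ γ ℕ.+ γ
          PQ≤XY = subst₂ ℕ._≤_ (split P Q) (trans (split X Y) (cong₂ ℕ._+_ (proj₂ tX) (proj₂ tY)))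
                    (sum-mono-≤ pointwise≤)

        -- `P` and `Q` each weigh at least `γ` and together at most `γ + γ`.
        uncross-tight : Tight P × Tight Q
        uncross-tight =
            (sP , ℕₚ.≤-antisym (ℕₚ.+-cancelʳ-≤ γ (weight P) γ
              (ℕₚ.≤-trans (ℕₚ.+-monoʳ-≤ (weight P) (valid Q sQ)) PQ≤XY)) (valid P sP))
          , (sQ , ℕₚ.≤-antisym (ℕₚ.+-cancelˡ-≤ γ (weight Q) γ
              (ℕₚ.≤-trans (ℕₚ.+-monoˡ-≤ (weight Q) (valid P sP)) PQ≤XY)) (valid Q sQ))

        -- Since the total weights agree, the edgewise inequality `cut≤` is an equality on every
        -- edge of positive weight; on the other edges `x` vanishes.
        uncross-value : ∀ x → Supported x → value x P ℤ.+ value x Q ≡ value x X ℤ.+ value x Y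
        uncross-value x sx = trans (sym (Σℤ.∑-distrib-+ (λ e → + cut P e ℤ.* x e) (λ e → + cut Q e ℤ.* x e)))
          (trans (Σℤ.sum-cong-≗ pointwise)
            (Σℤ.∑-distrib-+ (λ e → + cut X e ℤ.* x e) (λ e → + cut Y e ℤ.* x e)))
          where
          merge : ∀ i j k → + i ℤ.* k ℤ.+ + j ℤ.* k ≡ + (i ℕ.+ j) ℤ.* k
          merge i j k = sym (ℤₚ.*-distribʳ-+ k (+ i) (+ j))
          pointwise : ∀ e → + cut P e ℤ.* x e ℤ.+ + cut Q e ℤ.* x e ≡
                            + cut X e ℤ.* x e ℤ.+ + cut Y e ℤ.* x e
          pointwise e = trans (merge (cut P e) (cut Q e) (x e))
            (trans (go (c e) refl) (sym (merge (cut X e) (cut Y e) (x e))))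
            where
            equal = sum-≡⇒pointwise pointwise≤ (ℕₚ.≤-trans
              (ℕₚ.≤-reflexive (trans (split X Y) (cong₂ ℕ._+_ (proj₂ tX) (proj₂ tY))))
              (ℕₚ.≤-trans (ℕₚ.+-mono-≤ (valid P sP) (valid Q sQ)) (ℕₚ.≤-reflexive (sym (split P Q))))) e
            go : ∀ k → c e ≡ k →
              + (cut P e ℕ.+ cut Q e) ℤ.* x e ≡ + (cut X e ℕ.+ cut Y e) ℤ.* x e
            go zero ce rewrite sx e (cong live ce) =
              trans (ℤₚ.*-zeroʳ (+ (cut P e ℕ.+ cut Q e))) (sym (ℤₚ.*-zeroʳ (+ (cut X e ℕ.+ cut Y e))))
            go (suc k) ce = cong (λ i → + i ℤ.* x e) (ℕₚ.*-cancelˡ-≡ _ _ (suc k)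
              (subst (λ i → i ℕ.* (cut P e ℕ.+ cut Q e) ≡ i ℕ.* (cut X e ℕ.+ cut Y e)) ce equal))

-- A small spanning family of tight cuts

-- A partition of the nodes is encoded by an idempotent `π` that sends every node to the
-- representative of its class. The representatives are the fixed points, and contracting changes
-- `π` instead of the node set.
class : ∀ {n} → (Fin n → Fin n) → Fin n → Fin n → Bool
class π v u = v ≐ π u

#classes : ∀ {n} → (Fin n → Fin n) → ℕ
#classes π = count (λ v → v ≐ π v)

Idempotent : ∀ {n} → (Fin n → Fin n) → Set
Idempotent π = ∀ v → π (π v) ≡ π v

Compatible : ∀ {n} → (Fin n → Fin n) → (Fin n → Bool) → Set
Compatible π X = ∀ v → X (π v) ≡ X v

TwoClasses : ∀ {n} → (Fin n → Fin n) → (Fin n → Bool) → Bool → Set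
TwoClasses π X β = ∃[ u ] ∃[ v ] u ≢ v × (π u ≡ u × X u ≡ β) × (π v ≡ v × X v ≡ β)

twoClasses? : ∀ {n} (π : Fin n → Fin n) X β → Dec (TwoClasses π X β)
twoClasses? π X β = Finₚ.any? λ u → Finₚ.any? λ v → ¬? (u Finₚ.≟ v) ×-dec (member? u ×-dec member? v)
  where
  member? : ∀ u → Dec (π u ≡ u × X u ≡ β)
  member? u = (π u Finₚ.≟ u) ×-dec (X u Boolₚ.≟ β)

twoClasses-resp : ∀ {n} (π : Fin n → Fin n) {X Y β} → X ≗ Y → TwoClasses π X β → TwoClasses π Y β
twoClasses-resp π eq (u , v , u≢v , (πu , Xu) , (πv , Xv)) =
  u , v , u≢v , (πu , trans (sym (eq u)) Xu) , (πv , trans (sym (eq v)) Xv)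

bool-ext : ∀ {p q} → (p ≡ true → q ≡ true) → (q ≡ true → p ≡ true) → p ≡ q
bool-ext {true}  {q}     f g = sym (f refl)
bool-ext {false} {true}  f g = g refl
bool-ext {false} {false} f g = refl

-- The complement of `S` is shrunk to one class, represented by a node `s` chosen there.
contract : ∀ {n} → (Fin n → Fin n) → (Fin n → Bool) → Fin n → Fin n → Fin n
contract π S s v = if S v then π v else s

module _ {n} {π : Fin n → Fin n} (idem : Idempotent π) {S : Fin n → Bool} {s : Fin n}
         (compat : Compatible π S) (Ss : S s ≡ false) where

  contract-idempotent : Idempotent (contract π S s)
  contract-idempotent v with S v in Sv
  ... | true  rewrite compat v | Sv = idem v
  ... | false rewrite Ss = refl

  compatible-contract : ∀ {X} → Compatible π X → (∀ v w → S v ≡ false → S w ≡ false → X v ≡ X w) →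
    Compatible (contract π S s) X
  compatible-contract cX const v with S v in Sv
  ... | true  = cX v
  ... | false = const s v Ss Sv

  class-in : ∀ {v} → S v ≡ true → class (contract π S s) v ≗ class π v
  class-in {v} Sv u with S u in Su
  ... | true  = refl
  ... | false = trans (≐-≢ v≢s) (sym (≐-≢ v≢πu))
    where
    v≢s : v ≢ s
    v≢s refl = true≢false (trans (sym Sv) Ss)
    v≢πu : v ≢ π u
    v≢πu refl = true≢false (trans (sym Sv) (trans (compat u) Su))

  class-out : class (contract π S s) s ≗ not ∘ S
  class-out u with S u in Su
  ... | false = ≐-refl s
  ... | true  = ≐-≢ λ s≡πu → true≢false
    (trans (sym Su) (trans (sym (compat u)) (trans (cong S (sym s≡πu)) Ss)))

-- Every old class survives in exactly one of the two contractions, and each contraction gains the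
-- class of its shrunk side.
#classes-contract : ∀ {n} {π : Fin n → Fin n} {S s t} → S s ≡ false → S t ≡ true →
  π s ≡ s → π t ≡ t →
  #classes (contract π S s) ℕ.+ #classes (contract π (not ∘ S) t) ≡ #classes π ℕ.+ 2
#classes-contract {π = π} {S} {s} {t} Ss St πs πt = begin
  #classes (contract π S s) ℕ.+ #classes (contract π (not ∘ S) t)
    ≡⟨ Σℕ.∑-distrib-+ (λ v → ⟦ v ≐ contract π S s v ⟧) _ ⟨
  Σℕ.sum (λ v → ⟦ v ≐ contract π S s v ⟧ ℕ.+ ⟦ v ≐ contract π (not ∘ S) t v ⟧)
    ≡⟨ Σℕ.sum-cong-≗ pointwise ⟩
  Σℕ.sum (λ v → ⟦ v ≐ π v ⟧ ℕ.+ (⟦ s ≐ v ⟧ ℕ.+ ⟦ t ≐ v ⟧))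
    ≡⟨ Σℕ.∑-distrib-+ (λ v → ⟦ v ≐ π v ⟧) _ ⟩
  #classes π ℕ.+ Σℕ.sum (λ v → ⟦ s ≐ v ⟧ ℕ.+ ⟦ t ≐ v ⟧)
    ≡⟨ cong (#classes π ℕ.+_) (trans (Σℕ.∑-distrib-+ (⟦_⟧ ∘ (s ≐_)) _)
         (cong₂ ℕ._+_ (count-point s) (count-point t))) ⟩
  #classes π ℕ.+ 2 ∎
  where
  open ≡-Reasoning
  ≐-sym : ∀ u v → u ≐ v ≡ v ≐ u
  ≐-sym u v with u Finₚ.≟ v
  ... | yes refl = sym (≐-refl u)
  ... | no  u≢v  = sym (≐-≢ (u≢v ∘ sym))
  pointwise : ∀ v → ⟦ v ≐ contract π S s v ⟧ ℕ.+ ⟦ v ≐ contract π (not ∘ S) t v ⟧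
                  ≡ ⟦ v ≐ π v ⟧ ℕ.+ (⟦ s ≐ v ⟧ ℕ.+ ⟦ t ≐ v ⟧)
  pointwise v with S v in Sv
  ... | true  rewrite ≐-≢ {i = s} {v} (λ { refl → true≢false (trans (sym Sv) Ss) }) | ≐-sym v t = refl
  ... | false rewrite ≐-≢ {i = t} {v} (λ { refl → true≢false (trans (sym St) Sv) }) | ≐-sym v s =
    trans (ℕₚ.+-comm ⟦ s ≐ v ⟧ _) (cong (⟦ v ≐ π v ⟧ ℕ.+_) (sym (ℕₚ.+-identityʳ ⟦ s ≐ v ⟧)))

-- Two classes inside `S` and the shrunk outside. This makes the truncated subtraction of 3 exact
-- and, through the total count, makes the other contraction strictly smaller.
3≤#classes-contract : ∀ {n} {π : Fin n → Fin n} {S s} → S s ≡ false → TwoClasses π S true →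
  3 ℕ.≤ #classes (contract π S s)
3≤#classes-contract {π = π} {S} {s} Ss (u , v , u≢v , (πu , Su) , (πv , Sv)) =
  distinct-indicators u≢v (outside Su) (outside Sv) _ (inside Su πu) (inside Sv πv) s-fixed
  where
  outside : ∀ {w} → S w ≡ true → w ≢ s
  outside Sw refl = true≢false (trans (sym Sw) Ss)
  inside : ∀ {w} → S w ≡ true → π w ≡ w → 1 ℕ.≤ ⟦ w ≐ contract π S s w ⟧
  inside {w} Sw πw rewrite Sw | πw | ≐-refl w = s≤s z≤n
  s-fixed : 1 ℕ.≤ ⟦ s ≐ contract π S s s ⟧
  s-fixed rewrite Ss | ≐-refl s = s≤s z≤n

module Spanning {n m : ℕ} (T : Fin n → Bool) (a b : Fin m → Fin n) (c : Fin m → ℕ) (γ : ℕ)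
  (valid : ∀ X → Cuts.Steiner T a b X → γ ℕ.≤ Cuts.Weights.weight T a b c γ X) where

  open Cuts T a b
  open Weights c γ

  -- The cuts given by a single class are kept apart from `L`: a class created by shrinking is the
  -- complement of a splitting cut, which is listed, so that in the end only classes of the original
  -- partition have to be tested, and few of those are Steiner. The common value `y` is 0 when the
  -- rank is counted and an unknown when `γ` is bounded.
  SpanningFamily : (Fin n → Fin n) → Set
  SpanningFamily π = Σ[ L ∈ List (Fin n → Bool) ] All Tight L × length L ℕ.≤ #classes π ℕ.∸ 3 ×
    (∀ x y → Supported x →
      (∀ v → π v ≡ v → Tight (class π v) → value x (class π v) ≡ y) →
      All (λ X → value x X ≡ y) L →
      ∀ X → Tight X → Compatible π X → value x X ≡ y)

  Splitting : (Fin n → Fin n) → (Fin n → Bool) → Set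
  Splitting π S = Tight S × Compatible π S × TwoClasses π S true × TwoClasses π S false

  splitting? : ∀ π → Dec (∃ (Splitting π))
  splitting? π = anySet? (λ eq (t , cS , in₂ , out₂) → tight-resp eq t
      , (λ v → trans (sym (eq (π v))) (trans (cS v) (eq v)))
      , twoClasses-resp π eq in₂ , twoClasses-resp π eq out₂)
    (λ S → tight? S ×-dec (Finₚ.all? (λ v → S (π v) Boolₚ.≟ S v)
      ×-dec (twoClasses? π S true ×-dec twoClasses? π S false)))

  unsplit-class : ∀ (π : Fin n → Fin n) X {β u} → Idempotent π → Compatible π X → X u ≡ β → ¬ TwoClasses π X β →
    ∀ w → X w ≡ β → π w ≡ π u
  unsplit-class π X {β} {u} idem cX Xu one w Xw with π w Finₚ.≟ π u
  ... | yes eq = eq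
  ... | no neq = contradiction
    (π w , π u , neq , (idem w , trans (cX w) Xw) , (idem u , trans (cX u) Xu)) one

  -- A tight cut with two classes on each side would be a splitting, so one of its sides is a single
  -- class.
  unsplit : ∀ {π : Fin n → Fin n} → Idempotent π → ¬ ∃ (Splitting π) → ∀ X → Tight X → Compatible π X →
    ∃[ v ] π v ≡ v × ((class π v ≗ X) ⊎ (class π v ≗ not ∘ X))
  unsplit {π} idem none X tX@(((u , _ , Xu) , (v , _ , Xv)) , _) cX
    with twoClasses? π X true
  ... | no one = π u , idem u , inj₁ λ w → bool-ext
        (λ eq → trans (sym (cX w)) (trans (cong X (sym (≐⇒≡ eq))) (trans (cX u) Xu)))
        (λ Xw → trans (cong (_≐ π w) (sym (unsplit-class π X idem cX Xu one w Xw))) (≐-refl (π w)))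
  ... | yes two with twoClasses? π X false
  ...   | yes two′ = contradiction (X , tX , cX , two , two′) none
  ...   | no one = π v , idem v , inj₂ λ w → bool-ext
        (λ eq → cong not (trans (sym (cX w)) (trans (cong X (sym (≐⇒≡ eq))) (trans (cX v) Xv))))
        (λ Xw → trans (cong (_≐ π w) (sym (unsplit-class π X idem cX Xv one w (Boolₚ.not-injective Xw))))
          (≐-refl (π w)))

  -- Uncrossing a tight `X` with the splitting cut `S` gives two tight cuts, one constant outside
  -- `S` and one constant inside `S`. Each is compatible with one of the two contractions, so
  -- induction gives both of them the value `y`; as `S` has value `y` too, so has `X`.
  spanningFamily : ∀ π → Idempotent π → Acc ℕ._<_ (#classes π) → SpanningFamily π
  spanningFamily π idem (acc rec) with splitting? π
  ... | no none = [] , [] , z≤n , λ x y sx classes [] X tX cX → go x y classes X tX (unsplit idem none X tX cX)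
    where
    go : ∀ x y → (∀ v → π v ≡ v → Tight (class π v) → value x (class π v) ≡ y) → ∀ X → Tight X →
      (∃[ v ] π v ≡ v × ((class π v ≗ X) ⊎ (class π v ≗ not ∘ X))) → value x X ≡ y
    go x y classes X tX (v , πv , inj₁ eq) =
      trans (sym (value-resp x _ X eq)) (classes v πv (tight-resp (sym ∘ eq) tX))
    go x y classes X ((s , t) , w) (v , πv , inj₂ eq) =
      trans (trans (sym (value-not x X)) (sym (value-resp x _ (not ∘ X) eq)))
        (classes v πv (tight-resp (sym ∘ eq) ((flip t , flip s)
          , trans (weight-not X) w)))
      where
      flip : ∀ {β} → (∃[ v ] T v ≡ true × X v ≡ β) → ∃[ v ] T v ≡ true × not (X v) ≡ not β
      flip (v , Tv , Xv) = v , Tv , cong not Xv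
  ... | yes (S , tS@(sS , _) , cS , in₂@(t , _ , _ , (πt , St) , _) , out₂@(s , _ , _ , (πs , Ss) , _)) =
    S ∷ L₁ List.++ L₂ , tS ∷ Allₚ.++⁺ tL₁ tL₂ , size , spans
    where
    S′ = not ∘ S
    cS′ : Compatible π S′
    cS′ v = cong not (cS v)
    π₁ = contract π S s
    π₂ = contract π S′ t
    S′t = cong not St
    total : #classes π₁ ℕ.+ #classes π₂ ≡ #classes π ℕ.+ 2
    total = #classes-contract Ss St πs πt
    negate : TwoClasses π S false → TwoClasses π S′ true
    negate (u , v , u≢v , (πu , Su) , (πv , Sv)) = u , v , u≢v , (πu , cong not Su) , (πv , cong not Sv)
    3≤₁ : 3 ℕ.≤ #classes π₁
    3≤₁ = 3≤#classes-contract Ss in₂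
    3≤₂ : 3 ℕ.≤ #classes π₂
    3≤₂ = 3≤#classes-contract S′t (negate out₂)
    smaller : ∀ {p q r} → p ℕ.+ q ≡ r ℕ.+ 2 → 3 ℕ.≤ q → p ℕ.< r
    smaller {p} {q} {r} eq 3≤q = ℕₚ.+-cancelʳ-≤ 2 (suc p) r (begin
      suc p ℕ.+ 2 ≡⟨ ℕₚ.+-suc p 2 ⟨
      p ℕ.+ 3     ≤⟨ ℕₚ.+-monoʳ-≤ p 3≤q ⟩
      p ℕ.+ q     ≡⟨ eq ⟩
      r ℕ.+ 2     ∎)
      where open ℕₚ.≤-Reasoning
    idem₁ = contract-idempotent idem cS Ss
    idem₂ = contract-idempotent idem cS′ S′t
    F₁ = spanningFamily π₁ idem₁ (rec (smaller total 3≤₂))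
    F₂ = spanningFamily π₂ idem₂ (rec (smaller (trans (ℕₚ.+-comm (#classes π₂) _) total) 3≤₁))
    L₁ = proj₁ F₁
    L₂ = proj₁ F₂
    tL₁ = proj₁ (proj₂ F₁)
    tL₂ = proj₁ (proj₂ F₂)
    -- `r - 3` solves the recurrence `f r = 1 + f p + f q` for `p + q = r + 2`.
    sizes : ∀ {p q r l₁ l₂} → 3 ℕ.≤ p → 3 ℕ.≤ q → p ℕ.+ q ≡ r ℕ.+ 2 →
      l₁ ℕ.≤ p ℕ.∸ 3 → l₂ ℕ.≤ q ℕ.∸ 3 → suc (l₁ ℕ.+ l₂) ℕ.≤ r ℕ.∸ 3
    sizes {suc (suc (suc p))} {suc (suc (suc q))} {r} {l₁} {l₂}
      (s≤s (s≤s (s≤s _))) (s≤s (s≤s (s≤s _))) eq l₁≤ l₂≤ = begin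
      suc (l₁ ℕ.+ l₂) ≤⟨ s≤s (ℕₚ.+-mono-≤ l₁≤ l₂≤) ⟩
      suc (p ℕ.+ q)   ≡⟨⟩
      4 ℕ.+ (p ℕ.+ q) ℕ.∸ 3 ≡⟨ cong (ℕ._∸ 3) r≡ ⟨
      r ℕ.∸ 3 ∎
      where
      open ℕₚ.≤-Reasoning
      shuffle : ∀ p q → 3 ℕ.+ p ℕ.+ (3 ℕ.+ q) ≡ 4 ℕ.+ (p ℕ.+ q) ℕ.+ 2
      shuffle = ℕ-Solver.solve-∀
      r≡ : r ≡ 4 ℕ.+ (p ℕ.+ q)
      r≡ = ℕₚ.+-cancelʳ-≡ 2 r _ (trans (sym eq) (shuffle p q))
    size : suc (length (L₁ List.++ L₂)) ℕ.≤ #classes π ℕ.∸ 3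
    size rewrite Listₚ.length-++ L₁ {L₂} =
      sizes 3≤₁ 3≤₂ total (proj₁ (proj₂ (proj₂ F₁))) (proj₁ (proj₂ (proj₂ F₂)))
    spans : ∀ x y → Supported x →
      (∀ v → π v ≡ v → Tight (class π v) → value x (class π v) ≡ y) →
      All (λ X → value x X ≡ y) (S ∷ L₁ List.++ L₂) →
      ∀ X → Tight X → Compatible π X → value x X ≡ y
    spans x y sx classes (xS ∷ xL) X tX@(sX , _) cX = crossing (uncross-steiner sX sS)
      where
      classes₁ : ∀ v → π₁ v ≡ v → Tight (class π₁ v) → value x (class π₁ v) ≡ y
      classes₁ v π₁v tv with S v in Sv
      ... | true  = trans (value-resp x _ (class π v) (class-in idem cS Ss Sv))
                      (classes v π₁v (tight-resp (class-in idem cS Ss Sv) tv))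
      -- Here `v` is the representative `s` of the shrunk side, whose class is the complement of
      -- `S`.
      ... | false rewrite sym π₁v =
        trans (value-resp x _ S′ (class-out idem cS Ss)) (trans (value-not x S) xS)
      classes₂ : ∀ v → π₂ v ≡ v → Tight (class π₂ v) → value x (class π₂ v) ≡ y
      classes₂ v π₂v tv with S v in Sv
      ... | false = trans (value-resp x _ (class π v) (class-in idem cS′ S′t (cong not Sv)))
                      (classes v π₂v (tight-resp (class-in idem cS′ S′t (cong not Sv)) tv))
      ... | true rewrite sym π₂v =
        trans (value-resp x _ (not ∘ S′) (class-out idem cS′ S′t))
          (trans (value-not x S′) (trans (value-not x S) xS))
      inside : ∀ Y → Tight Y → Compatible π Y → (∀ v w → S v ≡ false → S w ≡ false → Y v ≡ Y w) → value x Y ≡ y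
      inside Y tY cY const = proj₂ (proj₂ (proj₂ F₁)) x y sx classes₁ (Allₚ.++⁻ˡ L₁ xL) Y tY
        (compatible-contract idem cS Ss cY const)
      outside : ∀ Y → Tight Y → Compatible π Y → (∀ v w → S v ≡ true → S w ≡ true → Y v ≡ Y w) → value x Y ≡ y
      outside Y tY cY const = proj₂ (proj₂ (proj₂ F₂)) x y sx classes₂ (Allₚ.++⁻ʳ L₁ xL) Y tY
        (compatible-contract idem cS′ S′t cY λ v w Sv Sw →
          const v w (Boolₚ.not-injective Sv) (Boolₚ.not-injective Sw))
      conclude : ∀ P Q → value x P ≡ y → value x Q ≡ y →
        value x P ℤ.+ value x Q ≡ value x X ℤ.+ value x S → value x X ≡ y
      conclude P Q p q eq = sym (ℤ-Group.∙-cancelʳ y y (value x X)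
        (trans (sym (cong₂ ℤ._+_ p q)) (trans eq (cong (λ z → value x X ℤ.+ z) xS))))
      crossing : (Steiner (X ⊓ S) × Steiner (X ⊔ S)) ⊎ (Steiner (X ∖ S) × Steiner (S ∖ X)) → value x X ≡ y
      crossing (inj₁ (s⊓ , s⊔)) = conclude (X ⊓ S) (X ⊔ S)
        (inside (X ⊓ S) (proj₁ tights) (λ v → cong₂ _∧_ (cX v) (cS v))
          (λ v w Sv Sw → trans (trans (cong (X v ∧_) Sv) (Boolₚ.∧-zeroʳ (X v)))
            (sym (trans (cong (X w ∧_) Sw) (Boolₚ.∧-zeroʳ (X w))))))
        (outside (X ⊔ S) (proj₂ tights) (λ v → cong₂ _∨_ (cX v) (cS v))
          (λ v w Sv Sw → trans (trans (cong (X v ∨_) Sv) (Boolₚ.∨-zeroʳ (X v)))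
            (sym (trans (cong (X w ∨_) Sw) (Boolₚ.∨-zeroʳ (X w))))))
        (uncross-value valid X S (X ⊓ S) (X ⊔ S) (cut-⊓-⊔ X S) tX tS s⊓ s⊔ x sx)
        where tights = uncross-tight valid X S (X ⊓ S) (X ⊔ S) (cut-⊓-⊔ X S) tX tS s⊓ s⊔
      crossing (inj₂ (s∖ , s∖′)) = conclude (X ∖ S) (S ∖ X)
        (outside (X ∖ S) (proj₁ tights) (λ v → cong₂ (λ p q → p ∧ not q) (cX v) (cS v))
          (λ v w Sv Sw → trans (trans (cong (λ q → X v ∧ not q) Sv) (Boolₚ.∧-zeroʳ (X v)))
            (sym (trans (cong (λ q → X w ∧ not q) Sw) (Boolₚ.∧-zeroʳ (X w))))))
        (inside (S ∖ X) (proj₂ tights) (λ v → cong₂ (λ p q → p ∧ not q) (cS v) (cX v))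
          (λ v w Sv Sw → trans (cong (λ q → q ∧ not (X v)) Sv) (sym (cong (λ q → q ∧ not (X w)) Sw))))
        (uncross-value valid X S (X ∖ S) (S ∖ X) (cut-∖-∖ X S) tX tS s∖ s∖′ x sx)
        where tights = uncross-tight valid X S (X ∖ S) (S ∖ X) (cut-∖-∖ X S) tX tS s∖ s∖′

-- Splitting off nonterminals of degree two

⟦⟧≡1 : ∀ {p} → ⟦ p ⟧ ≡ 1 → p ≡ true
⟦⟧≡1 {true} _ = refl

⟦⟧≢1 : ∀ {p} → ⟦ p ⟧ ≢ 1 → ⟦ p ⟧ ≡ 0
⟦⟧≢1 {true}  p≢1 = contradiction refl p≢1
⟦⟧≢1 {false} _   = refl

live⁺ : ∀ {k} → live k ≡ true → k ≢ 0
live⁺ () refl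

sumℤ-zero : ∀ {N} {f : Fin N → ℤ} → (∀ i → f i ≡ 0ℤ) → Σℤ.sum f ≡ 0ℤ
sumℤ-zero {N} f≡0 = trans (Σℤ.sum-cong-≗ f≡0) (Σℤ.sum-replicate-zero N)

sumℤ-point : ∀ {N} (i : Fin N) (f : Fin N → ℤ) → Σℤ.sum (λ j → + ⟦ i ≐ j ⟧ ℤ.* f j) ≡ f i
sumℤ-point zero f = trans (cong₂ ℤ._+_ (ℤₚ.*-identityˡ (f zero)) (sumℤ-zero λ j → ℤₚ.*-zeroˡ (f (suc j))))
  (ℤₚ.+-identityʳ (f zero))
sumℤ-point (suc i) f = trans
  (cong₂ ℤ._+_ (ℤₚ.*-zeroˡ (f zero)) (sumℤ-point i (f ∘ suc)))
  (ℤₚ.+-identityˡ (f (suc i)))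

flip : ∀ {n} → Fin n → (Fin n → Bool) → Fin n → Bool
flip v X u = if v ≐ u then not (X u) else X u

module Reduction {n m : ℕ} (T : Fin n → Bool) (a b : Fin m → Fin n) (c : Fin m → ℕ) (γ : ℕ)
  (extremal : Cuts.Weights.Extremal T a b c γ) where

  open Cuts T a b
  open Weights c γ
  open Extremal extremal

  Incident : Fin n → Fin m → Set
  Incident v e = live (c e) ≡ true × (a e ≐ v) ∨ (b e ≐ v) ≡ true

  incident? : ∀ v e → Dec (Incident v e)
  incident? v e = (live (c e) Boolₚ.≟ true) ×-dec ((a e ≐ v) ∨ (b e ≐ v) Boolₚ.≟ true)

  -- Otherwise the unit vector at `e` has value 0 on every tight cut, against `rigid`.
  tightThrough : ∀ e → live (c e) ≡ true → ∃[ X ] Tight X × cut X e ≡ 1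
  tightThrough e le with anySet? {P = λ X → Tight X × cut X e ≡ 1}
    (λ eq (t , ce) → tight-resp eq t , trans (sym (cut-resp eq e)) ce)
    (λ X → tight? X ×-dec (cut X e ℕₚ.≟ 1))
  ... | yes found = found
  ... | no none = contradiction (rigid x sx killed e) x≢0
    where
    x : Fin m → ℤ
    x f = + ⟦ e ≐ f ⟧
    x≢0 : x e ≢ 0ℤ
    x≢0 eq rewrite ≐-refl e = case-⊥ eq
      where
      case-⊥ : 1ℤ ≢ 0ℤ
      case-⊥ ()
    sx : Supported x
    sx f lf with e Finₚ.≟ f
    ... | yes refl = contradiction (trans (sym le) lf) true≢false
    ... | no _     = refl
    killed : ∀ X → Tight X → value x X ≡ 0ℤ
    killed X tX = sumℤ-zero term
      where
      term : ∀ f → + cut X f ℤ.* x f ≡ 0ℤ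
      term f with e Finₚ.≟ f
      ... | no _     = ℤₚ.*-zeroʳ (+ cut X f)
      ... | yes refl rewrite ⟦⟧≢1 {X (a e) xor X (b e)} (λ ce → none (X , tX , ce)) = refl

  -- A loop lies in no cut, whereas a live edge lies in a tight one.
  live⇒ends-distinct : ∀ e → live (c e) ≡ true → a e ≢ b e
  live⇒ends-distinct e le ae≡be with tightThrough e le
  ... | X , _ , ce rewrite ae≡be | Boolₚ.xor-same (X (b e)) = contradiction ce λ ()

  weight≤γ : ∀ e → c e ℕ.≤ γ
  weight≤γ e with c e in ce
  ... | zero  = z≤n
  ... | suc k with tightThrough e (cong live ce)
  ...   | X , (_ , w) , cut≡1 = begin
    suc k           ≡⟨ ce ⟨
    c e             ≡⟨ ℕₚ.*-identityʳ (c e) ⟨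
    c e ℕ.* 1       ≡⟨ cong (c e ℕ.*_) cut≡1 ⟨
    c e ℕ.* cut X e ≤⟨ term≤sum (λ f → c f ℕ.* cut X f) e ⟩
    weight X        ≡⟨ w ⟩
    γ               ∎
    where open ℕₚ.≤-Reasoning

  existsLive : ∃[ e ] live (c e) ≡ true
  existsLive with Finₚ.any? (λ e → live (c e) Boolₚ.≟ true)
  ... | yes found = found
  -- If all weights were 0, then 2 would divide each of them and hence 1.
  ... | no none   = contradiction (∣.∣⇒≤ (coprime 1 2 even)) λ { (s≤s ()) }
    where
    even : ∀ e → 2 ∣ 1 ℕ.* c e
    even e rewrite live⁻ (Boolₚ.¬-not (λ le → none (e , le))) = 2 ∣.∣0

  abstract
    existsTight : ∃ Tight
    existsTight = let e , le = existsLive ; X , tX , _ = tightThrough e le in X , tX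

  module Flip {v} (Tv : T v ≡ false) where

    flip-steiner : ∀ {X} → Steiner X → Steiner (flip v X)
    flip-steiner {X} ((s , Ts , Xs) , (t , Tt , Xt)) =
      (s , Ts , trans (terminal Ts) Xs) , (t , Tt , trans (terminal Tt) Xt)
      where
      terminal : ∀ {w} → T w ≡ true → flip v X w ≡ X w
      terminal {w} Tw rewrite ≐-≢ {i = v} {w} (λ { refl → true≢false (trans (sym Tw) Tv) }) = refl

    flip-outside : ∀ X {e} → live (c e) ≡ true → ¬ Incident v e → cut (flip v X) e ≡ cut X e
    flip-outside X {e} le ninc with v Finₚ.≟ a e | v Finₚ.≟ b e
    ... | yes refl | _        = contradiction (le , cong (_∨ (b e ≐ v)) (≐-refl v)) ninc
    ... | no _     | yes refl =
      contradiction (le , trans (cong ((a e ≐ v) ∨_) (≐-refl v)) (Boolₚ.∨-zeroʳ _)) ninc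
    ... | no _     | no _     = refl

    flip-incident : ∀ X {e} → Incident v e → cut (flip v X) e ≡ ⟦ not (X (a e) xor X (b e)) ⟧
    flip-incident X {e} (le , inc) with v Finₚ.≟ a e | v Finₚ.≟ b e
    ... | yes p    | yes q = contradiction (trans (sym p) q) (live⇒ends-distinct e le)
    ... | yes _    | no _  = cong ⟦_⟧ (sym (Boolₚ.not-distribˡ-xor (X (a e)) (X (b e))))
    ... | no _     | yes _ = cong ⟦_⟧ (sym (Boolₚ.not-distribʳ-xor (X (a e)) (X (b e))))
    ... | no p     | no q  =
      contradiction (trans (sym inc) (cong₂ _∨_ (≐-≢ (p ∘ sym)) (≐-≢ (q ∘ sym)))) true≢false

    flip-cut : ∀ X {e} → Incident v e → cut X e ≡ 1 → cut (flip v X) e ≡ 0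
    flip-cut X {e} inc eq rewrite flip-incident X inc | ⟦⟧≡1 {X (a e) xor X (b e)} eq = refl

    flip-uncut : ∀ X {e} → Incident v e → cut X e ≡ 0 → cut (flip v X) e ≡ 1
    flip-uncut X {e} inc eq rewrite flip-incident X inc with X (a e) xor X (b e)
    ... | false = refl

    -- Moving `v` changes the cut only at live edges incident to `v`, up to edges of weight 0, where
    -- `P` has to hold for arbitrary entries. Comparisons of weights and of values of supported
    -- vectors both have this shape.
    flip-pointwise : ∀ X (P : Fin m → ℕ → ℕ → Set) →
      (∀ e → c e ≡ 0 → ∀ {i j} → P e i j) → (∀ e {i} → ¬ Incident v e → P e i i) →
      (∀ e → Incident v e → P e (cut (flip v X) e) (cut X e)) →
      ∀ e → P e (cut (flip v X) e) (cut X e)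
    flip-pointwise X P dead outside inside e with incident? v e
    ... | yes inc = inside e inc
    ... | no ninc = go (c e) refl
      where
      go : ∀ k → c e ≡ k → P e (cut (flip v X) e) (cut X e)
      go zero    ce = dead e ce
      go (suc k) ce = subst (λ i → P e i (cut X e)) (sym (flip-outside X (cong live ce) ninc)) (outside e ninc)

    -- Moving v across a tight cut containing all edges at v would improve it.
    someUncut : ∀ {e} → Incident v e → ∀ {X} → Tight X → ¬ (∀ f → Incident v f → cut X f ≡ 1)
    someUncut {e} inc {X} (sX , w) all = live⁺ (proj₁ inc) (begin
      c e                    ≡⟨ ℕₚ.*-identityʳ (c e) ⟨
      c e ℕ.* 1              ≡⟨ cong (c e ℕ.*_) (all e inc) ⟨
      c e ℕ.* cut X e        ≡⟨ sum-≡⇒pointwise smaller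
        (ℕₚ.≤-trans (ℕₚ.≤-reflexive w) (valid _ (flip-steiner sX))) e ⟨
      c e ℕ.* cut (flip v X) e ≡⟨ cong (c e ℕ.*_) (flip-cut X inc (all e inc)) ⟩
      c e ℕ.* 0              ≡⟨ ℕₚ.*-zeroʳ (c e) ⟩
      0                      ∎)
      where
      open ≡-Reasoning
      smaller : ∀ f → c f ℕ.* cut (flip v X) f ℕ.≤ c f ℕ.* cut X f
      smaller = flip-pointwise X (λ f i j → c f ℕ.* i ℕ.≤ c f ℕ.* j)
        (λ f cf → subst (λ k → k ℕ.* _ ℕ.≤ k ℕ.* _) (sym cf) z≤n)
        (λ _ _ → ℕₚ.≤-refl)
        (λ f incf → ℕₚ.*-monoʳ-≤ (c f) (subst (ℕ._≤ cut X f) (sym (flip-cut X incf (all f incf))) z≤n))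

    -- If `e` were the only live edge at `v`, a tight cut through `e` would contain all live edges
    -- at `v`, which `someUncut` forbids.
    anotherEdge : ∀ e → Incident v e → ∃[ f ] e ≢ f × Incident v f
    anotherEdge e inc with Finₚ.any? (λ f → ¬? (e Finₚ.≟ f) ×-dec incident? v f)
    ... | yes found = found
    ... | no none with tightThrough e (proj₁ inc)
    ...   | X , tX , ce = contradiction only (someUncut inc tX)
      where
      only : ∀ f → Incident v f → cut X f ≡ 1
      only f incf with e Finₚ.≟ f
      ... | yes refl = ce
      ... | no e≢f   = contradiction (f , e≢f , incf) none

  record DegreeTwo (v : Fin n) (e f : Fin m) : Set where
    field
      nonterminal : T v ≡ false
      e≢f         : e ≢ f
      incₑ        : Incident v e
      inc_f       : Incident v f
      only        : ∀ h → Incident v h → e ≡ h ⊎ f ≡ h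

  degreeTwo? : ∀ v e f → Dec (DegreeTwo v e f)
  degreeTwo? v e f = map′
    (λ (Tv , e≢f , ie , if , only) → record
      { nonterminal = Tv ; e≢f = e≢f ; incₑ = ie ; inc_f = if ; only = only })
    (λ d → let open DegreeTwo d in nonterminal , e≢f , incₑ , inc_f , only)
    ((T v Boolₚ.≟ false) ×-dec (¬? (e Finₚ.≟ f) ×-dec (incident? v e ×-dec (incident? v f ×-dec
      Finₚ.all? (λ h → incident? v h →-dec ((e Finₚ.≟ h) ⊎-dec (f Finₚ.≟ h)))))))

  degreeTwo-sym : ∀ {v e f} → DegreeTwo v e f → DegreeTwo v f e
  degreeTwo-sym d = record
    { nonterminal = nonterminal ; e≢f = e≢f ∘ sym ; incₑ = inc_f ; inc_f = incₑ
    ; only = λ h inc → Sum.swap (only h inc) }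
    where
    open DegreeTwo d

  module _ {v e f} (d : DegreeTwo v e f) where

    open DegreeTwo d
    open Flip nonterminal

    notBoth : ∀ {X} → Tight X → cut X e ≡ 1 → cut X f ≡ 0
    notBoth {X} tX ce = ⟦⟧≢1 {X (a f) xor X (b f)} λ cf → someUncut incₑ tX λ h inc → both cf h (only h inc)
      where
      both : cut X f ≡ 1 → ∀ h → e ≡ h ⊎ f ≡ h → cut X h ≡ 1
      both cf h (inj₁ refl) = ce
      both cf h (inj₂ refl) = cf

    private
      flip-two : ∀ {X} → cut X e ≡ 1 → cut X f ≡ 0 →
        (P : Fin m → ℕ → ℕ → Set) →
        (∀ h → c h ≡ 0 → ∀ {i j} → P h i j) →
        (∀ h {i} → e ≢ h → f ≢ h → P h i i) → P e 0 1 → P f 1 0 →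
        ∀ h → P h (cut (flip v X) h) (cut X h)
      flip-two {X} ce cf P dead other pe pf = flip-pointwise X P dead
        (λ h ninc → other h (λ { refl → ninc incₑ }) (λ { refl → ninc inc_f }))
        (λ h inc → at h (only h inc))
        where
        at : ∀ h → e ≡ h ⊎ f ≡ h → P h (cut (flip v X) h) (cut X h)
        at h (inj₁ refl) rewrite flip-cut X incₑ ce | ce = pe
        at h (inj₂ refl) rewrite flip-uncut X inc_f cf | cf = pf

    -- Moving `v` exchanges `e` for `f` in the cut. Adding the lost and the gained weight on
    -- opposite sides avoids subtraction.
    flip-weight : ∀ {X} → cut X e ≡ 1 → cut X f ≡ 0 → weight (flip v X) ℕ.+ c e ≡ weight X ℕ.+ c f
    flip-weight {X} ce cf = begin
      weight (flip v X) ℕ.+ c e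
        ≡⟨ cong (weight (flip v X) ℕ.+_) (sum-point e c) ⟨
      weight (flip v X) ℕ.+ Σℕ.sum (λ h → ⟦ e ≐ h ⟧ ℕ.* c h)
        ≡⟨ Σℕ.∑-distrib-+ (λ h → c h ℕ.* cut (flip v X) h) _ ⟨
      Σℕ.sum (λ h → c h ℕ.* cut (flip v X) h ℕ.+ ⟦ e ≐ h ⟧ ℕ.* c h)
        ≡⟨ Σℕ.sum-cong-≗ (flip-two {X} ce cf
             (λ h i j → c h ℕ.* i ℕ.+ ⟦ e ≐ h ⟧ ℕ.* c h ≡ c h ℕ.* j ℕ.+ ⟦ f ≐ h ⟧ ℕ.* c h)
             dead other pe pf) ⟩
      Σℕ.sum (λ h → c h ℕ.* cut X h ℕ.+ ⟦ f ≐ h ⟧ ℕ.* c h)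
        ≡⟨ Σℕ.∑-distrib-+ (λ h → c h ℕ.* cut X h) _ ⟩
      weight X ℕ.+ Σℕ.sum (λ h → ⟦ f ≐ h ⟧ ℕ.* c h)
        ≡⟨ cong (weight X ℕ.+_) (sum-point f c) ⟩
      weight X ℕ.+ c f ∎
      where
      open ≡-Reasoning
      dead : ∀ h → c h ≡ 0 → ∀ {i j} → c h ℕ.* i ℕ.+ ⟦ e ≐ h ⟧ ℕ.* c h ≡ c h ℕ.* j ℕ.+ ⟦ f ≐ h ⟧ ℕ.* c h
      dead h ch rewrite ch = trans (ℕₚ.*-zeroʳ ⟦ e ≐ h ⟧) (sym (ℕₚ.*-zeroʳ ⟦ f ≐ h ⟧))
      other : ∀ h {i} → e ≢ h → f ≢ h → c h ℕ.* i ℕ.+ ⟦ e ≐ h ⟧ ℕ.* c h ≡ c h ℕ.* i ℕ.+ ⟦ f ≐ h ⟧ ℕ.* c h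
      other h e≢h f≢h rewrite ≐-≢ e≢h | ≐-≢ f≢h = refl
      arith₁ : ∀ k → k ℕ.* 0 ℕ.+ 1 ℕ.* k ≡ k ℕ.* 1 ℕ.+ 0 ℕ.* k
      arith₁ = ℕ-Solver.solve-∀
      pe : c e ℕ.* 0 ℕ.+ ⟦ e ≐ e ⟧ ℕ.* c e ≡ c e ℕ.* 1 ℕ.+ ⟦ f ≐ e ⟧ ℕ.* c e
      pe rewrite ≐-refl e | ≐-≢ (e≢f ∘ sym) = arith₁ (c e)
      pf : c f ℕ.* 1 ℕ.+ ⟦ e ≐ f ⟧ ℕ.* c f ≡ c f ℕ.* 0 ℕ.+ ⟦ f ≐ f ⟧ ℕ.* c f
      pf rewrite ≐-refl f | ≐-≢ e≢f = sym (arith₁ (c f))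

    flip-value : ∀ x {X} → Supported x → cut X e ≡ 1 → cut X f ≡ 0 →
      value x (flip v X) ℤ.+ x e ≡ value x X ℤ.+ x f
    flip-value x {X} sx ce cf = begin
      value x (flip v X) ℤ.+ x e
        ≡⟨ cong (λ z → value x (flip v X) ℤ.+ z) (sumℤ-point e x) ⟨
      value x (flip v X) ℤ.+ Σℤ.sum (λ h → + ⟦ e ≐ h ⟧ ℤ.* x h)
        ≡⟨ Σℤ.∑-distrib-+ (λ h → + cut (flip v X) h ℤ.* x h) _ ⟨
      Σℤ.sum (λ h → + cut (flip v X) h ℤ.* x h ℤ.+ + ⟦ e ≐ h ⟧ ℤ.* x h)
        ≡⟨ Σℤ.sum-cong-≗ (flip-two {X} ce cf
             (λ h i j → + i ℤ.* x h ℤ.+ + ⟦ e ≐ h ⟧ ℤ.* x h ≡ + j ℤ.* x h ℤ.+ + ⟦ f ≐ h ⟧ ℤ.* x h)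
             dead other pe pf) ⟩
      Σℤ.sum (λ h → + cut X h ℤ.* x h ℤ.+ + ⟦ f ≐ h ⟧ ℤ.* x h)
        ≡⟨ Σℤ.∑-distrib-+ (λ h → + cut X h ℤ.* x h) _ ⟩
      value x X ℤ.+ Σℤ.sum (λ h → + ⟦ f ≐ h ⟧ ℤ.* x h)
        ≡⟨ cong (λ z → value x X ℤ.+ z) (sumℤ-point f x) ⟩
      value x X ℤ.+ x f ∎
      where
      open ≡-Reasoning
      zeros : ∀ i j k l → i ℤ.* 0ℤ ℤ.+ j ℤ.* 0ℤ ≡ k ℤ.* 0ℤ ℤ.+ l ℤ.* 0ℤ
      zeros = ℤ-Solver.solve-∀
      dead : ∀ h → c h ≡ 0 → ∀ {i j} → + i ℤ.* x h ℤ.+ + ⟦ e ≐ h ⟧ ℤ.* x h ≡ + j ℤ.* x h ℤ.+ + ⟦ f ≐ h ⟧ ℤ.* x h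
      dead h ch {i} {j} rewrite sx h (cong live ch) = zeros (+ i) (+ ⟦ e ≐ h ⟧) (+ j) (+ ⟦ f ≐ h ⟧)
      other : ∀ h {i} → e ≢ h → f ≢ h →
        + i ℤ.* x h ℤ.+ + ⟦ e ≐ h ⟧ ℤ.* x h ≡ + i ℤ.* x h ℤ.+ + ⟦ f ≐ h ⟧ ℤ.* x h
      other h e≢h f≢h rewrite ≐-≢ e≢h | ≐-≢ f≢h = refl
      pe : + 0 ℤ.* x e ℤ.+ + ⟦ e ≐ e ⟧ ℤ.* x e ≡ + 1 ℤ.* x e ℤ.+ + ⟦ f ≐ e ⟧ ℤ.* x e
      pe rewrite ≐-refl e | ≐-≢ (e≢f ∘ sym) = ℤₚ.+-comm (+ 0 ℤ.* x e) (+ 1 ℤ.* x e)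
      pf : + 1 ℤ.* x f ℤ.+ + ⟦ e ≐ f ⟧ ℤ.* x f ≡ + 0 ℤ.* x f ℤ.+ + ⟦ f ≐ f ⟧ ℤ.* x f
      pf rewrite ≐-refl f | ≐-≢ e≢f = ℤₚ.+-comm (+ 1 ℤ.* x f) (+ 0 ℤ.* x f)

    -- Moving `v` across a tight cut through `e` trades `e` for `f`, and the result still weighs at
    -- least `γ`.
    degreeTwo-≤ : c e ℕ.≤ c f
    degreeTwo-≤ with tightThrough e (proj₁ incₑ)
    ... | X , tX@(sX , w) , ce = ℕₚ.+-cancelˡ-≤ γ (c e) (c f) (begin
      γ ℕ.+ c e                 ≤⟨ ℕₚ.+-monoˡ-≤ (c e) (valid _ (flip-steiner sX)) ⟩
      weight (flip v X) ℕ.+ c e ≡⟨ flip-weight {X} ce (notBoth {X} tX ce) ⟩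
      weight X ℕ.+ c f          ≡⟨ cong (ℕ._+ c f) w ⟩
      γ ℕ.+ c f                 ∎)
      where open ℕₚ.≤-Reasoning

  degreeTwo-≡ : ∀ {v e f} → DegreeTwo v e f → c e ≡ c f
  degreeTwo-≡ d = ℕₚ.≤-antisym (degreeTwo-≤ d) (degreeTwo-≤ (degreeTwo-sym d))

  -- Contract e, i.e. replace the path formed by e and f by the single edge f.
  module SplitOff {v e f} (d : DegreeTwo v e f) where

    open DegreeTwo d
    open Flip nonterminal

    u : Fin n
    u = if a e ≐ v then b e else a e

    π : Fin n → Fin n
    π w = if v ≐ w then u else w

    a′ b′ : Fin m → Fin n
    a′ = π ∘ a
    b′ = π ∘ b

    c′ : Fin m → ℕ
    c′ h = if e ≐ h then 0 else c h

    private
      module C′ = Cuts T a′ b′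
      module W′ = C′.Weights c′ γ

    c′-≢ : ∀ {h} → e ≢ h → c′ h ≡ c h
    c′-≢ e≢h rewrite ≐-≢ e≢h = refl

    ends : (a e ≡ v × b e ≡ u) ⊎ (a e ≡ u × b e ≡ v)
    ends with a e Finₚ.≟ v | b e Finₚ.≟ v | proj₂ incₑ
    ... | yes p | _     | _ = inj₁ (p , refl)
    ... | no _  | yes q | _ = inj₂ (refl , q)
    ... | no _  | no _  | ()

    v≢u : v ≢ u
    v≢u v≡u with ends
    ... | inj₁ (p , q) = live⇒ends-distinct e (proj₁ incₑ) (trans p (trans v≡u (sym q)))
    ... | inj₂ (p , q) = live⇒ends-distinct e (proj₁ incₑ) (trans p (trans (sym v≡u) (sym q)))

    πv : π v ≡ u
    πv rewrite ≐-refl v = refl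

    πu : π u ≡ u
    πu rewrite ≐-≢ v≢u = refl

    cut-e : ∀ X → cut (X ∘ π) e ≡ 0
    cut-e X = trans (cong₂ (λ s t → ⟦ X s xor X t ⟧) (proj₁ merged) (proj₂ merged))
                    (cong ⟦_⟧ (Boolₚ.xor-same (X u)))
      where
      merged : π (a e) ≡ u × π (b e) ≡ u
      merged with ends
      ... | inj₁ (p , q) = trans (cong π p) πv , trans (cong π q) πu
      ... | inj₂ (p , q) = trans (cong π p) πu , trans (cong π q) πv

    π-terminal : ∀ {w} → T w ≡ true → π w ≡ w
    π-terminal {w} Tw rewrite ≐-≢ {i = v} {w} (λ { refl → true≢false (trans (sym Tw) nonterminal) }) = refl

    steiner∘π : ∀ {X} → Steiner X → Steiner (X ∘ π)
    steiner∘π {X} ((s , Ts , Xs) , (t , Tt , Xt)) =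
      (s , Ts , trans (cong X (π-terminal Ts)) Xs) , (t , Tt , trans (cong X (π-terminal Tt)) Xt)

    weight∘π : ∀ X → W′.weight X ≡ weight (X ∘ π)
    weight∘π X = Σℕ.sum-cong-≗ pointwise
      where
      pointwise : ∀ h → c′ h ℕ.* C′.cut X h ≡ c h ℕ.* cut (X ∘ π) h
      pointwise h with e Finₚ.≟ h
      ... | no _     = refl
      ... | yes refl rewrite cut-e X = sym (ℕₚ.*-zeroʳ (c e))

    -- Lifts a vector from the reduced instance: both edges of the path get the same entry, just as
    -- `c` has equal weights on them.
    extend : (Fin m → ℤ) → Fin m → ℤ
    extend y h = if e ≐ h then y f else y h

    extend-e : ∀ y → extend y e ≡ y f
    extend-e y rewrite ≐-refl e = refl

    extend-≢ : ∀ y {h} → e ≢ h → extend y h ≡ y h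
    extend-≢ y e≢h rewrite ≐-≢ e≢h = refl

    extend-supported : ∀ {y} → W′.Supported y → Supported (extend y)
    extend-supported sy h lh with e Finₚ.≟ h
    ... | yes refl = contradiction (trans (sym (proj₁ incₑ)) lh) true≢false
    ... | no e≢h   = sy h (trans (cong live (c′-≢ e≢h)) lh)

    module _ {y} (sy : W′.Supported y) (killed : ∀ X → W′.Tight X → C′.value y X ≡ 0ℤ) where

      killed-uncut : ∀ X → Tight X → X v ≡ X u → value (extend y) X ≡ 0ℤ
      killed-uncut X (sX , w) Xv≡Xu = begin
        value (extend y) X       ≡⟨ value-resp (extend y) (X ∘ π) X X∘π ⟨
        value (extend y) (X ∘ π) ≡⟨ Σℤ.sum-cong-≗ pointwise ⟩
        C′.value y X             ≡⟨ killed X (sX , trans (weight∘π X) (trans (weight-resp X∘π) w)) ⟩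
        0ℤ                       ∎
        where
        open ≡-Reasoning
        X∘π : X ∘ π ≗ X
        X∘π w with v Finₚ.≟ w
        ... | yes refl = sym Xv≡Xu
        ... | no _     = refl
        pointwise : ∀ h → + cut (X ∘ π) h ℤ.* extend y h ≡ + C′.cut X h ℤ.* y h
        pointwise h with e Finₚ.≟ h
        ... | no _     = refl
        ... | yes refl rewrite cut-e X = refl

      -- A tight cut that does not separate the ends of `e` comes from the reduced instance. If it
      -- separates them, moving `v` trades `e` for `f`; the two have equal weight and equal entry in
      -- `extend y`, so tightness and value persist and the first case applies.
      killed-all : ∀ X → Tight X → value (extend y) X ≡ 0ℤ
      killed-all X tX@(sX , w) with X v Boolₚ.≟ X u
      ... | yes same = killed-uncut X tX same
      ... | no differ = trans value-flip (killed-uncut (flip v X) tight-flip flip-same)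
        where
        crossed : ∀ {p q} → p ≢ q → ⟦ p xor q ⟧ ≡ 1
        crossed {true}  {true}  p≢q = contradiction refl p≢q
        crossed {true}  {false} _   = refl
        crossed {false} {true}  _   = refl
        crossed {false} {false} p≢q = contradiction refl p≢q
        ce : cut X e ≡ 1
        ce with ends
        ... | inj₁ (p , q) = trans (cong₂ (λ s t → ⟦ X s xor X t ⟧) p q) (crossed differ)
        ... | inj₂ (p , q) = trans (cong₂ (λ s t → ⟦ X s xor X t ⟧) p q) (crossed (differ ∘ sym))
        cf = notBoth d {X} tX ce
        tight-flip : Tight (flip v X)
        tight-flip = flip-steiner sX , trans (ℕₚ.+-cancelʳ-≡ (c e) _ _
          (trans (flip-weight d {X} ce cf) (cong (weight X ℕ.+_) (sym (degreeTwo-≡ d))))) w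
        not-≢ : ∀ {p q} → p ≢ q → not p ≡ q
        not-≢ {true}  {true}  p≢q = contradiction refl p≢q
        not-≢ {true}  {false} _   = refl
        not-≢ {false} {true}  _   = refl
        not-≢ {false} {false} p≢q = contradiction refl p≢q
        flip-same : flip v X v ≡ flip v X u
        flip-same rewrite ≐-refl v | ≐-≢ v≢u = not-≢ differ
        value-flip : value (extend y) X ≡ value (extend y) (flip v X)
        value-flip = sym (ℤ-Group.∙-cancelʳ (y f) _ _ (subst₂
          (λ i j → value (extend y) (flip v X) ℤ.+ i ≡ value (extend y) X ℤ.+ j)
          (extend-e y) (extend-≢ y e≢f) (flip-value d (extend y) {X} (extend-supported sy) ce cf)))

    extremal′ : W′.Extremal
    extremal′ = record
      { positive = positive
      ; valid    = λ X sX → subst (γ ℕ.≤_) (sym (weight∘π X)) (valid (X ∘ π) (steiner∘π sX))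
      ; rigid    = λ y sy killed h →
          restrict sy (rigid (extend y) (extend-supported sy) (killed-all sy killed)) h
      ; coprime  = λ k q div → coprime k q (divides k q div)
      }
      where
      restrict : ∀ {y} → W′.Supported y → (∀ h → extend y h ≡ 0ℤ) → ∀ h → y h ≡ 0ℤ
      restrict {y} sy zeros h with e Finₚ.≟ h
      ... | no e≢h   = trans (sym (extend-≢ y e≢h)) (zeros h)
      ... | yes refl = sy e dead
        where
        dead : live (c′ e) ≡ false
        dead rewrite ≐-refl e = refl
      divides : ∀ k q → (∀ h → q ∣ k ℕ.* c′ h) → ∀ h → q ∣ k ℕ.* c h
      divides k q div h with e Finₚ.≟ h
      ... | no e≢h   = subst (λ i → q ∣ k ℕ.* i) (c′-≢ e≢h) (div h)
      -- The weight erased at `e` still occurs at `f`.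
      ... | yes refl = subst (λ i → q ∣ k ℕ.* i) (trans (c′-≢ e≢f) (sym (degreeTwo-≡ d))) (div f)

    fewerLive : count (live ∘ c′) ℕ.< count (live ∘ c)
    fewerLive = ℕₚ.≤-reflexive (begin
      suc (count (live ∘ c′)) ≡⟨ ℕₚ.+-comm 1 _ ⟩
      count (live ∘ c′) ℕ.+ 1 ≡⟨ cong (count (live ∘ c′) ℕ.+_) (count-point e) ⟨
      count (live ∘ c′) ℕ.+ count (e ≐_) ≡⟨ Σℕ.∑-distrib-+ (⟦_⟧ ∘ live ∘ c′) _ ⟨
      Σℕ.sum (λ h → ⟦ live (c′ h) ⟧ ℕ.+ ⟦ e ≐ h ⟧) ≡⟨ Σℕ.sum-cong-≗ pointwise ⟩
      count (live ∘ c) ∎)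
      where
      open ≡-Reasoning
      pointwise : ∀ h → ⟦ live (c′ h) ⟧ ℕ.+ ⟦ e ≐ h ⟧ ≡ ⟦ live (c h) ⟧
      pointwise h with e Finₚ.≟ h
      ... | yes refl rewrite proj₁ incₑ = refl
      ... | no _     = ℕₚ.+-identityʳ _

-- Bounding the right-hand side

kernelBound-mono : ∀ {B C k l} → B ℕ.≤ C → k ℕ.≤ l → kernelBound B k ℕ.≤ kernelBound C l
kernelBound-mono B≤C z≤n       = z≤n
kernelBound-mono B≤C (s≤s k≤l) = s≤s (ℕₚ.*-mono-≤ (s≤s k≤l) (ℕₚ.*-mono-≤ B≤C
  (kernelBound-mono (ℕₚ.+-mono-≤ (ℕₚ.*-mono-≤ B≤C B≤C) (ℕₚ.*-mono-≤ B≤C B≤C)) k≤l)))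

elements : ∀ {n} → (Fin n → Bool) → List (Fin n)
elements {zero}  p = []
elements {suc n} p = if p zero then zero ∷ rest else rest
  where rest = List.map suc (elements (p ∘ suc))

length-elements : ∀ {n} (p : Fin n → Bool) → length (elements p) ≡ count p
length-elements {zero}  p = refl
length-elements {suc n} p with p zero
... | true  = cong suc (trans (Listₚ.length-map suc (elements (p ∘ suc))) (length-elements (p ∘ suc)))
... | false = trans (Listₚ.length-map suc (elements (p ∘ suc))) (length-elements (p ∘ suc))

all-elements : ∀ {n} (p : Fin n → Bool) {P : Fin n → Set} → All P (elements p) → ∀ v → p v ≡ true → P v
all-elements {suc n} p ps v pv with p zero in eq
all-elements {suc n} p (p₀ ∷ ps) zero pv | true  = p₀
all-elements {suc n} p (p₀ ∷ ps) (suc v) pv | true  = all-elements (p ∘ suc) (Allₚ.map⁻ ps) v pv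
all-elements {suc n} p ps zero pv | false = contradiction (trans (sym pv) eq) true≢false
all-elements {suc n} p ps (suc v) pv | false = all-elements (p ∘ suc) (Allₚ.map⁻ ps) v pv

-- Instances without nonterminals of degree two

module IrreducibleBound {n m : ℕ} (T : Fin n → Bool) (a b : Fin m → Fin n) (c : Fin m → ℕ) (γ : ℕ)
  (extremal : Cuts.Weights.Extremal T a b c γ)
  (irreducible : ∀ v e f → ¬ Reduction.DegreeTwo T a b c γ extremal v e f) where

  open Cuts T a b
  open Weights c γ
  open Extremal extremal
  open Reduction T a b c γ extremal
  open Spanning T a b c γ valid

  S₀ : Fin n → Bool
  S₀ = proj₁ existsTight

  tS₀ : Tight S₀
  tS₀ = proj₂ existsTight

  r : Fin n
  r = proj₁ (proj₁ (proj₁ tS₀))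

  Tr : T r ≡ true
  Tr = proj₁ (proj₂ (proj₁ (proj₁ tS₀)))

  active : Fin n → Bool
  active v = not (T v) ∧ does (Finₚ.any? (incident? v))

  keep : Fin n → Bool
  keep v = T v ∨ active v

  -- Isolated nonterminals are merged into r so that only active nodes count as classes.
  π : Fin n → Fin n
  π v = if keep v then v else r

  π-keep : ∀ {v} → keep v ≡ true → π v ≡ v
  π-keep kv rewrite kv = refl

  π-terminal : ∀ {v} → T v ≡ true → π v ≡ v
  π-terminal {v} Tv = π-keep (cong (_∨ active v) Tv)

  π-incident : ∀ {v e} → Incident v e → π v ≡ v
  π-incident {v} {e} inc = π-keep kept
    where
    kept : keep v ≡ true
    kept with T v
    ... | true  = refl
    ... | false = dec-true (Finₚ.any? (incident? v)) (e , inc)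

  π-idempotent : Idempotent π
  π-idempotent v with keep v in kv
  ... | true  = π-keep kv
  ... | false = π-terminal Tr

  live-ends : ∀ {e} → live (c e) ≡ true → π (a e) ≡ a e × π (b e) ≡ b e
  live-ends {e} le = π-incident {a e} {e} (le , cong (_∨ (b e ≐ a e)) (≐-refl (a e)))
    , π-incident {b e} {e} (le , trans (cong ((a e ≐ b e) ∨_) (≐-refl (b e))) (Boolₚ.∨-zeroʳ _))

  live-split : ∀ (P : Fin m → Set) → (∀ e → c e ≡ 0 → P e) → (∀ e → live (c e) ≡ true → P e) → ∀ e → P e
  live-split P dead alive e with c e in ce
  ... | zero  = dead e ce
  ... | suc k = alive e (cong live ce)

  cut∘π : ∀ X {e} → live (c e) ≡ true → cut (X ∘ π) e ≡ cut X e
  cut∘π X le = cong₂ (λ s t → ⟦ X s xor X t ⟧) (proj₁ (live-ends le)) (proj₂ (live-ends le))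

  tight∘π : ∀ {X} → Tight X → Tight (X ∘ π)
  tight∘π {X} (((s , Ts , Xs) , (t , Tt , Xt)) , w) =
    ((s , Ts , trans (cong X (π-terminal Ts)) Xs) , (t , Tt , trans (cong X (π-terminal Tt)) Xt))
    , trans (Σℕ.sum-cong-≗ (live-split _
        (λ e ce → subst (λ k → k ℕ.* cut (X ∘ π) e ≡ k ℕ.* cut X e) (sym ce) refl)
        (λ e le → cong (c e ℕ.*_) (cut∘π X le)))) w

  value∘π : ∀ {x} → Supported x → ∀ X → value x (X ∘ π) ≡ value x X
  value∘π {x} sx X = Σℤ.sum-cong-≗ (live-split _ dead (λ e le → cong (λ k → + k ℤ.* x e) (cut∘π X le)))
    where
    dead : ∀ e → c e ≡ 0 → + cut (X ∘ π) e ℤ.* x e ≡ + cut X e ℤ.* x e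
    dead e ce rewrite sx e (cong live ce) =
      trans (ℤₚ.*-zeroʳ (+ cut (X ∘ π) e)) (sym (ℤₚ.*-zeroʳ (+ cut X e)))

  M t s : ℕ
  M = count (live ∘ c)
  t = count T
  s = count active

  degree : Fin n → Fin m → ℕ
  degree v e = ⟦ live (c e) ⟧ ℕ.* (⟦ a e ≐ v ⟧ ℕ.+ ⟦ b e ≐ v ⟧)

  1≤degree : ∀ {v e} → Incident v e → 1 ℕ.≤ degree v e
  1≤degree {v} {e} (le , inc) rewrite le with a e ≐ v | b e ≐ v | inc
  ... | true  | _    | _ = s≤s z≤n
  ... | false | true | _ = s≤s z≤n

  degreeTwo : ∀ {v e f} → T v ≡ false → e ≢ f → Incident v e → Incident v f →
    (∀ h → Incident v h → e ≡ h ⊎ f ≡ h) → DegreeTwo v e f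
  degreeTwo Tv e≢f ie if only = record
    { nonterminal = Tv ; e≢f = e≢f ; incₑ = ie ; inc_f = if ; only = only }

  -- A live edge at `v` forces a second one by `anotherEdge`; without a third, `v` would have degree
  -- two, contrary to irreducibility.
  3≤degree : ∀ v → active v ≡ true → 3 ℕ.≤ Σℕ.sum (degree v)
  3≤degree v act with T v in Tv | Finₚ.any? (incident? v)
  ... | false | yes (e , ie) with Flip.anotherEdge Tv e ie
  ...   | f , e≢f , if with Finₚ.any? (λ h → ¬? (e Finₚ.≟ h) ×-dec (¬? (f Finₚ.≟ h) ×-dec incident? v h))
  ...     | yes (h , e≢h , f≢h , ih) =
    distinct-indicators e≢f e≢h f≢h (degree v) (1≤degree {v} {e} ie) (1≤degree {v} {f} if) (1≤degree {v} {h} ih)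
  ...     | no none = contradiction (degreeTwo Tv e≢f ie if only) (irreducible v e f)
    where
    only : ∀ h → Incident v h → e ≡ h ⊎ f ≡ h
    only h ih with e Finₚ.≟ h | f Finₚ.≟ h
    ... | yes p | _     = inj₁ p
    ... | no _  | yes q = inj₂ q
    ... | no p  | no q  = contradiction (h , p , q , ih) none

  3s≤2M : 3 ℕ.* s ℕ.≤ 2 ℕ.* M
  3s≤2M = begin
    3 ℕ.* s ≡⟨ Σℕ.*-distribˡ-sum 3 (⟦_⟧ ∘ active) ⟩
    Σℕ.sum (λ v → 3 ℕ.* ⟦ active v ⟧) ≤⟨ sum-mono-≤ pointwise ⟩
    Σℕ.sum (λ v → Σℕ.sum (degree v)) ≡⟨ Σℕ.∑-comm degree ⟩
    Σℕ.sum (λ e → Σℕ.sum (λ v → degree v e)) ≡⟨ Σℕ.sum-cong-≗ handshake ⟩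
    Σℕ.sum (λ e → 2 ℕ.* ⟦ live (c e) ⟧) ≡⟨ Σℕ.*-distribˡ-sum 2 (⟦_⟧ ∘ live ∘ c) ⟨
    2 ℕ.* M ∎
    where
    open ℕₚ.≤-Reasoning
    pointwise : ∀ v → 3 ℕ.* ⟦ active v ⟧ ℕ.≤ Σℕ.sum (degree v)
    pointwise v = go (active v) refl
      where
      go : ∀ β → active v ≡ β → 3 ℕ.* ⟦ β ⟧ ℕ.≤ Σℕ.sum (degree v)
      go true  act = 3≤degree v act
      go false _   = z≤n
    handshake : ∀ e → Σℕ.sum (λ v → degree v e) ≡ 2 ℕ.* ⟦ live (c e) ⟧
    handshake e = trans (sym (Σℕ.*-distribˡ-sum ⟦ live (c e) ⟧ (λ v → ⟦ a e ≐ v ⟧ ℕ.+ ⟦ b e ≐ v ⟧)))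
      (trans (cong (⟦ live (c e) ⟧ ℕ.*_) (trans (Σℕ.∑-distrib-+ (⟦_⟧ ∘ (a e ≐_)) _)
        (cong₂ ℕ._+_ (count-point (a e)) (count-point (b e))))) (ℕₚ.*-comm ⟦ live (c e) ⟧ 2))

  #classes≤ : #classes π ℕ.≤ t ℕ.+ s
  #classes≤ = ℕₚ.≤-trans (sum-mono-≤ pointwise) (ℕₚ.≤-reflexive (Σℕ.∑-distrib-+ (⟦_⟧ ∘ T) (⟦_⟧ ∘ active)))
    where
    pointwise : ∀ v → ⟦ v ≐ π v ⟧ ℕ.≤ ⟦ T v ⟧ ℕ.+ ⟦ active v ⟧
    pointwise v with T v in Tv
    ... | true  = ℕₚ.≤-trans (⟦⟧≤1 (v ≐ v)) (ℕₚ.m≤m+n 1 _)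
    ... | false with does (Finₚ.any? (incident? v))
    ...   | true  = ⟦⟧≤1 (v ≐ v)
    ...   | false rewrite ≐-≢ {i = v} {r} (λ { refl → true≢false (trans (sym Tr) Tv) }) = z≤n

  family : SpanningFamily π
  family = spanningFamily π π-idempotent (<-wellFounded _)

  -- `S₀` is a placeholder for terminals whose class is not tight: the list stays a list of tight
  -- cuts with exactly one entry per terminal.
  pick : ∀ {X} → Dec (Tight X) → Fin n → Bool
  pick {X} (yes _) = X
  pick     (no _)  = S₀

  tight-pick : ∀ {X} (d : Dec (Tight X)) → Tight (pick d)
  tight-pick (yes tX) = tX
  tight-pick (no _)   = tS₀

  pick-tight : ∀ {X} (d : Dec (Tight X)) → Tight X → pick d ≡ X
  pick-tight (yes _) _  = refl
  pick-tight (no ¬t) tX = contradiction tX ¬t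

  terminalSet : Fin n → Fin n → Bool
  terminalSet v = pick (tight? (class π v))

  basis : List (Fin n → Bool)
  basis = proj₁ family List.++ List.map terminalSet (elements T)

  tight-basis : All Tight basis
  tight-basis = Allₚ.++⁺ (proj₁ (proj₂ family)) 
    (Allₚ.map⁺ (All.universal (λ v → tight-pick (tight? (class π v))) (elements T)))

  length-basis : length basis ℕ.≤ t ℕ.+ s ℕ.+ t
  length-basis rewrite Listₚ.length-++ (proj₁ family) {List.map terminalSet (elements T)}
    | Listₚ.length-map terminalSet (elements T) | length-elements T =
    ℕₚ.+-monoˡ-≤ t (ℕₚ.≤-trans (proj₁ (proj₂ (proj₂ family))) (ℕₚ.≤-trans (ℕₚ.m∸n≤m _ 3) #classes≤))

  -- A class that forms a Steiner cut contains a terminal, which is fixed by `π` and therefore is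
  -- its representative; so testing the classes of terminals covers all tight classes. Replacing `X`
  -- by `X ∘ π` moves only nodes without live edges and makes it compatible.
  basis-determines : ∀ x y → Supported x → All (λ X → value x X ≡ y) basis → ∀ X → Tight X → value x X ≡ y
  basis-determines x y sx xs X tX = trans (sym (value∘π sx X))
    (proj₂ (proj₂ (proj₂ family)) x y sx classes (Allₚ.++⁻ˡ (proj₁ family) xs) (X ∘ π) (tight∘π tX)
      (λ v → cong X (π-idempotent v)))
    where
    classes : ∀ v → π v ≡ v → Tight (class π v) → value x (class π v) ≡ y
    classes v _ tc@(((w , Tw , v≐πw) , _) , _) =
      trans (cong (value x) (sym (pick-tight (tight? (class π v)) tc)))
      (all-elements T (Allₚ.map⁻ (Allₚ.++⁻ʳ (proj₁ family) xs)) v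
        (subst (λ u → T u ≡ true) (trans (sym (π-terminal Tw)) (sym (≐⇒≡ v≐πw))) Tw))

  ∣cut∣≤1 : ∀ X e → ℤ.∣ + cut X e ∣ ℕ.≤ 1
  ∣cut∣≤1 X e = ⟦⟧≤1 (X (a e) xor X (b e))

  cutRow : (Fin n → Bool) → Fin m → ℤ
  cutRow X e = + cut X e

  -- With fewer cuts than live edges there would be a nonzero supported vector of value 0 on the
  -- basis, hence on all tight cuts, against `rigid`.
  M≤length-basis : M ℕ.≤ length basis
  M≤length-basis with smallKernelVector (live ∘ c) 1 (List.map cutRow basis)
                        (Allₚ.map⁺ (All.universal ∣cut∣≤1 basis))
  ... | inj₂ (M≤ , _) = subst (M ℕ.≤_) (Listₚ.length-map cutRow basis) M≤
  ... | inj₁ (x , sx , killed , (e , xe≢0) , _) = contradiction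
    (rigid x sx (basis-determines x 0ℤ sx (Allₚ.map⁻ killed)) e) xe≢0

  M≤6t : M ℕ.≤ 6 ℕ.* t
  M≤6t = ℕₚ.+-cancelˡ-≤ (2 ℕ.* M) M (6 ℕ.* t) (begin
    2 ℕ.* M ℕ.+ M               ≡⟨ arith₁ M ⟩
    3 ℕ.* M                     ≤⟨ ℕₚ.*-monoʳ-≤ 3 (ℕₚ.≤-trans M≤length-basis length-basis) ⟩
    3 ℕ.* (t ℕ.+ s ℕ.+ t)       ≡⟨ arith₂ t s ⟩
    3 ℕ.* s ℕ.+ 6 ℕ.* t         ≤⟨ ℕₚ.+-monoˡ-≤ (6 ℕ.* t) 3s≤2M ⟩
    2 ℕ.* M ℕ.+ 6 ℕ.* t         ∎)
    where
    open ℕₚ.≤-Reasoning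
    arith₁ : ∀ k → 2 ℕ.* k ℕ.+ k ≡ 3 ℕ.* k
    arith₁ = ℕ-Solver.solve-∀
    arith₂ : ∀ p q → 3 ℕ.* (p ℕ.+ q ℕ.+ p) ≡ 3 ℕ.* q ℕ.+ 6 ℕ.* p
    arith₂ = ℕ-Solver.solve-∀

  -- The system value x X = y (X in the basis) in the unknowns y and x.
  mask : Fin (suc m) → Bool
  mask = true V.∷ (live ∘ c)

  equation : (Fin n → Bool) → Fin (suc m) → ℤ
  equation X = ℤ.-1ℤ V.∷ cutRow X

  equation-∙ : ∀ X (z : Fin (suc m) → ℤ) → equation X ∙ z ≡ value (z ∘ suc) X ℤ.- z zero
  equation-∙ X z = arith (z zero) (value (z ∘ suc) X)
    where
    arith : ∀ p q → ℤ.-1ℤ ℤ.* p ℤ.+ q ≡ q ℤ.- p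
    arith = ℤ-Solver.solve-∀

  value-c : ∀ X → value (+_ ∘ c) X ≡ + weight X
  value-c X = ∙-pos (cut X) c

  supported-c : Supported (+_ ∘ c)
  supported-c e le = cong +_ (live⁻ le)

  -- The vector `γ x - y c` is supported and has value `γ y - y γ` on every tight cut.
  proportional : ∀ x y → Supported x → (∀ X → Tight X → value x X ≡ y) → ∀ e → + γ ℤ.* x e ≡ y ℤ.* + c e
  proportional x y sx same e = ℤₚ.i-j≡0⇒i≡j (+ γ ℤ.* x e) (y ℤ.* + c e) (rigid z sz killed e)
    where
    z : Fin m → ℤ
    z e = + γ ℤ.* x e ℤ.- y ℤ.* + c e
    sz : Supported z
    sz e le rewrite sx e le | live⁻ le | ℤₚ.*-zeroʳ (+ γ) | ℤₚ.*-zeroʳ y = refl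
    expand : ∀ {N} (g h k : Fin N → ℤ) i j → g ∙ (λ e → i ℤ.* h e ℤ.- j ℤ.* k e) ≡ i ℤ.* g ∙ h ℤ.- j ℤ.* g ∙ k
    expand {zero}  g h k i j = arith₀ i j
      where
      arith₀ : ∀ i j → 0ℤ ≡ i ℤ.* 0ℤ ℤ.- j ℤ.* 0ℤ
      arith₀ = ℤ-Solver.solve-∀
    expand {suc N} g h k i j = trans
      (cong (λ s → g zero ℤ.* (i ℤ.* h zero ℤ.- j ℤ.* k zero) ℤ.+ s) (expand (g ∘ suc) (h ∘ suc) (k ∘ suc) i j))
      (arith (g zero) (h zero) (k zero) i j ((g ∘ suc) ∙ (h ∘ suc)) ((g ∘ suc) ∙ (k ∘ suc)))
      where
      arith : ∀ g h k i j p q → g ℤ.* (i ℤ.* h ℤ.- j ℤ.* k) ℤ.+ (i ℤ.* p ℤ.- j ℤ.* q) ≡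
        i ℤ.* (g ℤ.* h ℤ.+ p) ℤ.- j ℤ.* (g ℤ.* k ℤ.+ q)
      arith = ℤ-Solver.solve-∀
    killed : ∀ X → Tight X → value z X ≡ 0ℤ
    killed X tX = trans (expand (cutRow X) x (+_ ∘ c) (+ γ) y)
      (trans (cong₂ (λ p q → + γ ℤ.* p ℤ.- y ℤ.* q) (same X tX) (trans (value-c X) (cong +_ (proj₂ tX))))
        (trans (cong (ℤ._- (y ℤ.* + γ)) (ℤₚ.*-comm (+ γ) y)) (ℤₚ.+-inverseʳ (y ℤ.* + γ))))

  γ≢0 : + γ ≢ 0ℤ
  γ≢0 eq = ℕₚ.<⇒≢ positive (sym (ℤₚ.+-injective eq))

  -- By proportionality `γ` divides every `∣ y ∣ * c e`; the weights have no common divisor, so `γ`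
  -- divides `∣ y ∣`.
  γ≤∣y∣ : ∀ x y → Supported x → (∀ X → Tight X → value x X ≡ y) → y ≢ 0ℤ → γ ℕ.≤ ℤ.∣ y ∣
  γ≤∣y∣ x y sx same y≢0 = ∣.∣⇒≤ {{ℕ.≢-nonZero (y≢0 ∘ ℤₚ.∣i∣≡0⇒i≡0)}} (coprime ℤ.∣ y ∣ γ divides)
    where
    divides : ∀ e → γ ∣ ℤ.∣ y ∣ ℕ.* c e
    divides e = ∣.divides ℤ.∣ x e ∣ (begin
      ℤ.∣ y ∣ ℕ.* c e    ≡⟨ ℤₚ.abs-* y (+ c e) ⟨
      ℤ.∣ y ℤ.* + c e ∣  ≡⟨ cong ℤ.∣_∣ (proportional x y sx same e) ⟨
      ℤ.∣ + γ ℤ.* x e ∣  ≡⟨ ℤₚ.abs-* (+ γ) (x e) ⟩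
      γ ℕ.* ℤ.∣ x e ∣    ≡⟨ ℕₚ.*-comm γ ℤ.∣ x e ∣ ⟩
      ℤ.∣ x e ∣ ℕ.* γ    ∎)
      where open ≡-Reasoning

  -- `(γ , c)` itself solves the system and refutes a trivial kernel, so elimination returns a small
  -- nonzero solution. The `suc` accounts for the column of the unknown `y`.
  γ≤kernelBound : γ ℕ.≤ kernelBound 1 (suc (6 ℕ.* t))
  γ≤kernelBound with smallKernelVector mask 1 (List.map equation basis)
                       (Allₚ.map⁺ (All.universal (λ X → λ { zero → s≤s z≤n ; (suc e) → ∣cut∣≤1 X e }) basis))
  ... | inj₂ (_ , trivial) = contradiction (trivial (+ γ V.∷ (+_ ∘ c))
      (λ { (suc e) le → supported-c e le })
      (Allₚ.map⁺ (All.map solves tight-basis)) zero) γ≢0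
    where
    solves : ∀ {X} → Tight X → equation X ∙ (+ γ V.∷ (+_ ∘ c)) ≡ 0ℤ
    solves {X} tX = trans (equation-∙ X (+ γ V.∷ (+_ ∘ c)))
      (trans (cong (ℤ._- + γ) (trans (value-c X) (cong +_ (proj₂ tX)))) (ℤₚ.+-inverseʳ (+ γ)))
  ... | inj₁ (z , sz , killed , (j , zj≢0) , z≤) = ℕₚ.≤-trans (γ≤∣y∣ x y sx same y≢0)
      (ℕₚ.≤-trans (z≤ zero) (kernelBound-mono (ℕₚ.≤-refl {1}) (s≤s M≤6t)))
    where
    x : Fin m → ℤ
    x = z ∘ suc
    y : ℤ
    y = z zero
    sx : Supported x
    sx = sz ∘ suc
    same : ∀ X → Tight X → value x X ≡ y
    same = basis-determines x y sx (All.map (λ {X} zX → ℤₚ.i-j≡0⇒i≡j (value x X) y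
      (trans (sym (equation-∙ X z)) zX)) (Allₚ.map⁻ killed))
    -- If `y` were 0, proportionality would give `γ x = 0`, and the whole solution would vanish.
    y≢0 : y ≢ 0ℤ
    y≢0 y≡0 = zj≢0 (vanish j)
      where
      vanish : ∀ j → z j ≡ 0ℤ
      vanish zero = y≡0
      vanish (suc e) with ℤₚ.i*j≡0⇒i≡0∨j≡0 (+ γ) (trans (proportional x y sx same e) (cong (ℤ._* + c e) y≡0))
      ... | inj₁ γ≡0 = contradiction γ≡0 γ≢0
      ... | inj₂ xe≡0 = xe≡0

-- Splitting off keeps `T` and `γ` and lowers the number of live edges, so the bound for irreducible
-- instances carries over unchanged.
extremal-bound : ∀ {n m} (T : Fin n → Bool) (a b : Fin m → Fin n) c γ →
  Cuts.Weights.Extremal T a b c γ → γ ℕ.≤ kernelBound 1 (suc (6 ℕ.* count T))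
extremal-bound {n} {m} T a b c γ ext = go a b c ext (<-wellFounded _)
  where
  go : ∀ (a b : Fin m → Fin n) c → Cuts.Weights.Extremal T a b c γ → Acc ℕ._<_ (count (live ∘ c)) →
    γ ℕ.≤ kernelBound 1 (suc (6 ℕ.* count T))
  go a b c ext (acc rec) = split (Finₚ.any? λ v → Finₚ.any? λ e → Finₚ.any? λ f → degreeTwo? v e f)
    where
    open Reduction T a b c γ ext
    split : Dec (∃[ v ] ∃[ e ] ∃[ f ] DegreeTwo v e f) → γ ℕ.≤ kernelBound 1 (suc (6 ℕ.* count T))
    split (yes (v , e , f , d)) = go _ _ _ (SplitOff.extremal′ d) (rec (SplitOff.fewerLive d))
    split (no none) = IrreducibleBound.γ≤kernelBound T a b c γ ext λ v e f d → none (v , e , f , d)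

-- The ordered ring of real numbers

private
  open +-*-Solver using (solve; _:=_; _:+_; _:*_; _:-_; :-_)

  neg-involutive : ∀ p → ℚ.- (ℚ.- p) ≡ p
  neg-involutive = solve 1 (λ p → :- (:- p) := p) refl

≤-∣∣ : ∀ p → p ℚ.≤ ℚ.∣ p ∣
≤-∣∣ p with ℚₚ.∣p∣≡p∨∣p∣≡-p p
... | inj₁ eq = ℚₚ.≤-reflexive (≡.sym eq)
... | inj₂ eq = ℚₚ.≤-trans
  (subst (ℚ._≤ 0ℚ) (neg-involutive p) (ℚₚ.neg-antimono-≤ (subst (0ℚ ℚ.≤_) eq (ℚₚ.0≤∣p∣ p))))
  (ℚₚ.0≤∣p∣ p)

∣∣-≤ : ∀ {p q} → p ℚ.≤ q → ℚ.- p ℚ.≤ q → ℚ.∣ p ∣ ℚ.≤ q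
∣∣-≤ {p} p≤q -p≤q with ℚₚ.∣p∣≡p∨∣p∣≡-p p
... | inj₁ eq = subst (ℚ._≤ _) (≡.sym eq) p≤q
... | inj₂ eq = subst (ℚ._≤ _) (≡.sym eq) -p≤q

private

  half : ℚ → ℚ
  half ε = ½ ℚ.* ε

  0<half : ∀ {ε} → 0ℚ ℚ.< ε → 0ℚ ℚ.< half ε
  0<half = ℚₚ.*-monoʳ-<-pos ½

  half+half : ∀ ε → half ε ℚ.+ half ε ≡ ε
  half+half ε = ≡.trans (≡.sym (ℚₚ.*-distribʳ-+ ε ½ ½)) (ℚₚ.*-identityˡ ε)

  left : ∀ N M {n} → N ℕ.⊔ M ℕ.≤ n → N ℕ.≤ n
  left N M = ℕₚ.≤-trans (ℕₚ.m≤m⊔n N M)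

  right : ∀ N M {n} → N ℕ.⊔ M ℕ.≤ n → M ℕ.≤ n
  right N M = ℕₚ.≤-trans (ℕₚ.m≤n⊔m N M)

pointwise⇒≤ : ∀ {x y} → (∀ n → seq x n ℚ.≤ seq y n) → x ≤ y
pointwise⇒≤ {x} {y} x≤y ε 0<ε = 0 , λ n _ → ℚₚ.≤-trans (x≤y n)
  (subst (ℚ._≤ seq y n ℚ.+ ε) (ℚₚ.+-identityʳ (seq y n)) (ℚₚ.+-monoʳ-≤ (seq y n) (ℚₚ.<⇒≤ 0<ε)))

≈⇒≤ : ∀ {x y} → x ≈ y → x ≤ y
≈⇒≤ {x} {y} x≈y ε 0<ε = let N , h = x≈y ε 0<ε in N , λ n Nn → begin
  seq x n                         ≡⟨ split (seq x n) (seq y n) ⟩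
  seq y n ℚ.+ (seq x n ℚ.- seq y n) ≤⟨ ℚₚ.+-monoʳ-≤ (seq y n) (ℚₚ.≤-trans (≤-∣∣ _) (h n Nn)) ⟩
  seq y n ℚ.+ ε                   ∎
  where
  open ℚₚ.≤-Reasoning
  split : ∀ p q → p ≡ q ℚ.+ (p ℚ.- q)
  split = solve 2 (λ p q → p := q :+ (p :- q)) refl

≤-antisym : ∀ {x y} → x ≤ y → y ≤ x → x ≈ y
≤-antisym {x} {y} x≤y y≤x ε 0<ε =
  let N , h = x≤y ε 0<ε
      M , k = y≤x ε 0<ε
  in N ℕ.⊔ M , λ n NMn → ∣∣-≤ (move (seq x n) (seq y n) (h n (left N M NMn)))
    (subst (ℚ._≤ ε) (negate (seq y n) (seq x n)) (move (seq y n) (seq x n) (k n (right N M NMn))))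
  where
  open ℚₚ.≤-Reasoning
  cancel : ∀ q r → (q ℚ.+ r) ℚ.- q ≡ r
  cancel = solve 2 (λ q r → (q :+ r) :- q := r) refl
  move : ∀ p q → p ℚ.≤ q ℚ.+ ε → p ℚ.- q ℚ.≤ ε
  move p q h = subst (p ℚ.- q ℚ.≤_) (cancel q ε) (ℚₚ.+-monoˡ-≤ (ℚ.- q) h)
  negate : ∀ p q → p ℚ.- q ≡ ℚ.- (q ℚ.- p)
  negate = solve 2 (λ p q → p :- q := :- (q :- p)) refl

≤-refl : ∀ {x} → x ≤ x
≤-refl {x} = pointwise⇒≤ {x} {x} (λ _ → ℚₚ.≤-refl)

≤-trans : ∀ {x y z} → x ≤ y → y ≤ z → x ≤ z
≤-trans {x} {y} {z} x≤y y≤z ε 0<ε =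
  let N , h = x≤y (half ε) (0<half 0<ε)
      M , k = y≤z (half ε) (0<half 0<ε)
  in N ℕ.⊔ M , λ n NMn → begin
    seq x n                         ≤⟨ h n (left N M NMn) ⟩
    seq y n ℚ.+ half ε              ≤⟨ ℚₚ.+-monoˡ-≤ (half ε) (k n (right N M NMn)) ⟩
    seq z n ℚ.+ half ε ℚ.+ half ε   ≡⟨ ℚₚ.+-assoc (seq z n) (half ε) (half ε) ⟩
    seq z n ℚ.+ (half ε ℚ.+ half ε) ≡⟨ cong (seq z n ℚ.+_) (half+half ε) ⟩
    seq z n ℚ.+ ε                   ∎
  where open ℚₚ.≤-Reasoning

+-mono-≤ : ∀ {x y u v} → x ≤ y → u ≤ v → x + u ≤ y + v
+-mono-≤ {x} {y} {u} {v} x≤y u≤v ε 0<ε =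
  let N , h = x≤y (half ε) (0<half 0<ε)
      M , k = u≤v (half ε) (0<half 0<ε)
  in N ℕ.⊔ M , λ n NMn → begin
    seq x n ℚ.+ seq u n ≤⟨ ℚₚ.+-mono-≤ (h n (left N M NMn)) (k n (right N M NMn)) ⟩
    (seq y n ℚ.+ half ε) ℚ.+ (seq v n ℚ.+ half ε) ≡⟨ shuffle (seq y n) (seq v n) (half ε) ⟩
    (seq y n ℚ.+ seq v n) ℚ.+ (half ε ℚ.+ half ε) ≡⟨ cong ((seq y n ℚ.+ seq v n) ℚ.+_) (half+half ε) ⟩
    (seq y n ℚ.+ seq v n) ℚ.+ ε ∎
  where
  open ℚₚ.≤-Reasoning
  shuffle : ∀ p q h → (p ℚ.+ h) ℚ.+ (q ℚ.+ h) ≡ (p ℚ.+ q) ℚ.+ (h ℚ.+ h)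
  shuffle = solve 3 (λ p q h → (p :+ h) :+ (q :+ h) := (p :+ q) :+ (h :+ h)) refl

pointwise⇒≈ : ∀ {x y} → (∀ n → seq x n ≡ seq y n) → x ≈ y
pointwise⇒≈ {x} {y} eq = ≤-antisym {x} {y} (pointwise⇒≤ {x} {y} (ℚₚ.≤-reflexive ∘ eq))
  (pointwise⇒≤ {y} {x} (ℚₚ.≤-reflexive ∘ ≡.sym ∘ eq))

≈-sym : ∀ {x y} → x ≈ y → y ≈ x
≈-sym {x} {y} x≈y ε 0<ε = let N , h = x≈y ε 0<ε in N , λ n Nn →
  subst (ℚ._≤ ε) (≡.trans (≡.sym (ℚₚ.∣-p∣≡∣p∣ _)) (cong ℚ.∣_∣ (negate (seq x n) (seq y n)))) (h n Nn)
  where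
  negate : ∀ p q → ℚ.- (p ℚ.- q) ≡ q ℚ.- p
  negate = solve 2 (λ p q → :- (p :- q) := q :- p) refl

≈-trans : ∀ {x y z} → x ≈ y → y ≈ z → x ≈ z
≈-trans {x} {y} {z} x≈y y≈z = ≤-antisym {x} {z}
  (≤-trans {x} {y} {z} (≈⇒≤ {x} {y} x≈y) (≈⇒≤ {y} {z} y≈z))
  (≤-trans {z} {y} {x} (≈⇒≤ {z} {y} (≈-sym {y} {z} y≈z)) (≈⇒≤ {y} {x} (≈-sym {x} {y} x≈y)))

+-cong : ∀ {x y u v} → x ≈ y → u ≈ v → x + u ≈ y + v
+-cong {x} {y} {u} {v} x≈y u≈v = ≤-antisym {x + u} {y + v}
  (+-mono-≤ {x} {y} {u} {v} (≈⇒≤ {x} {y} x≈y) (≈⇒≤ {u} {v} u≈v))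
  (+-mono-≤ {y} {x} {v} {u} (≈⇒≤ {y} {x} (≈-sym {x} {y} x≈y)) (≈⇒≤ {v} {u} (≈-sym {u} {v} u≈v)))

eventuallyBounded : ∀ x → Σ[ B ∈ ℚ ] ℚ.Positive B × Σ[ N ∈ ℕ ] (∀ n → N ℕ.≤ n → ℚ.∣ seq x n ∣ ℚ.≤ B)
eventuallyBounded x with cauchy x 1ℚ (ℚₚ.positive⁻¹ 1ℚ)
... | N , h = 1ℚ ℚ.+ ℚ.∣ seq x N ∣ , ℚₚ.pos+nonNeg⇒pos 1ℚ ℚ.∣ seq x N ∣ {{ℚₚ.∣-∣-nonNeg (seq x N)}}
  , N , λ n Nn → begin
    ℚ.∣ seq x n ∣                             ≡⟨ cong ℚ.∣_∣ (split (seq x n) (seq x N)) ⟩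
    ℚ.∣ (seq x n ℚ.- seq x N) ℚ.+ seq x N ∣   ≤⟨ ℚₚ.∣p+q∣≤∣p∣+∣q∣ (seq x n ℚ.- seq x N) (seq x N) ⟩
    ℚ.∣ seq x n ℚ.- seq x N ∣ ℚ.+ ℚ.∣ seq x N ∣ ≤⟨ ℚₚ.+-monoˡ-≤ ℚ.∣ seq x N ∣ (h n N Nn ℕₚ.≤-refl) ⟩
    1ℚ ℚ.+ ℚ.∣ seq x N ∣                      ∎
  where
  open ℚₚ.≤-Reasoning
  split : ∀ p q → p ≡ (p ℚ.- q) ℚ.+ q
  split = solve 2 (λ p q → p := (p :- q) :+ q) refl

private
  divide : ∀ B → ℚ.Positive B → ∀ ε → 0ℚ ℚ.< ε → Σ[ η ∈ ℚ ] 0ℚ ℚ.< η × B ℚ.* η ≡ ε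
  divide B B>0 ε 0<ε = 1/B ℚ.* ε
    , ℚₚ.positive⁻¹ _ {{ℚₚ.pos*pos⇒pos 1/B {{ℚₚ.1/pos⇒pos B}} ε {{ℚ.positive 0<ε}}}}
    , ≡.trans (≡.sym (ℚₚ.*-assoc B 1/B ε))
        (≡.trans (cong (ℚ._* ε) (ℚₚ.*-inverseʳ B)) (ℚₚ.*-identityˡ ε))
    where
    instance
      _ = B>0
      _ = ℚₚ.pos⇒nonZero B
    1/B = ℚ.1/ B

  *-distance : ∀ p q r {B η ε} → ℚ.Positive B → B ℚ.* η ≡ ε → ℚ.∣ p ∣ ℚ.≤ B → ℚ.∣ q ℚ.- r ∣ ℚ.≤ η →
    ℚ.∣ p ℚ.* q ℚ.- p ℚ.* r ∣ ℚ.≤ ε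
  *-distance p q r {B} {η} {ε} B>0 Bη≡ε p≤B qr≤η = begin
    ℚ.∣ p ℚ.* q ℚ.- p ℚ.* r ∣   ≡⟨ cong ℚ.∣_∣ (factor p q r) ⟩
    ℚ.∣ p ℚ.* (q ℚ.- r) ∣       ≡⟨ ℚₚ.∣p*q∣≡∣p∣*∣q∣ p (q ℚ.- r) ⟩
    ℚ.∣ p ∣ ℚ.* ℚ.∣ q ℚ.- r ∣   ≤⟨ ℚₚ.*-monoʳ-≤-nonNeg ℚ.∣ q ℚ.- r ∣ {{ℚₚ.∣-∣-nonNeg (q ℚ.- r)}} p≤B ⟩
    B ℚ.* ℚ.∣ q ℚ.- r ∣         ≤⟨ ℚₚ.*-monoˡ-≤-nonNeg B {{ℚₚ.pos⇒nonNeg B {{B>0}}}} qr≤η ⟩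
    B ℚ.* η                     ≡⟨ Bη≡ε ⟩
    ε                           ∎
    where
    open ℚₚ.≤-Reasoning
    factor : ∀ p q r → p ℚ.* q ℚ.- p ℚ.* r ≡ p ℚ.* (q ℚ.- r)
    factor = solve 3 (λ p q r → p :* q :- p :* r := p :* (q :- r)) refl

-- `x` is eventually bounded by some `B`, so it suffices that `y` and `z` come within `ε` divided by
-- `B`.
*-congˡ : ∀ x {y z} → y ≈ z → x * y ≈ x * z
*-congˡ x {y} {z} y≈z ε 0<ε =
  let B , B>0 , N , h = eventuallyBounded x
      η , 0<η , Bη≡ε  = divide B B>0 ε 0<ε
      M , k           = y≈z η 0<η
  in N ℕ.⊔ M , λ n NMn →
    *-distance (seq x n) (seq y n) (seq z n) B>0 Bη≡ε (h n (left N M NMn)) (k n (right N M NMn))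

*-comm : ∀ x y → x * y ≈ y * x
*-comm x y = pointwise⇒≈ {x * y} {y * x} (λ n → ℚₚ.*-comm (seq x n) (seq y n))

*-cong : ∀ {x y u v} → x ≈ y → u ≈ v → x * u ≈ y * v
*-cong {x} {y} {u} {v} x≈y u≈v = ≈-trans {x * u} {x * v} {y * v} (*-congˡ x {u} {v} u≈v)
  (≈-trans {x * v} {v * x} {y * v} (*-comm x v)
    (≈-trans {v * x} {v * y} {y * v} (*-congˡ v {x} {y} x≈y) (*-comm v y)))

-- Records keep the two relations from unfolding, and the operations are opaque, so
-- that their arguments can be inferred.
infix 4 _≃_ _≲_

record _≃_ (x y : ℝ) : Set where
  constructor mk≃
  field un≃ : x ≈ y

record _≲_ (x y : ℝ) : Set where
  constructor mk≲
  field un≲ : x ≤ y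

open _≃_ public
open _≲_ public

infixl 6 _⊕_
infixl 7 _⊗_

opaque
  _⊕_ _⊗_ : ℝ → ℝ → ℝ
  _⊕_ = _+_
  _⊗_ = _*_

  ⊖_ : ℝ → ℝ
  ⊖ x = fromℚ (ℚ.- 1ℚ) * x

  𝟘 𝟙 : ℝ
  𝟘 = 0ℝ
  𝟙 = 1ℝ

  ι : ℕ → ℝ
  ι = fromℕ

opaque
  unfolding _⊕_

  ℝ-isCommutativeRing : IsCommutativeRing _≃_ _⊕_ _⊗_ ⊖_ 𝟘 𝟙
  ℝ-isCommutativeRing = record
    { isRing = record
      { +-isAbelianGroup = record
        { isGroup = record
          { isMonoid = record
            { isSemigroup = record
              { isMagma = record
                { isEquivalence = record
                  { refl  = λ {x} → pointwise {x} {x} (λ _ → refl)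
                  ; sym   = λ {x} {y} p → mk≃ (≈-sym {x} {y} (un≃ p))
                  ; trans = λ {x} {y} {z} p q → mk≃ (≈-trans {x} {y} {z} (un≃ p) (un≃ q))
                  }
                ; ∙-cong = λ {x} {y} {u} {v} p q → mk≃ (+-cong {x} {y} {u} {v} (un≃ p) (un≃ q))
                }
              ; assoc = λ x y z → pointwise {x + y + z} {x + (y + z)} λ n →
                  ℚₚ.+-assoc (seq x n) (seq y n) (seq z n)
              }
            ; identity = (λ x → pointwise {0ℝ + x} {x} λ n → ℚₚ.+-identityˡ (seq x n))
                       , (λ x → pointwise {x + 0ℝ} {x} λ n → ℚₚ.+-identityʳ (seq x n))
            }
          ; inverse = (λ x → pointwise {⊖ x + x} {0ℝ} λ n → inverseˡ (seq x n))
                    , (λ x → pointwise {x + ⊖ x} {0ℝ} λ n → inverseʳ (seq x n))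
          ; ⁻¹-cong = λ {x} {y} p → mk≃ (*-congˡ (fromℚ (ℚ.- 1ℚ)) {x} {y} (un≃ p))
          }
        ; comm = λ x y → pointwise {x + y} {y + x} λ n → ℚₚ.+-comm (seq x n) (seq y n)
        }
      ; *-cong = λ {x} {y} {u} {v} p q → mk≃ (*-cong {x} {y} {u} {v} (un≃ p) (un≃ q))
      ; *-assoc = λ x y z → pointwise {x * y * z} {x * (y * z)} λ n →
          ℚₚ.*-assoc (seq x n) (seq y n) (seq z n)
      ; *-identity = (λ x → pointwise {1ℝ * x} {x} λ n → ℚₚ.*-identityˡ (seq x n))
                   , (λ x → pointwise {x * 1ℝ} {x} λ n → ℚₚ.*-identityʳ (seq x n))
      ; distrib = (λ x y z → pointwise {x * (y + z)} {x * y + x * z} λ n →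
                      ℚₚ.*-distribˡ-+ (seq x n) (seq y n) (seq z n))
                , (λ x y z → pointwise {(y + z) * x} {y * x + z * x} λ n →
                      ℚₚ.*-distribʳ-+ (seq x n) (seq y n) (seq z n))
      }
    ; *-comm = λ x y → mk≃ (*-comm x y)
    }
    where
    pointwise : ∀ {x y} → (∀ n → seq x n ≡ seq y n) → x ≃ y
    pointwise {x} {y} eq = mk≃ (pointwise⇒≈ {x} {y} eq)
    inverseˡ : ∀ p → ℚ.- 1ℚ ℚ.* p ℚ.+ p ≡ 0ℚ
    inverseˡ p = ≡.trans
      (cong (ℚ._+ p) (≡.trans (≡.sym (ℚₚ.neg-distribˡ-* 1ℚ p)) (cong ℚ.-_ (ℚₚ.*-identityˡ p))))
      (ℚₚ.+-inverseˡ p)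
    inverseʳ : ∀ p → p ℚ.+ ℚ.- 1ℚ ℚ.* p ≡ 0ℚ
    inverseʳ p = ≡.trans (ℚₚ.+-comm p _) (inverseˡ p)

ℝ-commutativeRing : CommutativeRing 0ℓ 0ℓ
ℝ-commutativeRing = record { isCommutativeRing = ℝ-isCommutativeRing }

module ℝ-Ring = CommutativeRing ℝ-commutativeRing
module ℝ-Ringₚ = Algebra.Properties.Ring ℝ-Ring.ring
module Σℝ = SemiringSum ℝ-Ring.semiring
module ≃-Reasoning = Relation.Binary.Reasoning.Setoid ℝ-Ring.setoid

-- Natural numbers inside the reals

/1-+ : ∀ i j → (i ℤ.+ j) ℚ./ 1 ≡ i ℚ./ 1 ℚ.+ j ℚ./ 1
/1-+ i j = ℚₚ.toℚᵘ-injective (ℚᵘₚ.≃-trans (ℚₚ.toℚᵘ-fromℚᵘ (ℚᵘ.mkℚᵘ (i ℤ.+ j) 0))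
  (ℚᵘₚ.≃-sym (ℚᵘₚ.≃-trans (ℚₚ.toℚᵘ-homo-+ (i ℚ./ 1) (j ℚ./ 1))
    (ℚᵘₚ.≃-trans (ℚᵘₚ.+-cong (ℚₚ.toℚᵘ-fromℚᵘ (ℚᵘ.mkℚᵘ i 0)) (ℚₚ.toℚᵘ-fromℚᵘ (ℚᵘ.mkℚᵘ j 0)))
      (ℚᵘ.*≡* (cong (ℤ._* ℤ.1ℤ) (cong₂ ℤ._+_ (ℤₚ.*-identityʳ i) (ℤₚ.*-identityʳ j))))))))

opaque
  unfolding _⊕_

  ι-0 : ι 0 ≡ 𝟘
  ι-0 = refl

  ι-1 : ι 1 ≡ 𝟙
  ι-1 = refl

  ι-+ : ∀ j k → ι (j ℕ.+ k) ≃ ι j ⊕ ι k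
  ι-+ j k = mk≃ (pointwise⇒≈ {fromℕ (j ℕ.+ k)} {fromℕ j + fromℕ k} λ _ → /1-+ (+ j) (+ k))

  ∑-def : ∀ {k} (v : Vector ℝ k) → ∑ v ≡ Σℝ.sum v
  ∑-def v = refl

  ·-def : ∀ {m} (u v : Vector ℝ m) → u · v ≡ Σℝ.sum (λ e → u e ⊗ v e)
  ·-def u v = refl

  lincomb-def : ∀ {m k} (μ : Vector ℝ k) (p : Vector (Vector ℝ m) k) e →
    lincomb μ p e ≡ Σℝ.sum (λ i → μ i ⊗ p i e)
  lincomb-def μ p e = refl

  +-def : ∀ x y → x + y ≡ x ⊕ y
  +-def x y = refl

  fromℕ-def : ∀ k → fromℕ k ≡ ι k
  fromℕ-def k = refl

  0ℝ-def : 0ℝ ≡ 𝟘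
  0ℝ-def = refl

  1ℝ-def : 1ℝ ≡ 𝟙
  1ℝ-def = refl

  ⊕-mono-≲ : ∀ {x y u v} → x ≲ y → u ≲ v → x ⊕ u ≲ y ⊕ v
  ⊕-mono-≲ {x} {y} {u} {v} p q = mk≲ (+-mono-≤ {x} {y} {u} {v} (un≲ p) (un≲ q))

  -- The factor is at least 1, so whatever index serves for the product serves for `x`. Only natural
  -- factors are ever cancelled; for a real factor one would need a positive distance from 0.
  ⊗ι-cancel : ∀ x k → x ⊗ ι (suc k) ≃ 𝟘 → x ≃ 𝟘
  ⊗ι-cancel x k (mk≃ h) = mk≃ λ ε 0<ε → let N , f = h ε 0<ε in N , λ n Nn → begin
    ℚ.∣ seq x n ℚ.- 0ℚ ∣             ≡⟨ cong ℚ.∣_∣ (minus0 (seq x n)) ⟩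
    ℚ.∣ seq x n ∣                    ≡⟨ ℚₚ.*-identityʳ ℚ.∣ seq x n ∣ ⟨
    ℚ.∣ seq x n ∣ ℚ.* 1ℚ             ≤⟨ ℚₚ.*-monoˡ-≤-nonNeg ℚ.∣ seq x n ∣ {{ℚₚ.∣-∣-nonNeg (seq x n)}} 1≤ ⟩
    ℚ.∣ seq x n ∣ ℚ.* ℚ.∣ K ∣        ≡⟨ ℚₚ.∣p*q∣≡∣p∣*∣q∣ (seq x n) K ⟨
    ℚ.∣ seq x n ℚ.* K ∣              ≡⟨ cong ℚ.∣_∣ (minus0 (seq x n ℚ.* K)) ⟨
    ℚ.∣ seq x n ℚ.* K ℚ.- 0ℚ ∣       ≤⟨ f n Nn ⟩
    ε ∎
    where
    open ℚₚ.≤-Reasoning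
    minus0 : ∀ p → p ℚ.- 0ℚ ≡ p
    minus0 p = ℚₚ.+-identityʳ p
    K : ℚ
    K = + suc k ℚ./ 1
    0≤k : 0ℚ ℚ.≤ + k ℚ./ 1
    0≤k = ℚₚ.nonNegative⁻¹ _ {{ℚₚ.normalize-nonNeg k 1}}
    1≤ : 1ℚ ℚ.≤ ℚ.∣ K ∣
    1≤ = ℚₚ.≤-trans (subst (1ℚ ℚ.≤_) (≡.sym (/1-+ (+ 1) (+ k)))
      (subst (ℚ._≤ 1ℚ ℚ.+ + k ℚ./ 1) (ℚₚ.+-identityʳ 1ℚ) (ℚₚ.+-monoʳ-≤ 1ℚ 0≤k))) (≤-∣∣ K)

≃⇒≲ : ∀ {x y} → x ≃ y → x ≲ y
≃⇒≲ {x} {y} p = mk≲ (≈⇒≤ {x} {y} (un≃ p))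

≲-antisym : ∀ {x y} → x ≲ y → y ≲ x → x ≃ y
≲-antisym {x} {y} p q = mk≃ (≤-antisym {x} {y} (un≲ p) (un≲ q))

≲-trans : ∀ {x y z} → x ≲ y → y ≲ z → x ≲ z
≲-trans {x} {y} {z} p q = mk≲ (≤-trans {x} {y} {z} (un≲ p) (un≲ q))

≲-refl : ∀ {x} → x ≲ x
≲-refl = ≃⇒≲ ℝ-Ring.refl

≲-respˡ-≃ : ∀ {x y z} → x ≃ y → x ≲ z → y ≲ z
≲-respˡ-≃ p q = ≲-trans (≃⇒≲ (ℝ-Ring.sym p)) q

≲-respʳ-≃ : ∀ {x y z} → y ≃ z → x ≲ y → x ≲ z
≲-respʳ-≃ p q = ≲-trans q (≃⇒≲ p)

⊕-nonneg : ∀ {x y} → 𝟘 ≲ x → 𝟘 ≲ y → 𝟘 ≲ x ⊕ y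
⊕-nonneg p q = ≲-respˡ-≃ (ℝ-Ring.+-identityˡ 𝟘) (⊕-mono-≲ p q)

sum-nonneg : ∀ {k} {v : Vector ℝ k} → (∀ i → 𝟘 ≲ v i) → 𝟘 ≲ Σℝ.sum v
sum-nonneg {zero}  p = ≲-refl
sum-nonneg {suc k} p = ⊕-nonneg (p zero) (sum-nonneg (p ∘ suc))

ι⊗-suc : ∀ k x → ι (suc k) ⊗ x ≃ x ⊕ ι k ⊗ x
ι⊗-suc k x = begin
  ι (suc k) ⊗ x        ≈⟨ ℝ-Ring.*-congʳ (ι-+ 1 k) ⟩
  (ι 1 ⊕ ι k) ⊗ x      ≡⟨ cong (λ o → (o ⊕ ι k) ⊗ x) ι-1 ⟩
  (𝟙 ⊕ ι k) ⊗ x        ≈⟨ ℝ-Ring.distribʳ x 𝟙 (ι k) ⟩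
  𝟙 ⊗ x ⊕ ι k ⊗ x      ≈⟨ ℝ-Ring.+-congʳ (ℝ-Ring.*-identityˡ x) ⟩
  x ⊕ ι k ⊗ x          ∎
  where open ≃-Reasoning

ι0⊗ : ∀ x → ι 0 ⊗ x ≃ 𝟘
ι0⊗ x = ℝ-Ring.trans (ℝ-Ring.reflexive (cong (_⊗ x) ι-0)) (ℝ-Ring.zeroˡ x)

ι⊗-nonneg : ∀ k {x} → 𝟘 ≲ x → 𝟘 ≲ ι k ⊗ x
ι⊗-nonneg zero    {x} p = ≃⇒≲ (ℝ-Ring.sym (ι0⊗ x))
ι⊗-nonneg (suc k) {x} p = ≲-respʳ-≃ (ℝ-Ring.sym (ι⊗-suc k x)) (⊕-nonneg p (ι⊗-nonneg k p))

0≲1 : 𝟘 ≲ 𝟙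
0≲1 = ≡.subst₂ _≲_ 0ℝ-def 1ℝ-def (mk≲ (pointwise⇒≤ {0ℝ} {1ℝ} (λ _ → ℚₚ.nonNegative⁻¹ 1ℚ)))

0≲ι : ∀ k → 𝟘 ≲ ι k
0≲ι k = ≲-respʳ-≃ (ℝ-Ring.*-identityʳ (ι k)) (ι⊗-nonneg k 0≲1)

ι-* : ∀ j k → ι (j ℕ.* k) ≃ ι j ⊗ ι k
ι-* zero    k = ℝ-Ring.trans (ℝ-Ring.reflexive ι-0) (ℝ-Ring.sym (ι0⊗ (ι k)))
ι-* (suc j) k = begin
  ι (k ℕ.+ j ℕ.* k)    ≈⟨ ι-+ k (j ℕ.* k) ⟩
  ι k ⊕ ι (j ℕ.* k)    ≈⟨ ℝ-Ring.+-congˡ (ι-* j k) ⟩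
  ι k ⊕ ι j ⊗ ι k      ≈⟨ ι⊗-suc j (ι k) ⟨
  ι (suc j) ⊗ ι k      ∎
  where open ≃-Reasoning

ι-sum : ∀ {k} (f : Fin k → ℕ) → Σℝ.sum (ι ∘ f) ≃ ι (SemiringSum.sum ℕₚ.+-*-semiring f)
ι-sum {zero}  f = ℝ-Ring.reflexive (≡.sym ι-0)
ι-sum {suc k} f = ℝ-Ring.trans (ℝ-Ring.+-congˡ (ι-sum (f ∘ suc))) (ℝ-Ring.sym (ι-+ (f zero) _))

⊗ι-cancel-< : ∀ x {j k} → j ℕ.< k → x ⊗ ι j ≃ x ⊗ ι k → x ≃ 𝟘
⊗ι-cancel-< x {j} {k} j<k eq = go (k ℕ.∸ j) (ℕₚ.m<n⇒0<n∸m j<k) (ℕₚ.m+[n∸m]≡n (ℕₚ.<⇒≤ j<k))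
  where
  go : ∀ d → 0 ℕ.< d → j ℕ.+ d ≡ k → x ≃ 𝟘
  go (suc d) _ refl = ⊗ι-cancel x d (ℝ-Ring.sym (ℝ-Ringₚ.+-cancelˡ (x ⊗ ι j) 𝟘 (x ⊗ ι (suc d)) (begin
    x ⊗ ι j ⊕ 𝟘              ≈⟨ ℝ-Ring.+-identityʳ _ ⟩
    x ⊗ ι j                  ≈⟨ eq ⟩
    x ⊗ ι (j ℕ.+ suc d)      ≈⟨ ℝ-Ring.*-congˡ (ι-+ j (suc d)) ⟩
    x ⊗ (ι j ⊕ ι (suc d))    ≈⟨ ℝ-Ring.distribˡ x (ι j) (ι (suc d)) ⟩
    x ⊗ ι j ⊕ x ⊗ ι (suc d)  ∎)))
    where open ≃-Reasoning

⊗ι-cancel-≢ : ∀ x {j k} → j ≢ k → x ⊗ ι j ≃ x ⊗ ι k → x ≃ 𝟘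
⊗ι-cancel-≢ x {j} {k} j≢k eq with ℕₚ.<-cmp j k
... | tri≈ _ j≡k _ = contradiction j≡k j≢k
... | tri< j<k _ _ = ⊗ι-cancel-< x j<k eq
... | tri> _ _ k<j = ⊗ι-cancel-< x k<j (ℝ-Ring.sym eq)

-- Facets of polyhedra

eval : ∀ {m} → (Fin m → ℕ) → Vector ℝ m → ℝ
eval a x = Σℝ.sum (λ e → ι (a e) ⊗ x e)

eval-def : ∀ {m} (a : Fin m → ℕ) x → (fromℕ ∘ a) · x ≡ eval a x
eval-def a x = trans (·-def (fromℕ ∘ a) x) (Σℝ.sum-cong-≗ (λ e → cong (_⊗ x e) (fromℕ-def (a e))))

eval-cong : ∀ {m} (a : Fin m → ℕ) {x y} → (∀ e → x e ≃ y e) → eval a x ≃ eval a y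
eval-cong a x≃y = Σℝ.sum-cong-≋ (λ e → ℝ-Ring.*-congˡ (x≃y e))

eval-⊕ : ∀ {m} (a : Fin m → ℕ) x y → eval a (λ e → x e ⊕ y e) ≃ eval a x ⊕ eval a y
eval-⊕ a x y = ℝ-Ring.trans (Σℝ.sum-cong-≋ (λ e → ℝ-Ring.distribˡ (ι (a e)) (x e) (y e)))
  (Σℝ.∑-distrib-+ (λ e → ι (a e) ⊗ x e) (λ e → ι (a e) ⊗ y e))

eval-+ : ∀ {m} (a b : Fin m → ℕ) x → eval (λ e → a e ℕ.+ b e) x ≃ eval a x ⊕ eval b x
eval-+ a b x = ℝ-Ring.trans (Σℝ.sum-cong-≋ λ e → ℝ-Ring.trans (ℝ-Ring.*-congʳ (ι-+ (a e) (b e)))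
                              (ℝ-Ring.distribʳ (x e) (ι (a e)) (ι (b e))))
  (Σℝ.∑-distrib-+ (λ e → ι (a e) ⊗ x e) (λ e → ι (b e) ⊗ x e))

eval-* : ∀ {m} k (a : Fin m → ℕ) x → eval (λ e → k ℕ.* a e) x ≃ ι k ⊗ eval a x
eval-* k a x = ℝ-Ring.trans (Σℝ.sum-cong-≋ λ e → ℝ-Ring.trans (ℝ-Ring.*-congʳ (ι-* k (a e)))
                              (ℝ-Ring.*-assoc (ι k) (ι (a e)) (x e)))
  (ℝ-Ring.sym (Σℝ.*-distribˡ-sum (ι k) (λ e → ι (a e) ⊗ x e)))

eval-ι : ∀ {m} (a f : Fin m → ℕ) → eval a (ι ∘ f) ≃ ι (Σℕ.sum (λ e → a e ℕ.* f e))
eval-ι a f = ℝ-Ring.trans (Σℝ.sum-cong-≋ (λ e → ℝ-Ring.sym (ι-* (a e) (f e)))) (ι-sum (λ e → a e ℕ.* f e))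

eval-lincomb : ∀ {m k} (a : Fin m → ℕ) (μ : Vector ℝ k) (p : Vector (Vector ℝ m) k) →
  eval a (λ e → Σℝ.sum (λ i → μ i ⊗ p i e)) ≃ Σℝ.sum (λ i → μ i ⊗ eval a (p i))
eval-lincomb a μ p = begin
  Σℝ.sum (λ e → ι (a e) ⊗ Σℝ.sum (λ i → μ i ⊗ p i e))
    ≈⟨ Σℝ.sum-cong-≋ (λ e → Σℝ.*-distribˡ-sum (ι (a e)) (λ i → μ i ⊗ p i e)) ⟩
  Σℝ.sum (λ e → Σℝ.sum (λ i → ι (a e) ⊗ (μ i ⊗ p i e)))
    ≈⟨ Σℝ.∑-comm (λ e i → ι (a e) ⊗ (μ i ⊗ p i e)) ⟩
  Σℝ.sum (λ i → Σℝ.sum (λ e → ι (a e) ⊗ (μ i ⊗ p i e)))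
    ≈⟨ Σℝ.sum-cong-≋ (λ i → Σℝ.sum-cong-≋ (λ e → exchange (ι (a e)) (μ i) (p i e))) ⟩
  Σℝ.sum (λ i → Σℝ.sum (λ e → μ i ⊗ (ι (a e) ⊗ p i e)))
    ≈⟨ Σℝ.sum-cong-≋ (λ i → ℝ-Ring.sym (Σℝ.*-distribˡ-sum (μ i) (λ e → ι (a e) ⊗ p i e))) ⟩
  Σℝ.sum (λ i → μ i ⊗ eval a (p i)) ∎
  where
  open ≃-Reasoning
  exchange : ∀ x y z → x ⊗ (y ⊗ z) ≃ y ⊗ (x ⊗ z)
  exchange x y z = ℝ-Ring.trans (ℝ-Ring.sym (ℝ-Ring.*-assoc x y z))
    (ℝ-Ring.trans (ℝ-Ring.*-congʳ (ℝ-Ring.*-comm x y)) (ℝ-Ring.*-assoc y x z))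

⊕-cancelʳ-≲ : ∀ {x y} z → x ⊕ z ≲ y ⊕ z → x ≲ y
⊕-cancelʳ-≲ {x} {y} z p = ≲-respˡ-≃ (undo x) (≲-respʳ-≃ (undo y) (⊕-mono-≲ p (≲-refl {⊖ z})))
  where
  undo : ∀ w → w ⊕ z ⊕ (⊖ z) ≃ w
  undo w = ℝ-Ring.trans (ℝ-Ring.+-assoc w z (⊖ z))
    (ℝ-Ring.trans (ℝ-Ring.+-congˡ (ℝ-Ring.-‿inverseʳ z)) (ℝ-Ring.+-identityʳ w))

-- Cramer's rule without subtraction: the first equation times `d` and the second times `b` share
-- their `y` term, which cancels.
eliminateʳ : ∀ x y {a b c d} → x ⊗ ι a ⊕ y ⊗ ι b ≃ 𝟘 → x ⊗ ι c ⊕ y ⊗ ι d ≃ 𝟘 →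
  x ⊗ ι (a ℕ.* d) ≃ x ⊗ ι (c ℕ.* b)
eliminateʳ x y {a} {b} {c} {d} p q = ℝ-Ringₚ.+-cancelʳ (y ⊗ ι (b ℕ.* d)) _ _ (begin
  x ⊗ ι (a ℕ.* d) ⊕ y ⊗ ι (b ℕ.* d) ≈⟨ scale a b d p ⟩
  𝟘                                 ≈⟨ scale c d b q ⟨
  x ⊗ ι (c ℕ.* b) ⊕ y ⊗ ι (d ℕ.* b) ≡⟨ cong (λ k → x ⊗ ι (c ℕ.* b) ⊕ y ⊗ ι k) (ℕₚ.*-comm d b) ⟩
  x ⊗ ι (c ℕ.* b) ⊕ y ⊗ ι (b ℕ.* d) ∎)
  where
  open ≃-Reasoning
  pull : ∀ x j k → x ⊗ ι (j ℕ.* k) ≃ x ⊗ ι j ⊗ ι k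
  pull x j k = ℝ-Ring.trans (ℝ-Ring.*-congˡ (ι-* j k)) (ℝ-Ring.sym (ℝ-Ring.*-assoc x (ι j) (ι k)))
  scale : ∀ i j k → x ⊗ ι i ⊕ y ⊗ ι j ≃ 𝟘 → x ⊗ ι (i ℕ.* k) ⊕ y ⊗ ι (j ℕ.* k) ≃ 𝟘
  scale i j k r = begin
    x ⊗ ι (i ℕ.* k) ⊕ y ⊗ ι (j ℕ.* k)  ≈⟨ ℝ-Ring.+-cong (pull x i k) (pull y j k) ⟩
    x ⊗ ι i ⊗ ι k ⊕ y ⊗ ι j ⊗ ι k      ≈⟨ ℝ-Ring.distribʳ (ι k) (x ⊗ ι i) (y ⊗ ι j) ⟨
    (x ⊗ ι i ⊕ y ⊗ ι j) ⊗ ι k          ≈⟨ ℝ-Ring.*-congʳ r ⟩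
    𝟘 ⊗ ι k                            ≈⟨ ℝ-Ring.zeroˡ (ι k) ⟩
    𝟘                                  ∎

-- If c were not extreme, two points s + e_i and s + e_j of P could be added to an
-- affinely independent family spanning the face, exceeding the dimension of P.
module _ {m} (P : Pred (Vector ℝ m) 0ℓ) (c : Fin m → ℕ) (γ : ℝ) (facet : FacetDefining P (fromℕ ∘ c) γ)
  (s : Fin m → ℕ) (up : ∀ i → P (λ e → fromℕ (s e ℕ.+ ⟦ i ≐ e ⟧)))
  (μ : ℕ) (γ≃μ : γ ≃ ι μ) (cs≡μ : Σℕ.sum (λ e → c e ℕ.* s e) ≡ μ) where

  eval-up : ∀ (f : Fin m → ℕ) i → eval f (λ e → fromℕ (s e ℕ.+ ⟦ i ≐ e ⟧)) ≃
    ι (Σℕ.sum (λ e → f e ℕ.* s e)) ⊕ ι (f i)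
  eval-up f i = begin
    eval f (λ e → fromℕ (s e ℕ.+ ⟦ i ≐ e ⟧))
      ≈⟨ eval-cong f (λ e → ℝ-Ring.reflexive (fromℕ-def (s e ℕ.+ ⟦ i ≐ e ⟧))) ⟩
    eval f (λ e → ι (s e ℕ.+ ⟦ i ≐ e ⟧)) ≈⟨ eval-ι f (λ e → s e ℕ.+ ⟦ i ≐ e ⟧) ⟩
    ι (Σℕ.sum (λ e → f e ℕ.* (s e ℕ.+ ⟦ i ≐ e ⟧))) ≡⟨ cong ι expand ⟩
    ι (Σℕ.sum (λ e → f e ℕ.* s e) ℕ.+ f i) ≈⟨ ι-+ _ (f i) ⟩
    ι (Σℕ.sum (λ e → f e ℕ.* s e)) ⊕ ι (f i) ∎
    where
    open ≃-Reasoning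
    expand : Σℕ.sum (λ e → f e ℕ.* (s e ℕ.+ ⟦ i ≐ e ⟧)) ≡ Σℕ.sum (λ e → f e ℕ.* s e) ℕ.+ f i
    expand = trans (Σℕ.sum-cong-≗ λ e → trans (ℕₚ.*-distribˡ-+ (f e) (s e) ⟦ i ≐ e ⟧)
        (cong (f e ℕ.* s e ℕ.+_) (ℕₚ.*-comm (f e) ⟦ i ≐ e ⟧)))
      (trans (Σℕ.∑-distrib-+ (λ e → f e ℕ.* s e) (λ e → ⟦ i ≐ e ⟧ ℕ.* f e))
        (cong (Σℕ.sum (λ e → f e ℕ.* s e) ℕ.+_) (sum-point i f)))

  face-eval-c : ∀ {p} → Face P (fromℕ ∘ c) γ p → eval c p ≃ ι μ
  face-eval-c {p} (_ , cp≈γ) = ℝ-Ring.trans (ℝ-Ring.reflexive (sym (eval-def c p)))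
    (ℝ-Ring.trans (mk≃ cp≈γ) γ≃μ)

  module _ (u w : Fin m → ℕ) (k b b′ : ℕ)
    (u-valid : ∀ x → P x → ι b ≲ eval u x) (w-valid : ∀ x → P x → ι b′ ≲ eval w x)
    (b≤us : b ℕ.≤ Σℕ.sum (λ e → u e ℕ.* s e)) (b′≤ws : b′ ℕ.≤ Σℕ.sum (λ e → w e ℕ.* s e))
    (u+w : ∀ e → u e ℕ.+ w e ≡ k ℕ.* c e) (b+b′ : b ℕ.+ b′ ≡ k ℕ.* μ) where

    -- The inequalities given by `u` and `w` add up to `k` times the facet inequality, which is
    -- tight at `s`; so both are tight there.
    us≡b : Σℕ.sum (λ e → u e ℕ.* s e) ≡ b
    us≡b = ℕₚ.≤-antisym (ℕₚ.+-cancelʳ-≤ b′ _ b (begin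
      Σℕ.sum (λ e → u e ℕ.* s e) ℕ.+ b′ ≤⟨ ℕₚ.+-monoʳ-≤ _ b′≤ws ⟩
      Σℕ.sum (λ e → u e ℕ.* s e) ℕ.+ Σℕ.sum (λ e → w e ℕ.* s e)
        ≡⟨ Σℕ.∑-distrib-+ (λ e → u e ℕ.* s e) _ ⟨
      Σℕ.sum (λ e → u e ℕ.* s e ℕ.+ w e ℕ.* s e)
        ≡⟨ Σℕ.sum-cong-≗ (λ e → trans (sym (ℕₚ.*-distribʳ-+ (s e) (u e) (w e)))
             (trans (cong (ℕ._* s e) (u+w e)) (ℕₚ.*-assoc k (c e) (s e)))) ⟩
      Σℕ.sum (λ e → k ℕ.* (c e ℕ.* s e)) ≡⟨ Σℕ.*-distribˡ-sum k (λ e → c e ℕ.* s e) ⟨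
      k ℕ.* Σℕ.sum (λ e → c e ℕ.* s e) ≡⟨ cong (k ℕ.*_) cs≡μ ⟩
      k ℕ.* μ ≡⟨ b+b′ ⟨
      b ℕ.+ b′ ∎)) b≤us
      where open ℕₚ.≤-Reasoning

    -- The same squeeze at the real points of the face: excess in `u` would have to be compensated
    -- by a deficit in `w`.
    face-eval-u : ∀ {p} → Face P (fromℕ ∘ c) γ p → eval u p ≃ ι b
    face-eval-u {p} face@(Pp , _) = ≲-antisym (⊕-cancelʳ-≲ (ι b′)
      (≲-trans (⊕-mono-≲ (≲-refl {eval u p}) (w-valid p Pp)) (≃⇒≲ total))) (u-valid p Pp)
      where
      open ≃-Reasoning
      total : eval u p ⊕ eval w p ≃ ι b ⊕ ι b′
      total = begin
        eval u p ⊕ eval w p              ≈⟨ eval-+ u w p ⟨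
        eval (λ e → u e ℕ.+ w e) p       ≡⟨ Σℝ.sum-cong-≗ (λ e → cong (λ i → ι i ⊗ p e) (u+w e)) ⟩
        eval (λ e → k ℕ.* c e) p         ≈⟨ eval-* k c p ⟩
        ι k ⊗ eval c p                   ≈⟨ ℝ-Ring.*-congˡ (face-eval-c face) ⟩
        ι k ⊗ ι μ                        ≈⟨ ι-* k μ ⟨
        ι (k ℕ.* μ)                      ≡⟨ cong ι b+b′ ⟨
        ι (b ℕ.+ b′)                     ≈⟨ ι-+ b b′ ⟩
        ι b ⊕ ι b′                       ∎

    -- `u - b` and `c - μ` vanish on the face and at `s`. If they are not proportional at `i` and
    -- `j`, their 2 by 2 matrix on the two unit increments is invertible, so in an affine relation
    -- among `q` both new coefficients vanish, and independence of the face points settles the rest.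
    -- The dimension of `P` only refutes independence, hence the appeal to decidable equality of
    -- naturals.
    facet-extreme : ∀ i j → u i ℕ.* c j ≡ u j ℕ.* c i
    facet-extreme i j =
      decidable-stable (_ ℕₚ.≟ _) λ differ → noIndependent q q∈P (λ ν Σν lin → conclude differ ν Σν lin)
      where
      open ≃-Reasoning
      d = proj₁ (proj₂ facet)
      noIndependent = proj₂ (proj₁ (proj₂ (proj₂ facet)))
      faceBasis = proj₁ (proj₂ (proj₂ (proj₂ facet)))
      p = proj₁ faceBasis
      face = proj₁ (proj₂ faceBasis)
      independent = proj₂ (proj₂ faceBasis)
      q : Vector (Vector ℝ m) (suc (suc (suc d)))
      q = (λ e → fromℕ (s e ℕ.+ ⟦ i ≐ e ⟧)) V.∷ (λ e → fromℕ (s e ℕ.+ ⟦ j ≐ e ⟧)) V.∷ p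
      q∈P : ∀ k → P (q k)
      q∈P zero          = up i
      q∈P (suc zero)    = up j
      q∈P (suc (suc k)) = proj₁ (face k)
      excess : (Fin m → ℕ) → Fin (suc (suc (suc d))) → ℕ
      excess f = f i V.∷ f j V.∷ λ _ → 0
      -- Apply `f` to the affine relation: all points contribute the common value `t`, whose
      -- coefficients sum to 0, and only the increments `f i` and `f j` at the two added points
      -- remain.
      combination : ∀ f t → (∀ k → eval f (p k) ≃ ι t) → Σℕ.sum (λ e → f e ℕ.* s e) ≡ t →
        ∀ ν → ∑ ν ≈ 0ℝ → (∀ e → lincomb ν q e ≈ 0ℝ) →
        ν zero ⊗ ι (f i) ⊕ ν (suc zero) ⊗ ι (f j) ≃ 𝟘
      combination f t face-t fs≡t ν Σν lin = begin
        ν zero ⊗ ι (f i) ⊕ ν (suc zero) ⊗ ι (f j)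
          ≈⟨ ℝ-Ring.+-congˡ (ℝ-Ring.+-identityʳ _) ⟨
        ν zero ⊗ ι (f i) ⊕ (ν (suc zero) ⊗ ι (f j) ⊕ 𝟘)
          ≈⟨ ℝ-Ring.+-congˡ (ℝ-Ring.+-congˡ (ℝ-Ring.sym rest)) ⟩
        Σℝ.sum (λ k → ν k ⊗ ι (excess f k)) ≈⟨ ℝ-Ring.+-identityˡ _ ⟨
        𝟘 ⊕ Σℝ.sum (λ k → ν k ⊗ ι (excess f k)) ≈⟨ ℝ-Ring.+-congʳ base ⟨
        Σℝ.sum (λ k → ν k ⊗ ι t) ⊕ Σℝ.sum (λ k → ν k ⊗ ι (excess f k))
          ≈⟨ Σℝ.∑-distrib-+ (λ k → ν k ⊗ ι t) (λ k → ν k ⊗ ι (excess f k)) ⟨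
        Σℝ.sum (λ k → ν k ⊗ ι t ⊕ ν k ⊗ ι (excess f k))
          ≈⟨ Σℝ.sum-cong-≋ (λ k → ℝ-Ring.trans (ℝ-Ring.sym (ℝ-Ring.distribˡ (ν k) (ι t) _))
               (ℝ-Ring.*-congˡ (ℝ-Ring.sym (eval-q k)))) ⟩
        Σℝ.sum (λ k → ν k ⊗ eval f (q k)) ≈⟨ eval-lincomb f ν q ⟨
        eval f (λ e → Σℝ.sum (λ k → ν k ⊗ q k e))
          ≈⟨ eval-cong f (λ e → ℝ-Ring.trans (ℝ-Ring.reflexive (sym (lincomb-def ν q e)))
               (ℝ-Ring.trans (mk≃ (lin e)) (ℝ-Ring.reflexive (trans 0ℝ-def (sym ι-0))))) ⟩
        eval f (λ _ → ι 0) ≈⟨ eval-ι f (λ _ → 0) ⟩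
        ι (Σℕ.sum (λ e → f e ℕ.* 0)) 
          ≡⟨ cong ι (trans (Σℕ.sum-cong-≗ (ℕₚ.*-zeroʳ ∘ f)) (Σℕ.sum-replicate-zero m)) ⟩
        ι 0 ≡⟨ ι-0 ⟩
        𝟘 ∎
        where
        rest : Σℝ.sum (λ k → ν (suc (suc k)) ⊗ ι 0) ≃ 𝟘
        rest = ℝ-Ring.trans (Σℝ.sum-cong-≋ (λ k → ℝ-Ring.trans (ℝ-Ring.*-congˡ (ℝ-Ring.reflexive ι-0))
          (ℝ-Ring.zeroʳ (ν (suc (suc k)))))) (Σℝ.sum-replicate-zero (suc d))
        base : Σℝ.sum (λ k → ν k ⊗ ι t) ≃ 𝟘
        base = ℝ-Ring.trans (ℝ-Ring.sym (Σℝ.*-distribʳ-sum (ι t) ν))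
          (ℝ-Ring.trans (ℝ-Ring.*-congʳ (ℝ-Ring.trans (ℝ-Ring.reflexive (sym (∑-def ν)))
            (ℝ-Ring.trans (mk≃ Σν) (ℝ-Ring.reflexive 0ℝ-def)))) (ℝ-Ring.zeroˡ (ι t)))
        eval-q : ∀ k → eval f (q k) ≃ ι t ⊕ ι (excess f k)
        eval-q zero          = ℝ-Ring.trans (eval-up f i) (ℝ-Ring.reflexive (cong (λ l → ι l ⊕ ι (f i)) fs≡t))
        eval-q (suc zero)    = ℝ-Ring.trans (eval-up f j) (ℝ-Ring.reflexive (cong (λ l → ι l ⊕ ι (f j)) fs≡t))
        eval-q (suc (suc k)) = ℝ-Ring.trans (face-t k)
          (ℝ-Ring.trans (ℝ-Ring.sym (ℝ-Ring.+-identityʳ (ι t))) (ℝ-Ring.+-congˡ (ℝ-Ring.reflexive (sym ι-0))))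
      conclude : u i ℕ.* c j ≢ u j ℕ.* c i → ∀ ν → ∑ ν ≈ 0ℝ → (∀ e → lincomb ν q e ≈ 0ℝ) → ∀ k → ν k ≈ 0ℝ
      conclude differ ν Σν lin = vanish
        where
        from𝟘 : ∀ {x} → x ≃ 𝟘 → x ≈ 0ℝ
        from𝟘 {x} x≃𝟘 = un≃ (ℝ-Ring.trans x≃𝟘 (ℝ-Ring.reflexive (sym 0ℝ-def)))
        U = combination u b (face-eval-u ∘ face) us≡b ν Σν lin
        C = combination c μ (face-eval-c ∘ face) cs≡μ ν Σν lin
        ν₀ : ν zero ≃ 𝟘
        ν₀ = ⊗ι-cancel-≢ (ν zero) (λ eq → differ (trans eq (ℕₚ.*-comm (c i) (u j))))
          (eliminateʳ (ν zero) (ν (suc zero)) U C)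
        ν₁ : ν (suc zero) ≃ 𝟘
        ν₁ = ⊗ι-cancel-≢ (ν (suc zero)) (λ eq → differ (trans (ℕₚ.*-comm (u i) (c j)) (sym eq)))
          (eliminateʳ (ν (suc zero)) (ν zero)
            (ℝ-Ring.trans (ℝ-Ring.+-comm _ _) U) (ℝ-Ring.trans (ℝ-Ring.+-comm _ _) C))
        drop : ∀ {x y z z′} → x ≃ 𝟘 → y ≃ 𝟘 → z′ ≡ z → x ⊕ (y ⊕ z) ≃ 𝟘 → z′ ≃ 𝟘
        drop {x} {y} {z} x≃0 y≃0 refl eq = begin
          z           ≈⟨ ℝ-Ring.+-identityˡ z ⟨
          𝟘 ⊕ z       ≈⟨ ℝ-Ring.+-congʳ y≃0 ⟨
          y ⊕ z       ≈⟨ ℝ-Ring.+-identityˡ (y ⊕ z) ⟨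
          𝟘 ⊕ (y ⊕ z) ≈⟨ ℝ-Ring.+-congʳ x≃0 ⟨
          x ⊕ (y ⊕ z) ≈⟨ eq ⟩
          𝟘           ∎
        absorb : ∀ {x} y → x ≃ 𝟘 → x ⊗ y ≃ 𝟘
        absorb y x≃0 = ℝ-Ring.trans (ℝ-Ring.*-congʳ x≃0) (ℝ-Ring.zeroˡ y)
        ν′ : Vector ℝ (suc d)
        ν′ k = ν (suc (suc k))
        Σν′ : ∑ ν′ ≈ 0ℝ
        Σν′ = from𝟘 (drop ν₀ ν₁ (∑-def ν′)
          (ℝ-Ring.trans (ℝ-Ring.reflexive (sym (∑-def ν))) (ℝ-Ring.trans (mk≃ Σν) (ℝ-Ring.reflexive 0ℝ-def))))
        lin′ : ∀ e → lincomb ν′ p e ≈ 0ℝ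
        lin′ e = from𝟘 (drop (absorb (q zero e) ν₀) (absorb (q (suc zero) e) ν₁) (lincomb-def ν′ p e)
          (ℝ-Ring.trans (ℝ-Ring.reflexive (sym (lincomb-def ν q e)))
            (ℝ-Ring.trans (mk≃ (lin e)) (ℝ-Ring.reflexive 0ℝ-def))))
        vanish : ∀ k → ν k ≈ 0ℝ
        vanish zero          = from𝟘 ν₀
        vanish (suc zero)    = from𝟘 ν₁
        vanish (suc (suc k)) = independent ν′ Σν′ lin′ k

-- The Steiner cut dominant

foldr-gcd-greatest : ∀ {m} k d (c : Vector ℕ m) → (∀ e → d ∣ k ℕ.* c e) → d ∣ k ℕ.* V.foldr gcd 0 c
foldr-gcd-greatest {zero}  k d c div rewrite ℕₚ.*-zeroʳ k = d ∣.∣0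
foldr-gcd-greatest {suc m} k d c div = subst (d ∣_) (sym (c*gcd[m,n]≡gcd[cm,cn] k (c zero) _))
  (gcd-greatest (div zero) (foldr-gcd-greatest k d (c ∘ suc) (div ∘ suc)))

count-lookup : ∀ {n} (T : Subset n) → count (lookup T) ≡ ∣ T ∣
count-lookup []            = refl
count-lookup (true ∷ T)  = cong suc (count-lookup T)
count-lookup (false ∷ T) = count-lookup T

x∈p─q⇒x∉q : ∀ {n x} (p q : Subset n) → x ∈ p ─ q → x ∉ q
x∈p─q⇒x∉q {x = x} p q x∈p─q x∈q = contradiction
  (trans (sym ([]=⇒lookup x∈p─q)) (go p q x ([]=⇒lookup x∈q))) λ ()
  where
  go : ∀ {n} (p q : Subset n) x → lookup q x ≡ true → lookup (p ─ q) x ≡ false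
  go (_ ∷ p) (true ∷ q)  zero    _  = refl
  go (_ ∷ p) (true ∷ q)  (suc x) qx = go p q x qx
  go (_ ∷ p) (false ∷ q) (suc x) qx = go p q x qx

∣value∣≤ : ∀ {N} (f : Fin N → ℕ) (x : Fin N → ℤ) → (∀ e → f e ℕ.≤ 1) →
  ℤ.∣ (λ e → + f e) ∙ x ∣ ℕ.≤ Σℕ.sum (λ e → ℤ.∣ x e ∣)
∣value∣≤ {zero}  f x f≤1 = z≤n
∣value∣≤ {suc N} f x f≤1 = ℕₚ.≤-trans (ℤₚ.∣i+j∣≤∣i∣+∣j∣ (+ f zero ℤ.* x zero) _)
  (ℕₚ.+-mono-≤ (subst₂ ℕ._≤_ (sym (ℤₚ.abs-* (+ f zero) (x zero))) (ℕₚ.*-identityˡ ℤ.∣ x zero ∣)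
      (ℕₚ.*-monoˡ-≤ ℤ.∣ x zero ∣ (f≤1 zero)))
    (∣value∣≤ (f ∘ suc) (x ∘ suc) (f≤1 ∘ suc)))

abs-shift : ∀ N x → ℤ.∣ x ∣ ℕ.≤ N → + ℤ.∣ + N ℤ.+ x ∣ ≡ + N ℤ.+ x
abs-shift N (+ n)        _ = refl
abs-shift N (ℤ.-[1+ n ]) h rewrite ℤₚ.⊖-≥ h = refl

shifted-sum : ∀ {N} (f u c : Fin N → ℕ) (y : Fin N → ℤ) K → (∀ e → + u e ≡ + (K ℕ.* c e) ℤ.+ y e) →
  + Σℕ.sum (λ e → u e ℕ.* f e) ≡ + (K ℕ.* Σℕ.sum (λ e → c e ℕ.* f e)) ℤ.+ (+_ ∘ f) ∙ y
shifted-sum {zero}  f u c y K eq rewrite ℕₚ.*-zeroʳ K = refl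
shifted-sum {suc N} f u c y K eq = begin
  + (u zero ℕ.* f zero) ℤ.+ + Σℕ.sum (λ e → u (suc e) ℕ.* f (suc e))
    ≡⟨ cong₂ ℤ._+_ (ℤₚ.pos-* (u zero) (f zero))
         (shifted-sum (f ∘ suc) (u ∘ suc) (c ∘ suc) (y ∘ suc) K (eq ∘ suc)) ⟩
  + u zero ℤ.* + f zero ℤ.+ (+ (K ℕ.* C) ℤ.+ V)
    ≡⟨ cong₂ (λ p q → p ℤ.* + f zero ℤ.+ (q ℤ.+ V))
         (trans (eq zero) (cong (ℤ._+ y zero) (ℤₚ.pos-* K (c zero)))) (ℤₚ.pos-* K C) ⟩
  (+ K ℤ.* + c zero ℤ.+ y zero) ℤ.* + f zero ℤ.+ (+ K ℤ.* + C ℤ.+ V)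
    ≡⟨ arith (+ K) (+ c zero) (y zero) (+ f zero) (+ C) V ⟩
  + K ℤ.* (+ c zero ℤ.* + f zero ℤ.+ + C) ℤ.+ (+ f zero ℤ.* y zero ℤ.+ V)
    ≡⟨ cong (λ p → + K ℤ.* (p ℤ.+ + C) ℤ.+ (+ f zero ℤ.* y zero ℤ.+ V)) (sym (ℤₚ.pos-* (c zero) (f zero))) ⟩
  + K ℤ.* (+ (c zero ℕ.* f zero ℕ.+ C)) ℤ.+ (+ f zero ℤ.* y zero ℤ.+ V)
    ≡⟨ cong (λ p → p ℤ.+ (+ f zero ℤ.* y zero ℤ.+ V)) (sym (ℤₚ.pos-* K _)) ⟩
  + (K ℕ.* (c zero ℕ.* f zero ℕ.+ C)) ℤ.+ (+ f zero ℤ.* y zero ℤ.+ V) ∎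
  where
  open ≡-Reasoning
  C = Σℕ.sum (λ e → c (suc e) ℕ.* f (suc e))
  V = (+_ ∘ f ∘ suc) ∙ (y ∘ suc)
  arith : ∀ k c y f C V → (k ℤ.* c ℤ.+ y) ℤ.* f ℤ.+ (k ℤ.* C ℤ.+ V) ≡ k ℤ.* (c ℤ.* f ℤ.+ C) ℤ.+ (f ℤ.* y ℤ.+ V)
  arith = ℤ-Solver.solve-∀

∙-neg : ∀ {N} (r v : Fin N → ℤ) → r ∙ (λ e → ℤ.- v e) ≡ ℤ.- (r ∙ v)
∙-neg r v = trans (Σℤ.sum-cong-≗ (λ e → cong (r e ℤ.*_) (sym (ℤₚ.-1*i≡-i (v e)))))
  (trans (∙-scale ℤ.-1ℤ r v) (ℤₚ.-1*i≡-i (r ∙ v)))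

point≤ : ∀ {N} (f : Fin N → ℕ) {i} → 1 ℕ.≤ f i → ∀ j → ⟦ i ≐ j ⟧ ℕ.≤ f j
point≤ f {i} 1≤ j with i Finₚ.≟ j
... | no _     = z≤n
... | yes refl = 1≤

ι-mono : ∀ {j k} → j ℕ.≤ k → ι j ≲ ι k
ι-mono {j} {k} j≤k = subst (λ l → ι j ≲ ι l) (ℕₚ.m+[n∸m]≡n j≤k)
  (≲-respʳ-≃ (ℝ-Ring.sym (ι-+ j (k ℕ.∸ j)))
    (≲-respˡ-≃ (ℝ-Ring.+-identityʳ (ι j)) (⊕-mono-≲ ≲-refl (0≲ι (k ℕ.∸ j)))))

module _ (GT : SteinerGraph) where

  open SteinerGraph GT
  open Cuts (lookup T) end₁ end₂

  weightOf : (Fin edges → ℕ) → (Fin nodes → Bool) → ℕ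
  weightOf a = Weights.weight a 0

  steinerCut⇒steiner : ∀ {S} → SteinerCut S → Steiner (lookup S)
  steinerCut⇒steiner {S} ((x , x∈) , (y , y∈)) =
    (x , []=⇒lookup (proj₁ (x∈p∩q⁻ T S x∈)) , []=⇒lookup (proj₂ (x∈p∩q⁻ T S x∈)))
    , (y , []=⇒lookup (p─q⊆p T S y∈) , Boolₚ.¬-not λ y∈S → x∈p─q⇒x∉q T S y∈ (lookup⇒[]= y S y∈S))

  steiner⇒steinerCut : ∀ {S} → Steiner (lookup S) → SteinerCut S
  steiner⇒steinerCut {S} ((x , Tx , Sx) , (y , Ty , Sy)) =
    (x , x∈p∩q⁺ (lookup⇒[]= x T Tx , lookup⇒[]= x S Sx))
    , (y , x∈p∧x∉q⇒x∈p─q (lookup⇒[]= y T Ty) λ y∈S → true≢false (trans (sym ([]=⇒lookup y∈S)) Sy))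

  χδ : ∀ S e → χ (δ S) e ≡ ι (cut (lookup S) e)
  χδ S e rewrite lookup∘tabulate (λ e → lookup S (end₁ e) xor lookup S (end₂ e)) e
    with lookup S (end₁ e) xor lookup S (end₂ e)
  ... | true  = fromℕ-def 1
  ... | false = fromℕ-def 0

  cutPoint∈CUT₊ : ∀ S → SteinerCut S → (f : Fin edges → ℕ) → CUT₊ (λ e → fromℕ (cut (lookup S) e ℕ.+ f e))
  cutPoint∈CUT₊ S sS f = χ (δ S) , fromℕ ∘ f
    , (1 , (λ _ → χ (δ S)) , (λ _ → 1ℝ) , (λ _ → S , sS , λ e → un≃ (ℝ-Ring.refl {χ (δ S) e}))
        , (λ _ → un≲ (subst₂ _≲_ (sym 0ℝ-def) (sym 1ℝ-def) 0≲1))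
        , un≃ (ℝ-Ring.trans (ℝ-Ring.reflexive (trans (∑-def {1} (λ _ → 1ℝ)) (cong (_⊕ 𝟘) 1ℝ-def)))
            (ℝ-Ring.trans (ℝ-Ring.+-identityʳ 𝟙) (ℝ-Ring.reflexive (sym 1ℝ-def))))
        , λ e → un≃ (ℝ-Ring.sym (ℝ-Ring.trans
            (ℝ-Ring.reflexive (trans (lincomb-def {k = 1} (λ _ → 1ℝ) (λ _ → χ (δ S)) e)
              (cong (λ o → o ⊗ χ (δ S) e ⊕ 𝟘) 1ℝ-def)))
            (ℝ-Ring.trans (ℝ-Ring.+-identityʳ _) (ℝ-Ring.*-identityˡ (χ (δ S) e))))))
    , (λ e → un≲ (subst₂ _≲_ (sym 0ℝ-def) (sym (fromℕ-def (f e))) (0≲ι (f e))))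
    , λ e → un≃ (ℝ-Ring.trans (ℝ-Ring.reflexive (fromℕ-def (cut (lookup S) e ℕ.+ f e)))
        (ℝ-Ring.trans (ι-+ (cut (lookup S) e) (f e))
          (ℝ-Ring.reflexive (trans (cong₂ _⊕_ (sym (χδ S e)) (sym (fromℕ-def (f e))))
            (sym (+-def (χ (δ S) e) (fromℕ (f e))))))))

  CUT₊-valid : ∀ (a : Fin edges → ℕ) b → (∀ X → Steiner X → b ℕ.≤ weightOf a X) →
    ∀ x → CUT₊ x → ι b ≲ eval a x
  CUT₊-valid a b valid x (y , z , (k , p , μ , p∈ , μ≥0 , Σμ , y≋) , z≥0 , x≋) =
    ≲-respʳ-≃ (ℝ-Ring.sym total) (≲-respˡ-≃ (ℝ-Ring.+-identityʳ (ι b)) (⊕-mono-≲ y-bound z-bound))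
    where
    open ≃-Reasoning
    0≲μ : ∀ i → 𝟘 ≲ μ i
    0≲μ i = subst (_≲ μ i) 0ℝ-def (mk≲ (μ≥0 i))
    total : eval a x ≃ eval a y ⊕ eval a z
    total = ℝ-Ring.trans
      (eval-cong a (λ e → ℝ-Ring.trans (mk≃ (x≋ e)) (ℝ-Ring.reflexive (+-def (y e) (z e)))))
      (eval-⊕ a y z)
    z-bound : 𝟘 ≲ eval a z
    z-bound = sum-nonneg (λ e → ι⊗-nonneg (a e) (subst (_≲ z e) 0ℝ-def (mk≲ (z≥0 e))))
    -- The slack of a cut is a natural number, so nonnegativity of its product with `μ i` is mere
    -- repeated addition.
    slack : Fin k → ℕ
    slack i = weightOf a (lookup (proj₁ (p∈ i))) ℕ.∸ b
    eval-p : ∀ i → eval a (p i) ≃ ι b ⊕ ι (slack i)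
    eval-p i = let S , sS , p≋ = p∈ i in begin
      eval a (p i)
        ≈⟨ eval-cong a (λ e → ℝ-Ring.trans (mk≃ (p≋ e)) (ℝ-Ring.reflexive (χδ S e))) ⟩
      eval a (ι ∘ cut (lookup S))     ≈⟨ eval-ι a (cut (lookup S)) ⟩
      ι (weightOf a (lookup S))       ≡⟨ cong ι (ℕₚ.m+[n∸m]≡n (valid _ (steinerCut⇒steiner sS))) ⟨
      ι (b ℕ.+ slack i)               ≈⟨ ι-+ b (slack i) ⟩
      ι b ⊕ ι (slack i)               ∎
    eval-y : eval a y ≃ ι b ⊕ Σℝ.sum (λ i → ι (slack i) ⊗ μ i)
    eval-y = begin
      eval a y ≈⟨ eval-cong a (λ e → ℝ-Ring.trans (mk≃ (y≋ e)) (ℝ-Ring.reflexive (lincomb-def μ p e))) ⟩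
      eval a (λ e → Σℝ.sum (λ i → μ i ⊗ p i e)) ≈⟨ eval-lincomb a μ p ⟩
      Σℝ.sum (λ i → μ i ⊗ eval a (p i))
        ≈⟨ Σℝ.sum-cong-≋ (λ i → ℝ-Ring.trans (ℝ-Ring.*-congˡ (eval-p i))
             (ℝ-Ring.distribˡ (μ i) (ι b) (ι (slack i)))) ⟩
      Σℝ.sum (λ i → μ i ⊗ ι b ⊕ μ i ⊗ ι (slack i))
        ≈⟨ Σℝ.∑-distrib-+ (λ i → μ i ⊗ ι b) (λ i → μ i ⊗ ι (slack i)) ⟩
      Σℝ.sum (λ i → μ i ⊗ ι b) ⊕ Σℝ.sum (λ i → μ i ⊗ ι (slack i))
        ≈⟨ ℝ-Ring.+-cong (ℝ-Ring.sym (Σℝ.*-distribʳ-sum (ι b) μ))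
             (Σℝ.sum-cong-≋ (λ i → ℝ-Ring.*-comm (μ i) (ι (slack i)))) ⟩
      Σℝ.sum μ ⊗ ι b ⊕ Σℝ.sum (λ i → ι (slack i) ⊗ μ i)
        ≈⟨ ℝ-Ring.+-congʳ (ℝ-Ring.trans (ℝ-Ring.*-congʳ (ℝ-Ring.trans (ℝ-Ring.reflexive (sym (∑-def μ)))
             (ℝ-Ring.trans (mk≃ Σμ) (ℝ-Ring.reflexive 1ℝ-def)))) (ℝ-Ring.*-identityˡ (ι b))) ⟩
      ι b ⊕ Σℝ.sum (λ i → ι (slack i) ⊗ μ i) ∎
    y-bound : ι b ≲ eval a y
    y-bound = ≲-respʳ-≃ (ℝ-Ring.sym eval-y) (≲-respˡ-≃ (ℝ-Ring.+-identityʳ (ι b))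
      (⊕-mono-≲ ≲-refl (sum-nonneg (λ i → ι⊗-nonneg (slack i) (0≲μ i)))))

  steinerCutExists : ∀ x → CUT₊ x → ∃ SteinerCut
  steinerCutExists x (_ , _ , (zero , _ , _ , _ , _ , 0≈1 , _) , _) =
    -- A convex combination of no points would have coefficient sum 0 instead of 1.
    let N , close = 0≈1 ½ (ℚₚ.positive⁻¹ ½) in
    contradiction (close N ℕₚ.≤-refl) (toWitnessFalse {a? = ℚ.∣ 0ℚ ℚ.- 1ℚ ∣ ℚₚ.≤? ½} tt)
  steinerCutExists x (_ , _ , (suc k , p , _ , p∈ , _) , _) = let S , sS , _ = p∈ zero in S , sS

  minimalCut : (c : Fin edges → ℕ) → ∃ SteinerCut →
    Σ[ S ∈ Subset nodes ] SteinerCut S × (∀ X → Steiner X → weightOf c (lookup S) ℕ.≤ weightOf c X)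
  minimalCut c (S , sS) = go S sS (<-wellFounded _)
    where
    go : ∀ S → SteinerCut S → Acc ℕ._<_ (weightOf c (lookup S)) →
      Σ[ S ∈ Subset nodes ] SteinerCut S × (∀ X → Steiner X → weightOf c (lookup S) ℕ.≤ weightOf c X)
    go S sS (acc rec) with anySubset? (λ S′ →
      steiner? (lookup S′) ×-dec (weightOf c (lookup S′) ℕₚ.<? weightOf c (lookup S)))
    ... | yes (S′ , sS′ , smaller) = go S′ (steiner⇒steinerCut sS′) (rec smaller)
    ... | no none = S , sS , λ X sX → ℕₚ.≮⇒≥ λ X<S → none (tabulate X
      , steiner-resp (sym ∘ lookup∘tabulate X) sX
      , subst (ℕ._< weightOf c (lookup S)) (sym (Weights.weight-resp c 0 (lookup∘tabulate X))) X<S)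

  facePoint : ∀ c γ → FacetDefining CUT₊ c γ → ∃ (Face CUT₊ c γ)
  facePoint c γ facet = let p , p∈ , _ = proj₁ (proj₂ (proj₂ (proj₂ facet))) in p zero , p∈ zero

  -- From a facet to an extremal integral weight vector

  module FacetBound (c : Fin edges → ℕ) (γ : ℝ) (minimum : MinimumIntegerForm c)
    (facet : FacetDefining CUT₊ (fromℕ ∘ c) γ)
    (S₀ : Subset nodes) (sS₀ : SteinerCut S₀)
    (μ≤ : ∀ X → Steiner X → weightOf c (lookup S₀) ℕ.≤ weightOf c X) where

    s : Fin edges → ℕ
    s = cut (lookup S₀)

    μ : ℕ
    μ = weightOf c (lookup S₀)

    -- A minimum cut is a point of the dominant, so validity gives one inequality; the face has a
    -- point, at which the valid bound `μ` gives the other.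
    γ≃μ : γ ≃ ι μ
    γ≃μ = ≲-antisym upper lower
      where
      point : Vector ℝ edges
      point e = fromℕ (s e ℕ.+ 0)
      eval-point : (fromℕ ∘ c) · point ≃ ι μ
      eval-point = ℝ-Ring.trans (ℝ-Ring.reflexive (trans (eval-def c point)
          (Σℝ.sum-cong-≗ (λ e → cong (ι (c e) ⊗_)
            (trans (cong fromℕ (ℕₚ.+-identityʳ (s e))) (fromℕ-def (s e)))))))
        (eval-ι c s)
      upper : γ ≲ ι μ
      upper = ≲-respʳ-≃ eval-point (mk≲ (proj₁ facet point (cutPoint∈CUT₊ S₀ sS₀ (λ _ → 0))))
      lower : ι μ ≲ γ
      lower = let p , p∈ , cp≈γ = facePoint (fromℕ ∘ c) γ facet in
        ≲-respʳ-≃ (mk≃ cp≈γ) (subst (ι μ ≲_) (sym (eval-def c p)) (CUT₊-valid c μ μ≤ p p∈))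

    extreme : ∀ (u w : Fin edges → ℕ) k b b′ →
      (∀ X → Steiner X → b ℕ.≤ weightOf u X) → (∀ X → Steiner X → b′ ℕ.≤ weightOf w X) →
      (∀ e → u e ℕ.+ w e ≡ k ℕ.* c e) → b ℕ.+ b′ ≡ k ℕ.* μ → ∀ i j → u i ℕ.* c j ≡ u j ℕ.* c i
    extreme u w k b b′ u-valid w-valid = facet-extreme CUT₊ c γ facet s
      (λ i → cutPoint∈CUT₊ S₀ sS₀ (⟦_⟧ ∘ (i ≐_))) μ γ≃μ refl u w k b b′
      (CUT₊-valid u b u-valid) (CUT₊-valid w b′ w-valid)
      (u-valid _ (steinerCut⇒steiner sS₀)) (w-valid _ (steinerCut⇒steiner sS₀))

    coprime : ∀ k d → (∀ e → d ∣ k ℕ.* c e) → d ∣ k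
    coprime k d div = subst (d ∣_) (trans (cong (k ℕ.*_) minimum) (ℕₚ.*-identityʳ k))
      (foldr-gcd-greatest k d c div)

    -- If `c e` is positive, the unit vector at `e` and the remainder of `c` both give valid
    -- inequalities with right-hand side 0. Hence `c` is a multiple of that unit vector, `c e`
    -- divides all weights, and coprimality makes it 1.
    unitVector : μ ≡ 0 → ∀ e → c e ℕ.≤ 1
    unitVector μ≡0 e = go (c e) refl
      where
      complement : 1 ℕ.≤ c e → ∀ f → ⟦ e ≐ f ⟧ ℕ.+ (c f ℕ.∸ ⟦ e ≐ f ⟧) ≡ 1 ℕ.* c f
      complement 1≤ f = trans (ℕₚ.m+[n∸m]≡n (point≤ c 1≤ f)) (sym (ℕₚ.*-identityˡ (c f)))
      multiple : 1 ℕ.≤ c e → ∀ f → 1 ℕ.* c f ≡ ⟦ e ≐ f ⟧ ℕ.* c e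
      multiple 1≤ f = subst (λ β → ⟦ β ⟧ ℕ.* c f ≡ ⟦ e ≐ f ⟧ ℕ.* c e) (≐-refl e)
        (extreme (⟦_⟧ ∘ (e ≐_)) (λ f → c f ℕ.∸ ⟦ e ≐ f ⟧) 1 0 0 (λ _ _ → z≤n) (λ _ _ → z≤n)
          (complement 1≤) (sym (trans (ℕₚ.*-identityˡ μ) μ≡0)) e f)
      go : ∀ l → c e ≡ l → c e ℕ.≤ 1
      go zero    ce = subst (ℕ._≤ 1) (sym ce) z≤n
      go (suc l) ce = ∣.∣⇒≤ (coprime 1 (c e) λ f →
        ∣.divides ⟦ e ≐ f ⟧ (multiple (subst (1 ℕ.≤_) (sym ce) (s≤s z≤n)) f))

    open Weights c μ using (Tight; Supported; Extremal)

    module Perturb (x : Fin edges → ℤ) (sx : Supported x) (killed : ∀ X → Tight X → value x X ≡ 0ℤ)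
      (K : ℕ) (Σ∣x∣≤K : Σℕ.sum (λ e → ℤ.∣ x e ∣) ℕ.≤ K) where

      -- The vector `K c + x` read in the naturals. The absolute value changes nothing: on live
      -- edges `∣ x e ∣` is at most `K`, and on the others `x` is 0.
      perturbed : Fin edges → ℕ
      perturbed e = ℤ.∣ + (K ℕ.* c e) ℤ.+ x e ∣

      +perturbed : ∀ e → + perturbed e ≡ + (K ℕ.* c e) ℤ.+ x e
      +perturbed e = abs-shift (K ℕ.* c e) (x e) (go (c e) refl)
        where
        go : ∀ l → c e ≡ l → ℤ.∣ x e ∣ ℕ.≤ K ℕ.* l
        go zero    ce = subst (λ i → ℤ.∣ i ∣ ℕ.≤ K ℕ.* 0) (sym (sx e (cong live ce))) z≤n
        go (suc l) ce = ℕₚ.≤-trans (ℕₚ.≤-trans (term≤sum (λ e → ℤ.∣ x e ∣) e) Σ∣x∣≤K) (ℕₚ.m≤m*n K (suc l))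

      weight-lower : ∀ X → K ℕ.* weightOf c X ℕ.≤ weightOf perturbed X ℕ.+ ℤ.∣ value x X ∣
      weight-lower X = subst (ℕ._≤ weightOf perturbed X ℕ.+ ℤ.∣ value x X ∣) (cong ℤ.∣_∣ difference)
        (ℤₚ.∣i-j∣≤∣i∣+∣j∣ (+ weightOf perturbed X) (value x X))
        where
        arith : ∀ p q → (p ℤ.+ q) ℤ.- q ≡ p
        arith = ℤ-Solver.solve-∀
        difference : + weightOf perturbed X ℤ.- value x X ≡ + (K ℕ.* weightOf c X)
        difference = trans (cong (ℤ._- value x X) (shifted-sum (cut X) perturbed c x K +perturbed))
          (arith (+ (K ℕ.* weightOf c X)) (value x X))

      -- On a tight cut `x` contributes nothing. Any other Steiner cut weighs at least `μ + 1` by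
      -- integrality, which gains `K`, while `x` takes away at most the sum of its absolute values.
      perturbed-valid : ∀ X → Steiner X → K ℕ.* μ ℕ.≤ weightOf perturbed X
      perturbed-valid X sX = [ slack , tight ]′ (ℕₚ.m≤n⇒m<n∨m≡n (μ≤ X sX))
        where
        open ℕₚ.≤-Reasoning
        tight : μ ≡ weightOf c X → K ℕ.* μ ℕ.≤ weightOf perturbed X
        tight μ≡W = begin
          K ℕ.* μ              ≡⟨ cong (K ℕ.*_) μ≡W ⟩
          K ℕ.* weightOf c X   ≤⟨ weight-lower X ⟩
          weightOf perturbed X ℕ.+ ℤ.∣ value x X ∣
            ≡⟨ cong (λ i → weightOf perturbed X ℕ.+ ℤ.∣ i ∣) (killed X (sX , sym μ≡W)) ⟩
          weightOf perturbed X ℕ.+ 0 ≡⟨ ℕₚ.+-identityʳ _ ⟩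
          weightOf perturbed X ∎
        slack : μ ℕ.< weightOf c X → K ℕ.* μ ℕ.≤ weightOf perturbed X
        slack μ<W = ℕₚ.+-cancelˡ-≤ K (K ℕ.* μ) (weightOf perturbed X) (begin
          K ℕ.+ K ℕ.* μ        ≡⟨ ℕₚ.*-suc K μ ⟨
          K ℕ.* suc μ          ≤⟨ ℕₚ.*-monoʳ-≤ K μ<W ⟩
          K ℕ.* weightOf c X   ≤⟨ weight-lower X ⟩
          weightOf perturbed X ℕ.+ ℤ.∣ value x X ∣
            ≤⟨ ℕₚ.+-monoʳ-≤ _ (ℕₚ.≤-trans
                 (∣value∣≤ (cut X) x (λ e → ⟦⟧≤1 (X (end₁ e) xor X (end₂ e)))) Σ∣x∣≤K) ⟩
          weightOf perturbed X ℕ.+ K ≡⟨ ℕₚ.+-comm (weightOf perturbed X) K ⟩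
          K ℕ.+ weightOf perturbed X ∎)

    -- The perturbations by `x` and by `- x` split `2K c`, so `K c + x` and therefore `x` is
    -- proportional to `c`. On the minimum cut `S₀` the value of `x` is 0 and that of `c` is the
    -- positive `μ`, which leaves only `x = 0`.
    rigid : 0 ℕ.< μ → ∀ x → Supported x → (∀ X → Tight X → value x X ≡ 0ℤ) → ∀ e → x e ≡ 0ℤ
    rigid 0<μ x sx killed i = nonzero (ℤₚ.i*j≡0⇒i≡0∨j≡0 (x i) (begin
      x i ℤ.* + μ ≡⟨ cong (x i ℤ.*_) (∙-pos s c) ⟨
      x i ℤ.* (+_ ∘ s) ∙ (+_ ∘ c) ≡⟨ ∙-scale (x i) (+_ ∘ s) (+_ ∘ c) ⟨
      (+_ ∘ s) ∙ (λ j → x i ℤ.* + c j)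
        ≡⟨ Σℤ.sum-cong-≗ (λ j → cong (+ s j ℤ.*_) (trans (proportional i j) (ℤₚ.*-comm (x j) (+ c i)))) ⟩
      (+_ ∘ s) ∙ (λ j → + c i ℤ.* x j) ≡⟨ ∙-scale (+ c i) (+_ ∘ s) x ⟩
      + c i ℤ.* value x (lookup S₀) ≡⟨ cong (+ c i ℤ.*_) (killed (lookup S₀) (steinerCut⇒steiner sS₀ , refl)) ⟩
      + c i ℤ.* 0ℤ ≡⟨ ℤₚ.*-zeroʳ (+ c i) ⟩
      0ℤ ∎))
      where
      open ≡-Reasoning
      K = Σℕ.sum (λ e → ℤ.∣ x e ∣)
      neg : Fin edges → ℤ
      neg e = ℤ.- x e
      module U = Perturb x sx killed K ℕₚ.≤-refl
      module W = Perturb neg (λ e le → cong ℤ.-_ (sx e le))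
        (λ X tX → trans (∙-neg (+_ ∘ cut X) x) (cong ℤ.-_ (killed X tX)))
        K (ℕₚ.≤-reflexive (Σℕ.sum-cong-≗ (ℤₚ.∣-i∣≡∣i∣ ∘ x)))
      double : ∀ e → U.perturbed e ℕ.+ W.perturbed e ≡ (K ℕ.+ K) ℕ.* c e
      double e = ℤₚ.+-injective (begin
        + U.perturbed e ℤ.+ + W.perturbed e ≡⟨ cong₂ ℤ._+_ (U.+perturbed e) (W.+perturbed e) ⟩
        (+ (K ℕ.* c e) ℤ.+ x e) ℤ.+ (+ (K ℕ.* c e) ℤ.+ neg e) ≡⟨ arith (+ (K ℕ.* c e)) (x e) ⟩
        + (K ℕ.* c e ℕ.+ K ℕ.* c e) ≡⟨ cong +_ (ℕₚ.*-distribʳ-+ (c e) K K) ⟨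
        + ((K ℕ.+ K) ℕ.* c e) ∎)
        where
        arith : ∀ p q → (p ℤ.+ q) ℤ.+ (p ℤ.+ ℤ.- q) ≡ p ℤ.+ p
        arith = ℤ-Solver.solve-∀
      proportional : ∀ i j → x i ℤ.* + c j ≡ x j ℤ.* + c i
      proportional i j = cancel (begin
        (+ K ℤ.* + c i ℤ.+ x i) ℤ.* + c j ≡⟨ cong (ℤ._* + c j) (shift i) ⟨
        + U.perturbed i ℤ.* + c j         ≡⟨ ℤₚ.pos-* (U.perturbed i) (c j) ⟨
        + (U.perturbed i ℕ.* c j)
          ≡⟨ cong +_ (extreme U.perturbed W.perturbed (K ℕ.+ K) (K ℕ.* μ) (K ℕ.* μ)
               U.perturbed-valid W.perturbed-valid double (sym (ℕₚ.*-distribʳ-+ μ K K)) i j) ⟩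
        + (U.perturbed j ℕ.* c i)         ≡⟨ ℤₚ.pos-* (U.perturbed j) (c i) ⟩
        + U.perturbed j ℤ.* + c i         ≡⟨ cong (ℤ._* + c i) (shift j) ⟩
        (+ K ℤ.* + c j ℤ.+ x j) ℤ.* + c i ∎)
        where
        shift : ∀ e → + U.perturbed e ≡ + K ℤ.* + c e ℤ.+ x e
        shift e = trans (U.+perturbed e) (cong (ℤ._+ x e) (ℤₚ.pos-* K (c e)))
        arith : ∀ k p q y → (k ℤ.* p ℤ.+ y) ℤ.* q ≡ k ℤ.* p ℤ.* q ℤ.+ y ℤ.* q
        arith = ℤ-Solver.solve-∀
        swap : ∀ k p q → k ℤ.* p ℤ.* q ≡ k ℤ.* q ℤ.* p
        swap = ℤ-Solver.solve-∀
        cancel : (+ K ℤ.* + c i ℤ.+ x i) ℤ.* + c j ≡ (+ K ℤ.* + c j ℤ.+ x j) ℤ.* + c i →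
          x i ℤ.* + c j ≡ x j ℤ.* + c i
        cancel eq = ℤ-Group.∙-cancelˡ (+ K ℤ.* + c i ℤ.* + c j) _ _
          (trans (sym (arith (+ K) (+ c i) (+ c j) (x i))) (trans eq (trans (arith (+ K) (+ c j) (+ c i) (x j))
            (cong (ℤ._+ x j ℤ.* + c i) (swap (+ K) (+ c j) (+ c i))))))
      nonzero : x i ≡ 0ℤ ⊎ + μ ≡ 0ℤ → x i ≡ 0ℤ
      nonzero (inj₁ xi≡0) = xi≡0
      nonzero (inj₂ μ≡0)  = contradiction (sym (ℤₚ.+-injective μ≡0)) (ℕₚ.<⇒≢ 0<μ)

    bound : ℕ
    bound = kernelBound 1 (suc (6 ℕ.* ∣ T ∣))

    bounded : μ ℕ.≤ bound × (∀ e → c e ℕ.≤ bound)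
    bounded = go (μ ℕₚ.≟ 0)
      where
      go : Dec (μ ≡ 0) → μ ℕ.≤ bound × (∀ e → c e ℕ.≤ bound)
      go (yes μ≡0) = subst (ℕ._≤ bound) (sym μ≡0) z≤n , λ e → ℕₚ.≤-trans (unitVector μ≡0 e) (s≤s z≤n)
      go (no μ≢0)  = μ≤bound , λ e → ℕₚ.≤-trans (Reduction.weight≤γ (lookup T) end₁ end₂ c μ extremal e) μ≤bound
        where
        extremal : Extremal
        extremal = record
          { positive = ℕₚ.n≢0⇒n>0 μ≢0
          ; valid    = μ≤
          ; rigid    = rigid (ℕₚ.n≢0⇒n>0 μ≢0)
          ; coprime  = coprime
          }
        μ≤bound : μ ℕ.≤ bound
        μ≤bound = subst (λ t → μ ℕ.≤ kernelBound 1 (suc (6 ℕ.* t))) (count-lookup T)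
          (extremal-bound (lookup T) end₁ end₂ c μ extremal)

theorem5 : Σ[ g ∈ (ℕ → ℕ) ]
    (∀ (GT : SteinerGraph) → let open SteinerGraph GT in
    ∀ (c : Vector ℕ edges) (γ : ℝ) →
    MinimumIntegerForm c →
    FacetDefining CUT₊ (fromℕ ∘ c) γ →
    γ ≤ fromℕ (g ∣ T ∣) × (∀ e → c e ℕ.≤ g ∣ T ∣))
theorem5 = (λ t → kernelBound 1 (suc (6 ℕ.* t))) , λ GT c γ minimum facet →
  let p , p∈ , _ = facePoint GT (fromℕ ∘ c) γ facet
      S , sS , min = minimalCut GT c (steinerCutExists GT p p∈)
      open FacetBound GT c γ minimum facet S sS min
  in un≲ (subst (γ ≲_) (sym (fromℕ-def _)) (≲-trans (≃⇒≲ γ≃μ) (ι-mono (proj₁ bounded)))) , proj₂ bounded
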